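{- Let $\Phi=(G,\varphi)$ be a complex unit gain graph of order $n$ whose underlying graph $G$ has at least one edge. Then $$1-\theta(G)\leq\frac{r(\Phi)}{r(G)}\leq1+\theta(G).$$ Moreover: (a) equality holds in the upper bound if and only if either $\Phi$ is acyclic, or $\Phi$ consists of one gain cycle $C_4^{\varphi}$ of Type B together with some isolated vertices; (b) equality holds in the lower bound if and only if $\Phi$ is acyclic.
   Context: A complex unit gain graph $\Phi=(G,\varphi)$ consists of a finite simple graph $G$ (the underlying graph) with vertex set $\{v_1,\dots,v_n\}$ and a gain function $\varphi$ assigning to each oriented edge $e_{ij}$ (from $v_i$ to $v_j$, where $v_iv_j\in E(G)$) a complex number of modulus $1$, with $\varphi(e_{ji})=\overline{\varphi(e_{ij})}$. The adjacency matrix $A(\Phi)$ is the Hermitian matrix with $(i,j)$ entry $\varphi(e_{ij})$ if $v_iv_j\in E(G)$ and $0$ otherwise; $r(\Phi)$ is its rank, and $r(G)$ is the rank of the $0$-$1$ adjacency matrix of $G$. $\theta(G)=|E(G)|-|V(G)|+\omega(G)$, where $\omega(G)$ is the number of connected components of $G$. $\Phi$ is acyclic if $G$ has no cycle. For a gain cycle $C_n^{\varphi}$ with vertices $v_1,\dots,v_n$ in cyclic order, $\varphi(C_n)=\varphi(e_{12})\varphi(e_{23})\cdots\varphi(e_{n-1,n})\varphi(e_{n1})$; for $n$ even, $C_n^\varphi$ is of Type A if $\varphi(C_n)=(-1)^{n/2}$ and of Type B if $\varphi(C_n)\neq(-1)^{n/2}$. -}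

module Defs where

open import Algebra.Bundles.Raw using (RawRing)
import Algebra.Definitions.RawSemiring as RawSemiringDefinitions
open import Data.Bool using (Bool; T)
open import Data.Bool.Properties using (T?)
open import Data.Fin using (Fin; toℕ; punchIn; punchOut)
import Data.Fin as Fin
import Data.Fin.Properties as Fin
open import Data.Fin.Subset using (Subset; _∉_; ∣_∣; ⊥)
open import Data.Fin.Subset.Properties using (∉⊥; ∣p∣≤n)
open import Data.Integer using (ℤ; +_)
import Data.Integer as ℤ
open import Data.List using (List; []; _∷_; length; filter; allFin; cartesianProduct)
open import Data.List.Membership.Propositional.Properties using (∈-allFin; ∈-cartesianProduct⁺)
open import Data.List.Relation.Unary.All using (All; []; _∷_; lookup)
import Data.List.Relation.Unary.All as All
open import Data.Nat using (ℕ; zero; suc; _≤_; _⊔_; ⌊_/2⌋)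
import Data.Nat as ℕ
import Data.Nat.Properties as ℕ
open import Data.Nat.Divisibility using (_∣_)
open import Data.Nat.DivMod using (_mod_)
open import Data.Product using (∃; ∃₂; _×_; _,_; proj₁; proj₂)
open import Data.Rational using (ℚ; 0ℚ; 1ℚ; ½)
import Data.Rational as ℚ
import Data.Rational.Properties as ℚ
open import Data.Rational.Solver using (module +-*-Solver)
open import Data.Sum using (_⊎_; inj₁; inj₂)
open import Function using (_∘_; _⇔_; mk⇔)
open import Function.Definitions using (Injective)
open import Level using (0ℓ)
open import Relation.Binary.Construct.Closure.ReflexiveTransitive using (Star; _◅_; _◅◅_; reverse) renaming (ε to nil)
open import Relation.Binary.PropositionalEquality
open import Relation.Nullary using (¬_; yes; no; contradiction)
open import Relation.Nullary.Decidable using (_×-dec_)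

------------------------------------------------------------------------
-- Real numbers: Cauchy sequences of rationals modulo null sequences.
-- The quotient is carried by the equivalence _≃_, and the operations are
-- pointwise.

IsCauchy : (ℕ → ℚ) → Set
IsCauchy x = ∀ ε → 0ℚ ℚ.< ε → ∃ λ N → ∀ m n → N ≤ m → N ≤ n → ℚ.∣ x m ℚ.- x n ∣ ℚ.< ε

record ℝ : Set where
  constructor mkℝ
  field
    seq    : ℕ → ℚ
    cauchy : IsCauchy seq

open ℝ public

infix 4 _≃_
_≃_ : ℝ → ℝ → Set
x ≃ y = ∀ ε → 0ℚ ℚ.< ε → ∃ λ N → ∀ n → N ≤ n → ℚ.∣ seq x n ℚ.- seq y n ∣ ℚ.< ε

private
  open +-*-Solver using (solve; _:=_; _:+_; _:*_; _:-_; :-_)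

  0<½* : ∀ {ε} → 0ℚ ℚ.< ε → 0ℚ ℚ.< ½ ℚ.* ε
  0<½* {ε} 0<ε = ℚ.positive⁻¹ (½ ℚ.* ε) {{ℚ.pos*pos⇒pos ½ ε {{ℚ.positive 0<ε}}}}

  ½*+½* : ∀ ε → ½ ℚ.* ε ℚ.+ ½ ℚ.* ε ≡ ε
  ½*+½* ε = trans (sym (ℚ.*-distribʳ-+ ε ½ ½)) (ℚ.*-identityˡ ε)

  -- Opaque, so that normalising an expression in ℝ does not unfold these proofs.
  abstract
    const-cauchy : ∀ q → IsCauchy (λ _ → q)
    const-cauchy q ε 0<ε = 0 , λ _ _ _ _ → subst (λ p → ℚ.∣ p ∣ ℚ.< ε) (sym (ℚ.+-inverseʳ q)) 0<ε

    +-cauchy : ∀ {x y} → IsCauchy x → IsCauchy y → IsCauchy (λ n → x n ℚ.+ y n)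
    +-cauchy {x} {y} cx cy ε 0<ε =
      let M , hM = cx (½ ℚ.* ε) (0<½* 0<ε)
          N , hN = cy (½ ℚ.* ε) (0<½* 0<ε)
      in M ⊔ N , λ m n m≥ n≥ → begin-strict
        ℚ.∣ (x m ℚ.+ y m) ℚ.- (x n ℚ.+ y n) ∣
          ≡⟨ cong ℚ.∣_∣ (solve 4 (λ a b c d → (a :+ b) :- (c :+ d) := (a :- c) :+ (b :- d))
                          refl (x m) (y m) (x n) (y n)) ⟩
        ℚ.∣ (x m ℚ.- x n) ℚ.+ (y m ℚ.- y n) ∣
          ≤⟨ ℚ.∣p+q∣≤∣p∣+∣q∣ (x m ℚ.- x n) (y m ℚ.- y n) ⟩
        ℚ.∣ x m ℚ.- x n ∣ ℚ.+ ℚ.∣ y m ℚ.- y n ∣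
          <⟨ ℚ.+-mono-< (hM m n (ℕ.m⊔n≤o⇒m≤o M N m≥) (ℕ.m⊔n≤o⇒m≤o M N n≥))
                        (hN m n (ℕ.m⊔n≤o⇒n≤o M N m≥) (ℕ.m⊔n≤o⇒n≤o M N n≥)) ⟩
        ½ ℚ.* ε ℚ.+ ½ ℚ.* ε  ≡⟨ ½*+½* ε ⟩
        ε ∎
      where open ℚ.≤-Reasoning

    neg-cauchy : ∀ {x} → IsCauchy x → IsCauchy (λ n → ℚ.- x n)
    neg-cauchy {x} cx ε 0<ε =
      let N , hN = cx ε 0<ε
      in N , λ m n m≥ n≥ → subst (ℚ._< ε)
           (trans (sym (ℚ.∣-p∣≡∣p∣ (x m ℚ.- x n)))
                  (cong ℚ.∣_∣ (solve 2 (λ a b → :- (a :- b) := (:- a) :- (:- b)) refl (x m) (x n))))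
           (hN m n m≥ n≥)

    eventually-bounded : ∀ {x} → IsCauchy x →
                         ∃₂ λ B N → 0ℚ ℚ.< B × (∀ n → N ≤ n → ℚ.∣ x n ∣ ℚ.≤ B)
    eventually-bounded {x} cx =
      let N , hN = cx 1ℚ (ℚ.positive⁻¹ 1ℚ)
      in 1ℚ ℚ.+ ℚ.∣ x N ∣ , N
       , ℚ.+-mono-<-≤ {0ℚ} {1ℚ} {0ℚ} (ℚ.positive⁻¹ 1ℚ) (ℚ.0≤∣p∣ (x N))
       , λ n n≥ → begin
           ℚ.∣ x n ∣
             ≡⟨ cong ℚ.∣_∣ (solve 2 (λ a b → a := (a :- b) :+ b) refl (x n) (x N)) ⟩
           ℚ.∣ (x n ℚ.- x N) ℚ.+ x N ∣        ≤⟨ ℚ.∣p+q∣≤∣p∣+∣q∣ (x n ℚ.- x N) (x N) ⟩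
           ℚ.∣ x n ℚ.- x N ∣ ℚ.+ ℚ.∣ x N ∣
             ≤⟨ ℚ.+-monoˡ-≤ ℚ.∣ x N ∣ (ℚ.<⇒≤ (hN n N n≥ ℕ.≤-refl)) ⟩
           1ℚ ℚ.+ ℚ.∣ x N ∣ ∎
      where open ℚ.≤-Reasoning

    small : ∀ B .{{_ : ℚ.Positive B}} η p q → ℚ.∣ p ∣ ℚ.≤ B →
            ℚ.∣ q ∣ ℚ.< (ℚ.1/ B) {{ℚ.pos⇒nonZero B}} ℚ.* η → ℚ.∣ p ℚ.* q ∣ ℚ.< η
    small B η p q hp hq = begin-strict
      ℚ.∣ p ℚ.* q ∣          ≡⟨ ℚ.∣p*q∣≡∣p∣*∣q∣ p q ⟩
      ℚ.∣ p ∣ ℚ.* ℚ.∣ q ∣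
        ≤⟨ ℚ.*-monoʳ-≤-nonNeg ℚ.∣ q ∣ {{ℚ.nonNegative (ℚ.0≤∣p∣ q)}} hp ⟩
      B ℚ.* ℚ.∣ q ∣          <⟨ ℚ.*-monoʳ-<-pos B hq ⟩
      B ℚ.* (ℚ.1/ B ℚ.* η)   ≡⟨ ℚ.*-assoc B (ℚ.1/ B) η ⟨
      B ℚ.* ℚ.1/ B ℚ.* η     ≡⟨ cong (ℚ._* η) (ℚ.*-inverseʳ B) ⟩
      1ℚ ℚ.* η               ≡⟨ ℚ.*-identityˡ η ⟩
      η ∎
      where
      open ℚ.≤-Reasoning
      instance
        B≢0 : ℚ.NonZero B
        B≢0 = ℚ.pos⇒nonZero B

    *-cauchy : ∀ {x y} → IsCauchy x → IsCauchy y → IsCauchy (λ n → x n ℚ.* y n)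
    *-cauchy {x} {y} cx cy ε 0<ε =
      let Bx , Nx , 0<Bx , hBx = eventually-bounded {x} cx
          By , Ny , 0<By , hBy = eventually-bounded {y} cy
          M , hM = cx (δ By 0<By) (0<δ By 0<By)
          N , hN = cy (δ Bx 0<Bx) (0<δ Bx 0<Bx)
      in (M ⊔ N) ⊔ (Nx ⊔ Ny) , λ m n m≥ n≥ →
        let m≥MN = ℕ.m⊔n≤o⇒m≤o (M ⊔ N) (Nx ⊔ Ny) m≥
            n≥MN = ℕ.m⊔n≤o⇒m≤o (M ⊔ N) (Nx ⊔ Ny) n≥
            m≥Nx = ℕ.m⊔n≤o⇒m≤o Nx Ny (ℕ.m⊔n≤o⇒n≤o (M ⊔ N) (Nx ⊔ Ny) m≥)
            n≥Ny = ℕ.m⊔n≤o⇒n≤o Nx Ny (ℕ.m⊔n≤o⇒n≤o (M ⊔ N) (Nx ⊔ Ny) n≥)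
            dx<  = hM m n (ℕ.m⊔n≤o⇒m≤o M N m≥MN) (ℕ.m⊔n≤o⇒m≤o M N n≥MN)
            dy<  = hN m n (ℕ.m⊔n≤o⇒n≤o M N m≥MN) (ℕ.m⊔n≤o⇒n≤o M N n≥MN)
        in combine m n
             (small Bx {{ℚ.positive 0<Bx}} (½ ℚ.* ε) (x m) (y m ℚ.- y n) (hBx m m≥Nx) dy<)
             (small By {{ℚ.positive 0<By}} (½ ℚ.* ε) (y n) (x m ℚ.- x n) (hBy n n≥Ny) dx<)
      where
      δ : ∀ B → 0ℚ ℚ.< B → ℚ
      δ B 0<B = (ℚ.1/ B) {{ℚ.pos⇒nonZero B {{ℚ.positive 0<B}}}} ℚ.* (½ ℚ.* ε)

      0<δ : ∀ B 0<B → 0ℚ ℚ.< δ B 0<B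
      0<δ B 0<B = ℚ.positive⁻¹ (δ B 0<B)
        {{ℚ.pos*pos⇒pos ((ℚ.1/ B) {{ℚ.pos⇒nonZero B {{ℚ.positive 0<B}}}})
                        {{ℚ.1/pos⇒pos B {{ℚ.positive 0<B}}}}
                        (½ ℚ.* ε) {{ℚ.positive (0<½* 0<ε)}}}}

      combine : ∀ m n → ℚ.∣ x m ℚ.* (y m ℚ.- y n) ∣ ℚ.< ½ ℚ.* ε →
                ℚ.∣ y n ℚ.* (x m ℚ.- x n) ∣ ℚ.< ½ ℚ.* ε →
                ℚ.∣ x m ℚ.* y m ℚ.- x n ℚ.* y n ∣ ℚ.< ε
      combine m n h₁ h₂ = begin-strict
        ℚ.∣ x m ℚ.* y m ℚ.- x n ℚ.* y n ∣
          ≡⟨ cong ℚ.∣_∣ (solve 4 (λ a b c d → a :* b :- c :* d := a :* (b :- d) :+ d :* (a :- c))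
                          refl (x m) (y m) (x n) (y n)) ⟩
        ℚ.∣ x m ℚ.* (y m ℚ.- y n) ℚ.+ y n ℚ.* (x m ℚ.- x n) ∣
          ≤⟨ ℚ.∣p+q∣≤∣p∣+∣q∣ (x m ℚ.* (y m ℚ.- y n)) (y n ℚ.* (x m ℚ.- x n)) ⟩
        ℚ.∣ x m ℚ.* (y m ℚ.- y n) ∣ ℚ.+ ℚ.∣ y n ℚ.* (x m ℚ.- x n) ∣  <⟨ ℚ.+-mono-< h₁ h₂ ⟩
        ½ ℚ.* ε ℚ.+ ½ ℚ.* ε  ≡⟨ ½*+½* ε ⟩
        ε ∎
        where open ℚ.≤-Reasoning

infixl 6 _+ᴿ_
infixl 7 _*ᴿ_
infix  8 -ᴿ_

fromℚ : ℚ → ℝ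
fromℚ q = mkℝ (λ _ → q) (const-cauchy q)

0ᴿ 1ᴿ : ℝ
0ᴿ = fromℚ 0ℚ
1ᴿ = fromℚ 1ℚ

_+ᴿ_ _*ᴿ_ : ℝ → ℝ → ℝ
x +ᴿ y = mkℝ (λ n → seq x n ℚ.+ seq y n) (+-cauchy {seq x} {seq y} (cauchy x) (cauchy y))
x *ᴿ y = mkℝ (λ n → seq x n ℚ.* seq y n) (*-cauchy {seq x} {seq y} (cauchy x) (cauchy y))

-ᴿ_ : ℝ → ℝ
-ᴿ x = mkℝ (λ n → ℚ.- seq x n) (neg-cauchy {seq x} (cauchy x))

------------------------------------------------------------------------
-- Complex numbers

record ℂ : Set where
  constructor _+i_
  field
    re im : ℝ

open ℂ public

ℂ-rawRing : RawRing 0ℓ 0ℓ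
ℂ-rawRing = record
  { Carrier = ℂ
  ; _≈_     = λ z w → re z ≃ re w × im z ≃ im w
  ; _+_     = λ z w → (re z +ᴿ re w) +i (im z +ᴿ im w)
  ; _*_     = λ z w → (re z *ᴿ re w +ᴿ -ᴿ (im z *ᴿ im w)) +i (re z *ᴿ im w +ᴿ im z *ᴿ re w)
  ; -_      = λ z → (-ᴿ re z) +i (-ᴿ im z)
  ; 0#      = 0ᴿ +i 0ᴿ
  ; 1#      = 1ᴿ +i 0ᴿ
  }

module ℂᵣ where
  open RawRing ℂ-rawRing public
  open RawSemiringDefinitions rawSemiring public using (sum; product; _^_)

conj : ℂ → ℂ
conj z = re z +i (-ᴿ im z)

-- |z| = 1, written without the square root: the modulus is the nonnegative
-- root of re² + im², and that root is 1 exactly when re² + im² is 1.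
HasModulusOne : ℂ → Set
HasModulusOne z = re z *ᴿ re z +ᴿ im z *ᴿ im z ≃ 1ᴿ

------------------------------------------------------------------------
-- Rank

Matrix : ℕ → ℕ → Set
Matrix m n = Fin m → Fin n → ℂ

-- The columns of A with index in S are linearly independent: a family of
-- coefficients on S is given by a vector vanishing off S.
IndependentColumns : ∀ {m n} → Matrix m n → Subset n → Set
IndependentColumns {m} {n} A S =
  (c : Fin n → ℂ) → (∀ j → j ∉ S → c j ℂᵣ.≈ ℂᵣ.0#) →
  (∀ i → ℂᵣ.sum (λ j → A i j ℂᵣ.* c j) ℂᵣ.≈ ℂᵣ.0#) →
  ∀ j → c j ℂᵣ.≈ ℂᵣ.0#

-- The rank is the maximal number of linearly independent columns. It is a
-- relation, not a function, because equality of complex numbers is not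
-- decidable; rank-unique and rank-exists show that it determines the rank.
record HasRank {m n} (A : Matrix m n) (r : ℕ) : Set where
  field
    attained : ∃ λ S → ∣ S ∣ ≡ r × IndependentColumns A S
    maximal  : ∀ S → IndependentColumns A S → ∣ S ∣ ≤ r

rank-unique : ∀ {m n} {A : Matrix m n} {r s} → HasRank A r → HasRank A s → r ≡ s
rank-unique p q = ℕ.≤-antisym (le p q) (le q p)
  where
  le : ∀ {m n} {A : Matrix m n} {r s} → HasRank A r → HasRank A s → r ≤ s
  le p q = let S , ∣S∣≡r , ind = HasRank.attained p
           in subst (_≤ _) ∣S∣≡r (HasRank.maximal q S ind)

rank-exists : ∀ {m n} (A : Matrix m n) → ¬ ¬ ∃ (HasRank A)
rank-exists {m} {n} A no-rank =
  search (suc n) ⊥ (λ c off _ j → off j ∉⊥) (ℕ.s≤s (ℕ.m≤m+n n _))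
  where
  search : ∀ d S → IndependentColumns A S → ¬ (n ℕ.< d ℕ.+ ∣ S ∣)
  search zero    S ind n< = contradiction (∣p∣≤n S) (ℕ.<⇒≱ n<)
  search (suc d) S ind n< = no-rank (∣ S ∣ , record
    { attained = S , refl , ind
    ; maximal  = max
    })
    where
    max : ∀ S′ → IndependentColumns A S′ → ∣ S′ ∣ ≤ ∣ S ∣
    max S′ ind′ with ∣ S′ ∣ ℕ.≤? ∣ S ∣
    ... | yes le = le
    ... | no ≰   = contradiction
      (ℕ.<-≤-trans n< (subst (ℕ._≤ d ℕ.+ ∣ S′ ∣) (ℕ.+-suc d ∣ S ∣) (ℕ.+-monoʳ-≤ d (ℕ.≰⇒> ≰))))
      (search d S′ ind′)

------------------------------------------------------------------------
-- Finite simple graphs on n labelled vertices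

record SimpleGraph (n : ℕ) : Set where
  field
    adj : Fin n → Fin n → Bool

  Adj : Fin n → Fin n → Set
  Adj i j = T (adj i j)

  field
    adj-sym    : ∀ i j → Adj i j → Adj j i
    adj-irrefl : ∀ i → ¬ Adj i i

open SimpleGraph public using (Adj)

module _ {n : ℕ} (G : SimpleGraph n) where
  open SimpleGraph G using (adj; adj-sym)

  HasEdge : Set
  HasEdge = ∃₂ λ i j → Adj G i j

  -- Each edge is listed once, with its smaller endpoint first.
  edges : List (Fin n × Fin n)
  edges = filter (λ (i , j) → (i Fin.<? j) ×-dec T? (adj i j))
                 (cartesianProduct (allFin n) (allFin n))

  Connected : Fin n → Fin n → Set
  Connected = Star (Adj G)

  -- A bijection between the connected components and Fin k.
  record ComponentLabelling (k : ℕ) : Set where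
    field
      label            : Fin n → Fin k
      label-surjective : ∀ c → ∃ λ i → label i ≡ c
      label-connected  : ∀ i j → label i ≡ label j ⇔ Connected i j

  adjacencyMatrix : Matrix n n
  adjacencyMatrix i j with T? (adj i j)
  ... | yes _ = ℂᵣ.1#
  ... | no  _ = ℂᵣ.0#

  private
    record Partial (es : List (Fin n × Fin n)) : Set where
      field
        size     : ℕ
        lab      : Fin n → Fin size
        surj     : ∀ c → ∃ λ i → lab i ≡ c
        sound    : ∀ i j → lab i ≡ lab j → Connected i j
        complete : All (λ (i , j) → Adj G i j → lab i ≡ lab j) es

    merge : ∀ {es} (P : Partial es) a b → Adj G a b →
            Partial.lab P b ≢ Partial.lab P a → Partial ((a , b) ∷ es)
    merge record { size = zero ; lab = lab } a b _ _ = contradiction (lab a) λ ()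
    merge record { size = suc k ; lab = lab ; surj = surj ; sound = sound ; complete = complete }
          a b ab b≢a = record
      { size     = k
      ; lab      = f ∘ lab
      ; surj     = λ c → let i , eq = surj (punchIn (lab b) c) in i , trans (cong f eq) (f-punchIn c)
      ; sound    = sound′
      ; complete = (λ _ → f-glues) ∷ All.map (λ h e → cong f (h e)) complete
      }
      where
      rep : ∀ z → ∃ λ w → lab b ≢ w × ((z ≡ lab b × w ≡ lab a) ⊎ z ≡ w)
      rep z with lab b Fin.≟ z
      ... | yes refl = lab a , b≢a , inj₁ (refl , refl)
      ... | no  b≢z  = z , b≢z , inj₂ refl

      f : Fin (suc k) → Fin k
      f z = punchOut (proj₁ (proj₂ (rep z)))

      f-punchIn : ∀ c → f (punchIn (lab b) c) ≡ c
      f-punchIn c with rep (punchIn (lab b) c)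
      ... | _ , _   , inj₁ (eq , _) = contradiction eq (Fin.punchInᵢ≢i (lab b) c)
      ... | _ , b≢w , inj₂ refl     =
        trans (Fin.punchOut-cong (lab b) refl) (Fin.punchOut-punchIn (lab b))

      f-glues : f (lab a) ≡ f (lab b)
      f-glues with rep (lab a) | rep (lab b)
      ... | _ , _ , inj₁ (eq , _) | _                         = contradiction (sym eq) b≢a
      ... | _ , _ , inj₂ refl     | _ , _ , inj₁ (_ , refl)   = Fin.punchOut-cong (lab b) refl
      ... | _ , _ , inj₂ refl     | _ , b≢b , inj₂ refl       = contradiction refl b≢b

      toRep : ∀ i {w} → (lab i ≡ lab b × w ≡ lab a) ⊎ lab i ≡ w → ∃ λ r → lab r ≡ w × Connected i r
      toRep i (inj₁ (i~b , refl)) = a , refl , sound i b i~b ◅◅ (adj-sym a b ab ◅ nil)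
      toRep i (inj₂ refl)         = i , refl , nil

      sound′ : ∀ i j → f (lab i) ≡ f (lab j) → Connected i j
      sound′ i j eq with rep (lab i) | rep (lab j)
      ... | _ , b≢w , hi | _ , b≢w′ , hj =
        let r , r~ , i→r = toRep i hi
            s , s~ , j→s = toRep j hj
            w≡w′ = Fin.punchOut-injective b≢w b≢w′ eq
        in i→r ◅◅ sound r s (trans r~ (trans w≡w′ (sym s~))) ◅◅ reverse (λ {x} {y} → adj-sym x y) j→s

    build : ∀ es → Partial es
    build [] = record
      { size = n ; lab = λ i → i ; surj = λ c → c , refl
      ; sound = λ { i _ refl → nil } ; complete = [] }
    build ((a , b) ∷ es) with build es | T? (adj a b)
    ... | P | no ¬ab = record
      { size = Partial.size P ; lab = Partial.lab P ; surj = Partial.surj P ; sound = Partial.sound P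
      ; complete = (λ ab → contradiction ab ¬ab) ∷ Partial.complete P }
    ... | P | yes ab with Partial.lab P b Fin.≟ Partial.lab P a
    ...   | yes b≡a = record
      { size = Partial.size P ; lab = Partial.lab P ; surj = Partial.surj P ; sound = Partial.sound P
      ; complete = (λ _ → sym b≡a) ∷ Partial.complete P }
    ...   | no b≢a  = merge P a b ab b≢a

  componentLabelling : ∃ ComponentLabelling
  componentLabelling = size , record
    { label            = lab
    ; label-surjective = surj
    ; label-connected  = λ i j → mk⇔ (sound i j) respects
    }
    where
    open Partial (build (cartesianProduct (allFin n) (allFin n)))
    respects : ∀ {i j} → Connected i j → lab i ≡ lab j
    respects nil = refl
    respects (_◅_ {i} {j} e es) =
      trans (lookup complete (∈-cartesianProduct⁺ (∈-allFin i) (∈-allFin j)) e) (respects es)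

  ω : ℕ
  ω = proj₁ componentLabelling

  θ : ℤ
  θ = + length edges ℤ.- + n ℤ.+ + ω

next : ∀ {k} → Fin k → Fin k
next {k} i = (suc (toℕ i) mod k) {{Fin.nonZeroIndex i}}

record Cycle {n : ℕ} (G : SimpleGraph n) (k : ℕ) : Set where
  field
    3≤k        : 3 ≤ k
    vertex     : Fin k → Fin n
    injective  : Injective _≡_ _≡_ vertex
    adjacent   : ∀ i → Adj G (vertex i) (vertex (next i))

Acyclic : ∀ {n} → SimpleGraph n → Set
Acyclic G = ∀ k → ¬ Cycle G k

------------------------------------------------------------------------
-- Complex unit gain graphs

record GainGraph (n : ℕ) : Set where
  field
    graph     : SimpleGraph n
    φ         : ∀ i j → Adj graph i j → ℂ
    φ-unit    : ∀ i j (e : Adj graph i j) → HasModulusOne (φ i j e)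
    φ-reverse : ∀ i j (e : Adj graph i j) (e′ : Adj graph j i) → φ j i e′ ℂᵣ.≈ conj (φ i j e)

module _ {n : ℕ} (Φ : GainGraph n) where
  open GainGraph Φ

  gainMatrix : Matrix n n
  gainMatrix i j with T? (SimpleGraph.adj graph i j)
  ... | yes e = φ i j e
  ... | no  _ = ℂᵣ.0#

  module _ {k : ℕ} (C : Cycle graph k) where
    open Cycle C

    cycleGain : ℂ
    cycleGain = ℂᵣ.product (λ i → φ (vertex i) (vertex (next i)) (adjacent i))

    TypeA TypeB : Set
    TypeA = 2 ∣ k × cycleGain ℂᵣ.≈ (ℂᵣ.- ℂᵣ.1#) ℂᵣ.^ ⌊ k /2⌋
    TypeB = 2 ∣ k × ¬ cycleGain ℂᵣ.≈ (ℂᵣ.- ℂᵣ.1#) ℂᵣ.^ ⌊ k /2⌋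

    -- Every edge of the graph is an edge of C, so C has no chords and the
    -- vertices outside C are isolated.
    OnlyEdges : Set
    OnlyEdges = ∀ i j → Adj graph i j → ∃ λ s →
      (i ≡ vertex s × j ≡ vertex (next s)) ⊎ (j ≡ vertex s × i ≡ vertex (next s))

  IsTypeBFourCycleWithIsolatedVertices : Set
  IsTypeBFourCycleWithIsolatedVertices = ∃ λ (C : Cycle graph 4) → TypeB C × OnlyEdges C

{-# OPTIONS --safe #-}

-- Switch the gains so that they become 1 along a spanning forest. The switched
-- matrix then differs from the 0-1 adjacency matrix only at the θ(G) edges outside
-- the forest, hence only in θ(G) rows and θ(G) columns, so |r(Φ) − r(G)| ≤ 2θ(G).
-- As r(G) ≥ 2 for a graph with an edge, both bounds follow, and equality in the
-- upper one forces θ(G) = 0 or r(G) = 2 and r(Φ) = 2 + 2θ(G). In the latter case G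
-- is complete bipartite (up to isolated vertices), because for an edge uv the minors
-- containing it give A_ij = A_iv A_uj + A_iu A_vj. A side of size p is a vertex cover,
-- so r(Φ) ≤ 2p, while θ(G) ≥ p if p ≥ 2 and the other side has three vertices; only
-- C₄ remains, and the same identity of minors shows that it must be of Type B.
--
-- Equality of complex numbers is undecidable but stable, and a nonzero complex number
-- is not not invertible. Since ranks are compared by a decidable relation, linear
-- algebra can be carried out under a double negation. Ranks are handled through
-- factorisations A = L R of inner dimension k.

module Submission where

open import Defs
open import Algebra.Bundles using (AbelianGroup; CommutativeRing)
import Algebra.Construct.Terminal as Terminal
import Algebra.Properties.Group as GroupProperties
import Algebra.Properties.Ring as RingProperties
import Algebra.Properties.Semiring.Sum as SemiringSum
import Algebra.Solver.Ring.NaturalCoefficients.Default as SemiringSolver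
open import Data.Bool using (true; false)
open import Data.Bool.Properties using (T?; T-irrelevant)
open import Data.Fin using (Fin; zero; suc; punchIn; punchOut; toℕ; fromℕ; inject₁; splitAt; join)
import Data.Fin as Fin
import Data.Fin.Properties as Fin
open import Data.Fin.Induction using (<-weakInduction)
open import Data.Fin.Relation.Unary.Top using (view; ‵fromℕ; ‵inject₁)
open import Data.Fin.Subset using (Subset; ∣_∣; _∉_; _∪_; ⁅_⁆)
open import Data.Fin.Subset.Properties using (p⊂q⇒∣p∣<∣q∣; p⊆p∪q; q⊆p∪q; x∈p∪q⁻; x∈⁅x⁆; x∈⁅y⁆⇒x≡y) renaming (_∈?_ to _∈ₛ?_)
open import Data.Integer using (+_)
import Data.Integer as ℤ
import Data.Integer.Properties as ℤ
open import Data.List using (List; []; _∷_; length; _++_; filter; lookup; allFin; cartesianProduct; map)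
import Data.List.Membership.DecPropositional as DecMembership
open import Data.List.Membership.Propositional using (_∈_)
open import Data.List.Membership.Propositional.Properties using (∈-allFin; ∈-cartesianProduct⁺; ∈-filter⁺; ∈-filter⁻; ∈-lookup; ∈-length; ∈-map⁻; ∈-++⁺ʳ)
import Data.List.Properties as List
open import Data.List.Relation.Unary.All using (All; []; _∷_)
import Data.List.Relation.Unary.All as All
open import Data.List.Relation.Unary.AllPairs using ([]; _∷_)
open import Data.List.Relation.Unary.Any using (here; there; index)
open import Data.List.Relation.Unary.Any.Properties using (lookup-index)
open import Data.List.Relation.Unary.Unique.Propositional using (Unique)
import Data.List.Relation.Unary.Unique.Propositional.Properties as Unique
open import Data.Nat using (ℕ; zero; suc; NonZero)
import Data.Nat as ℕ
import Data.Nat.DivMod as ℕ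
import Data.Nat.Properties as ℕ
open import Data.Nat.Divisibility using (divides)
open import Data.Product using (Σ; ∃; ∃₂; _×_; _,_; proj₁; proj₂)
import Data.Product.Properties as Product
open import Data.Rational using (ℚ; 0ℚ; 1ℚ; ½)
import Data.Rational as ℚ
import Data.Rational.Properties as ℚ
open import Data.Rational.Solver using (module +-*-Solver)
import Data.Rational.Unnormalised as ℚᵘ
import Data.Rational.Unnormalised.Properties as ℚᵘ
open import Data.Sum using (_⊎_; inj₁; inj₂; [_,_]; [_,_]′; swap; map₁)
import Data.Sum as Sum
open import Data.Vec using ([]; _∷_; here; there)
open import Data.Vec.Functional using (insertAt)
open import Data.Vec.Functional.Properties using (insertAt-lookup; insertAt-punchIn)
open import Function using (_∘_; id; mk⇔; Equivalence)
open import Function.Bundles using (_⇔_)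
open import Function.Definitions using (Injective)
open import Level using (0ℓ)
open import Relation.Binary.Construct.Closure.ReflexiveTransitive using (Star; _◅_; _◅◅_) renaming (ε to nil)
import Relation.Binary.Construct.Closure.ReflexiveTransitive as Star
open import Relation.Binary.PropositionalEquality using (_≡_; _≢_; refl; sym; trans; cong; cong₂; subst; subst₂; module ≡-Reasoning)
import Relation.Binary.Reasoning.Setoid as SetoidReasoning
open import Relation.Nullary using (¬_; Dec; yes; no; contradiction; ¬?)
open import Relation.Nullary.Decidable using (decidable-stable; _×-dec_; _⊎-dec_)
open import Relation.Unary using (Decidable)
open import Relation.Unary.Properties using (∁?)

-- Complex numbers

-- Of the gains only A_ij A_ji = 1 on the edges is used, so A(Φ) and the 0-1 matrix are treated
-- alike: a single switching lemma, applied in both directions, bounds each rank by the other.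
-- Equality in the lower bound is settled by arithmetic: r(G) = r(Φ) + θ(G) r(G) with r(Φ) > 0
-- excludes θ(G) ≥ 1. In the upper bound two opposite estimates meet: 2 + 2θ(G) = r(Φ) ≤ 2p gives
-- θ(G) < p for a side with p vertices, whereas a third vertex on the other side gives θ(G) ≥ p.
-- Hence both sides have exactly two vertices. The integer θ(G) is built from a list of edges and
-- from components found by a particular algorithm. It is replaced by a natural number t in an
-- equation without subtraction, and is computed by a separate scan of the edges. That scan runs
-- over an arbitrary abelian group: the group of invertible scalars yields the switching, the
-- trivial group yields pure counting.

module _ where
  open +-*-Solver using (solve; _:=_; _:+_; _:*_; _:-_; :-_; con)

  private
    0<½* : ∀ {ε} → 0ℚ ℚ.< ε → 0ℚ ℚ.< ½ ℚ.* ε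
    0<½* {ε} 0<ε = ℚ.positive⁻¹ (½ ℚ.* ε) {{ℚ.pos*pos⇒pos ½ ε {{ℚ.positive 0<ε}}}}

    ½*+½* : ∀ ε → ½ ℚ.* ε ℚ.+ ½ ℚ.* ε ≡ ε
    ½*+½* ε = trans (sym (ℚ.*-distribʳ-+ ε ½ ½)) (ℚ.*-identityˡ ε)

    ½*< : ∀ {ε} → 0ℚ ℚ.< ε → ½ ℚ.* ε ℚ.< ε
    ½*< {ε} 0<ε = subst₂ ℚ._<_ (ℚ.+-identityʳ (½ ℚ.* ε)) (½*+½* ε) (ℚ.+-monoʳ-< (½ ℚ.* ε) (0<½* 0<ε))

    0<* : ∀ {p q} → 0ℚ ℚ.< p → 0ℚ ℚ.< q → 0ℚ ℚ.< p ℚ.* q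
    0<* {p} {q} 0<p 0<q =
      ℚ.positive⁻¹ (p ℚ.* q) {{ℚ.pos*pos⇒pos p {{ℚ.positive 0<p}} q {{ℚ.positive 0<q}}}}

    ∣∣-triangle : ∀ p q → ℚ.∣ p ∣ ℚ.≤ ℚ.∣ p ℚ.- q ∣ ℚ.+ ℚ.∣ q ∣
    ∣∣-triangle p q = subst (λ s → ℚ.∣ s ∣ ℚ.≤ ℚ.∣ p ℚ.- q ∣ ℚ.+ ℚ.∣ q ∣)
      (solve 2 (λ a b → (a :- b) :+ b := a) refl p q) (ℚ.∣p+q∣≤∣p∣+∣q∣ (p ℚ.- q) q)

    ∣p∣*∣p∣≡p*p : ∀ p → ℚ.∣ p ∣ ℚ.* ℚ.∣ p ∣ ≡ p ℚ.* p
    ∣p∣*∣p∣≡p*p p with ℚ.∣p∣≡p∨∣p∣≡-p p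
    ... | inj₁ eq = cong₂ ℚ._*_ eq eq
    ... | inj₂ eq = trans (cong₂ ℚ._*_ eq eq) (solve 1 (λ a → (:- a) :* (:- a) := a :* a) refl p)

    0≤p*p : ∀ p → 0ℚ ℚ.≤ p ℚ.* p
    0≤p*p p = subst (0ℚ ℚ.≤_) (trans (ℚ.∣p*q∣≡∣p∣*∣q∣ p p) (∣p∣*∣p∣≡p*p p)) (ℚ.0≤∣p∣ (p ℚ.* p))

    small-product : ∀ B η → 0ℚ ℚ.< B → 0ℚ ℚ.< η →
      ∃ λ δ → 0ℚ ℚ.< δ × (∀ p q → ℚ.∣ p ∣ ℚ.≤ B → ℚ.∣ q ∣ ℚ.< δ → ℚ.∣ p ℚ.* q ∣ ℚ.< η)
    small-product B η 0<B 0<η = ℚ.1/ B ℚ.* η , 0<* (ℚ.positive⁻¹ (ℚ.1/ B) {{ℚ.1/pos⇒pos B}}) 0<η , bound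
      where
      instance
        B-pos : ℚ.Positive B
        B-pos = ℚ.positive 0<B
        B≢0 : ℚ.NonZero B
        B≢0 = ℚ.pos⇒nonZero B
      open ℚ.≤-Reasoning
      bound : ∀ p q → ℚ.∣ p ∣ ℚ.≤ B → ℚ.∣ q ∣ ℚ.< ℚ.1/ B ℚ.* η → ℚ.∣ p ℚ.* q ∣ ℚ.< η
      bound p q hp hq = begin-strict
        ℚ.∣ p ℚ.* q ∣         ≡⟨ ℚ.∣p*q∣≡∣p∣*∣q∣ p q ⟩
        ℚ.∣ p ∣ ℚ.* ℚ.∣ q ∣   ≤⟨ ℚ.*-monoʳ-≤-nonNeg ℚ.∣ q ∣ {{ℚ.∣-∣-nonNeg q}} hp ⟩
        B ℚ.* ℚ.∣ q ∣         <⟨ ℚ.*-monoʳ-<-pos B hq ⟩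
        B ℚ.* (ℚ.1/ B ℚ.* η)  ≡⟨ ℚ.*-assoc B (ℚ.1/ B) η ⟨
        B ℚ.* ℚ.1/ B ℚ.* η    ≡⟨ cong (ℚ._* η) (ℚ.*-inverseʳ B) ⟩
        1ℚ ℚ.* η              ≡⟨ ℚ.*-identityˡ η ⟩
        η                     ∎

  Null : (ℕ → ℚ) → Set
  Null x = ∀ ε → 0ℚ ℚ.< ε → ∃ λ N → ∀ n → N ℕ.≤ n → ℚ.∣ x n ∣ ℚ.< ε

  null-resp : ∀ {x y} → (∀ n → x n ≡ y n) → Null x → Null y
  null-resp x≗y null ε 0<ε with null ε 0<ε
  ... | N , h = N , λ n N≤n → subst (λ q → ℚ.∣ q ∣ ℚ.< ε) (x≗y n) (h n N≤n)

  null-0 : Null (λ _ → 0ℚ)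
  null-0 ε 0<ε = 0 , λ _ _ → 0<ε

  null-neg : ∀ {x} → Null x → Null (λ n → ℚ.- x n)
  null-neg {x} null ε 0<ε with null ε 0<ε
  ... | N , h = N , λ n N≤n → subst (ℚ._< ε) (sym (ℚ.∣-p∣≡∣p∣ (x n))) (h n N≤n)

  null-+ : ∀ {x y} → Null x → Null y → Null (λ n → x n ℚ.+ y n)
  null-+ {x} {y} nx ny ε 0<ε with nx (½ ℚ.* ε) (0<½* 0<ε) | ny (½ ℚ.* ε) (0<½* 0<ε)
  ... | M , hM | N , hN = M ℕ.⊔ N , λ n ≤n → begin-strict
      ℚ.∣ x n ℚ.+ y n ∣          ≤⟨ ℚ.∣p+q∣≤∣p∣+∣q∣ (x n) (y n) ⟩
      ℚ.∣ x n ∣ ℚ.+ ℚ.∣ y n ∣    <⟨ ℚ.+-mono-< (hM n (ℕ.m⊔n≤o⇒m≤o M N ≤n)) (hN n (ℕ.m⊔n≤o⇒n≤o M N ≤n)) ⟩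
      ½ ℚ.* ε ℚ.+ ½ ℚ.* ε        ≡⟨ ½*+½* ε ⟩
      ε                          ∎
    where open ℚ.≤-Reasoning

  null-*ˡ : ∀ {x y} → IsCauchy x → Null y → Null (λ n → x n ℚ.* y n)
  null-*ˡ {x} {y} cx ny ε 0<ε with cx 1ℚ (ℚ.positive⁻¹ 1ℚ)
  ... | M , hM with small-product (1ℚ ℚ.+ ℚ.∣ x M ∣) ε
                      (ℚ.+-mono-<-≤ {0ℚ} {1ℚ} {0ℚ} (ℚ.positive⁻¹ 1ℚ) (ℚ.0≤∣p∣ (x M))) 0<ε
  ...   | δ , 0<δ , small with ny δ 0<δ
  ...     | N , hN = M ℕ.⊔ N , λ n ≤n → small (x n) (y n)
              (ℚ.≤-trans (∣∣-triangle (x n) (x M))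
                (ℚ.+-monoˡ-≤ ℚ.∣ x M ∣ (ℚ.<⇒≤ (hM n M (ℕ.m⊔n≤o⇒m≤o M N ≤n) ℕ.≤-refl))))
              (hN n (ℕ.m⊔n≤o⇒n≤o M N ≤n))

  -- A term with ∣x n∣ ≥ ε would force the sum of squares to be at least ε². This makes a complex
  -- number vanish as soon as its squared modulus does.
  null-*-self : (x y : ℕ → ℚ) → Null (λ n → x n ℚ.* x n ℚ.+ y n ℚ.* y n) → Null x
  null-*-self x y null ε 0<ε with null (ε ℚ.* ε) (0<* {ε} {ε} 0<ε 0<ε)
  ... | N , h = N , λ n N≤n → ℚ.≰⇒> λ ε≤ → ℚ.<-irrefl refl (ℚ.<-≤-trans (h n N≤n) (begin
      ε ℚ.* ε                             ≤⟨ ℚ.*-monoˡ-≤-nonNeg ε {{ℚ.nonNegative (ℚ.<⇒≤ 0<ε)}} ε≤ ⟩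
      ε ℚ.* ℚ.∣ x n ∣                     ≤⟨ ℚ.*-monoʳ-≤-nonNeg ℚ.∣ x n ∣ {{ℚ.∣-∣-nonNeg (x n)}} ε≤ ⟩
      ℚ.∣ x n ∣ ℚ.* ℚ.∣ x n ∣             ≡⟨ ∣p∣*∣p∣≡p*p (x n) ⟩
      x n ℚ.* x n                         ≡⟨ ℚ.+-identityʳ (x n ℚ.* x n) ⟨
      x n ℚ.* x n ℚ.+ 0ℚ                  ≤⟨ ℚ.+-monoʳ-≤ (x n ℚ.* x n) (0≤p*p (y n)) ⟩
      x n ℚ.* x n ℚ.+ y n ℚ.* y n         ≡⟨ ℚ.0≤p⇒∣p∣≡p (ℚ.+-mono-≤ (0≤p*p (x n)) (0≤p*p (y n))) ⟨
      ℚ.∣ x n ℚ.* x n ℚ.+ y n ℚ.* y n ∣   ∎))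
    where open ℚ.≤-Reasoning

  -- The positive counterpart of not being null. Division needs the uniform bound twice: for nonzero
  -- terms and for the Cauchy property of their inverses.
  Apart : (ℕ → ℚ) → Set
  Apart x = ∃₂ λ δ N → 0ℚ ℚ.< δ × (∀ n → N ℕ.≤ n → δ ℚ.≤ ℚ.∣ x n ∣)

  apart⇒¬null : ∀ {x} → Apart x → ¬ Null x
  apart⇒¬null (δ , M , 0<δ , hM) null with null δ 0<δ
  ... | N , hN = ℚ.<-irrefl refl
        (ℚ.<-≤-trans (hN (M ℕ.⊔ N) (ℕ.m≤n⊔m M N)) (hM (M ℕ.⊔ N) (ℕ.m≤m⊔n M N)))

  -- Look at one term from which on the sequence varies by less than ε / 4.
  small-or-apart : ∀ {x} → IsCauchy x → ∀ ε → 0ℚ ℚ.< ε →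
                   (∃ λ N → ∀ n → N ℕ.≤ n → ℚ.∣ x n ∣ ℚ.< ε) ⊎ Apart x
  small-or-apart {x} cx ε 0<ε with cx (½ ℚ.* (½ ℚ.* ε)) (0<½* (0<½* 0<ε))
  ... | N , h with ℚ.∣ x N ∣ ℚ.<? ½ ℚ.* ε
  ...   | yes small = inj₁ (N , λ n N≤n → begin-strict
            ℚ.∣ x n ∣                           ≤⟨ ∣∣-triangle (x n) (x N) ⟩
            ℚ.∣ x n ℚ.- x N ∣ ℚ.+ ℚ.∣ x N ∣     <⟨ ℚ.+-mono-< (ℚ.<-trans (h n N N≤n ℕ.≤-refl) (½*< (0<½* 0<ε))) small ⟩
            ½ ℚ.* ε ℚ.+ ½ ℚ.* ε                 ≡⟨ ½*+½* ε ⟩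
            ε                                   ∎)
    where open ℚ.≤-Reasoning
  ...   | no  ≮     = inj₂ (½ ℚ.* (½ ℚ.* ε) , N , 0<½* (0<½* 0<ε) , λ n N≤n → ℚ.≮⇒≥ λ x<h →
            ≮ (begin-strict
              ℚ.∣ x N ∣                                   ≤⟨ ∣∣-triangle (x N) (x n) ⟩
              ℚ.∣ x N ℚ.- x n ∣ ℚ.+ ℚ.∣ x n ∣             <⟨ ℚ.+-mono-< (h N n ℕ.≤-refl N≤n) x<h ⟩
              ½ ℚ.* (½ ℚ.* ε) ℚ.+ ½ ℚ.* (½ ℚ.* ε)         ≡⟨ ½*+½* (½ ℚ.* ε) ⟩
              ½ ℚ.* ε                                     ∎))
    where open ℚ.≤-Reasoning

  -- Being null is a family of conditions indexed by ε. `small-or-apart` establishes each of them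
  -- unless the sequence is apart from 0, and the double negation excludes that.
  null-stable : ∀ {x} → IsCauchy x → ¬ ¬ Null x → Null x
  null-stable {x} cx ¬¬null ε 0<ε with small-or-apart {x} cx ε 0<ε
  ... | inj₁ small = small
  ... | inj₂ apart = contradiction (apart⇒¬null {x} apart) ¬¬null

  ¬null⇒¬¬apart : ∀ {x} → IsCauchy x → ¬ Null x → ¬ ¬ Apart x
  ¬null⇒¬¬apart {x} cx ¬null ¬apart = ¬null λ ε 0<ε → helper ε (small-or-apart {x} cx ε 0<ε)
    where
    helper : ∀ ε → _ ⊎ Apart x → ∃ λ N → ∀ n → N ℕ.≤ n → ℚ.∣ x n ∣ ℚ.< ε
    helper ε (inj₁ small) = small
    helper ε (inj₂ apart) = contradiction apart ¬apart

  private
    -- Total, with default value 0 at 0: finitely many terms of a sequence apart from 0 may vanish,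
    -- and they do not influence the limit.
    inv : ℚ → ℚ
    inv p with p ℚ.≟ 0ℚ
    ... | yes _   = 0ℚ
    ... | no  p≢0 = (ℚ.1/ p) {{ℚ.≢-nonZero p≢0}}

    *-inv : ∀ {δ} p → 0ℚ ℚ.< δ → δ ℚ.≤ ℚ.∣ p ∣ → p ℚ.* inv p ≡ 1ℚ
    *-inv {δ} p 0<δ δ≤ with p ℚ.≟ 0ℚ
    ... | yes refl = contradiction refl (ℚ.<⇒≢ (ℚ.<-≤-trans 0<δ δ≤))
    ... | no  p≢0  = ℚ.*-inverseʳ p {{ℚ.≢-nonZero p≢0}}

    ∣inv∣≤ : ∀ {δ} p (0<δ : 0ℚ ℚ.< δ) → δ ℚ.≤ ℚ.∣ p ∣ →
             ℚ.∣ inv p ∣ ℚ.≤ (ℚ.1/ δ) {{ℚ.pos⇒nonZero δ {{ℚ.positive 0<δ}}}}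
    ∣inv∣≤ {δ} p 0<δ δ≤ = begin
      ℚ.∣ inv p ∣                                ≡⟨ ℚ.*-identityˡ ℚ.∣ inv p ∣ ⟨
      1ℚ ℚ.* ℚ.∣ inv p ∣                         ≡⟨ cong (ℚ._* ℚ.∣ inv p ∣) (ℚ.*-inverseˡ δ) ⟨
      ℚ.1/ δ ℚ.* δ ℚ.* ℚ.∣ inv p ∣               ≡⟨ ℚ.*-assoc (ℚ.1/ δ) δ ℚ.∣ inv p ∣ ⟩
      ℚ.1/ δ ℚ.* (δ ℚ.* ℚ.∣ inv p ∣)             ≤⟨ ℚ.*-monoˡ-≤-nonNeg (ℚ.1/ δ) {{ℚ.pos⇒nonNeg (ℚ.1/ δ) {{ℚ.1/pos⇒pos δ}}}}
                                                      (ℚ.*-monoʳ-≤-nonNeg ℚ.∣ inv p ∣ {{ℚ.∣-∣-nonNeg (inv p)}} δ≤) ⟩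
      ℚ.1/ δ ℚ.* (ℚ.∣ p ∣ ℚ.* ℚ.∣ inv p ∣)       ≡⟨ cong (ℚ.1/ δ ℚ.*_) (ℚ.∣p*q∣≡∣p∣*∣q∣ p (inv p)) ⟨
      ℚ.1/ δ ℚ.* ℚ.∣ p ℚ.* inv p ∣               ≡⟨ cong (λ q → ℚ.1/ δ ℚ.* ℚ.∣ q ∣) (*-inv p 0<δ δ≤) ⟩
      ℚ.1/ δ ℚ.* 1ℚ                              ≡⟨ ℚ.*-identityʳ (ℚ.1/ δ) ⟩
      ℚ.1/ δ                                     ∎
      where
      open ℚ.≤-Reasoning
      instance
        δ-pos : ℚ.Positive δ
        δ-pos = ℚ.positive 0<δ
        δ≢0 : ℚ.NonZero δ
        δ≢0 = ℚ.pos⇒nonZero δ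

    -- This is 1/p - 1/q = (q - p)/(pq): a bounded factor times one that the Cauchy property of the
    -- original sequence makes small.
    inv-difference : ∀ {δ} p q → 0ℚ ℚ.< δ → δ ℚ.≤ ℚ.∣ p ∣ → δ ℚ.≤ ℚ.∣ q ∣ →
                     inv p ℚ.- inv q ≡ (inv p ℚ.* inv q) ℚ.* (q ℚ.- p)
    inv-difference p q 0<δ hp hq = begin
      inv p ℚ.- inv q                                      ≡⟨ cong₂ ℚ._-_ (ℚ.*-identityʳ (inv p)) (ℚ.*-identityʳ (inv q)) ⟨
      inv p ℚ.* 1ℚ ℚ.- inv q ℚ.* 1ℚ                        ≡⟨ cong₂ (λ s t → inv p ℚ.* s ℚ.- inv q ℚ.* t) (*-inv q 0<δ hq) (*-inv p 0<δ hp) ⟨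
      inv p ℚ.* (q ℚ.* inv q) ℚ.- inv q ℚ.* (p ℚ.* inv p)  ≡⟨ solve 4 (λ p q s t → s :* (q :* t) :- t :* (p :* s) := (s :* t) :* (q :- p))
                                                                refl p q (inv p) (inv q) ⟩
      (inv p ℚ.* inv q) ℚ.* (q ℚ.- p)                      ∎
      where open ≡-Reasoning

  apart⇒invertible : ∀ x → Apart (seq x) → ∃ λ y → x *ᴿ y ≃ 1ᴿ
  apart⇒invertible x (δ , M , 0<δ , hM) = mkℝ (inv ∘ seq x) inv-cauchy , λ ε 0<ε →
    M , λ n M≤n → subst (λ q → ℚ.∣ q ℚ.- 1ℚ ∣ ℚ.< ε) (sym (*-inv (seq x n) 0<δ (hM n M≤n))) 0<ε
    where
    instance
      δ≢0 : ℚ.NonZero δ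
      δ≢0 = ℚ.pos⇒nonZero δ {{ℚ.positive 0<δ}}
    0<1/δ : 0ℚ ℚ.< ℚ.1/ δ
    0<1/δ = ℚ.positive⁻¹ (ℚ.1/ δ) {{ℚ.1/pos⇒pos δ {{ℚ.positive 0<δ}}}}
    bound : ∀ m n → M ℕ.≤ m → M ℕ.≤ n → ℚ.∣ inv (seq x m) ℚ.* inv (seq x n) ∣ ℚ.≤ ℚ.1/ δ ℚ.* ℚ.1/ δ
    bound m n M≤m M≤n = begin
      ℚ.∣ s ℚ.* t ∣           ≡⟨ ℚ.∣p*q∣≡∣p∣*∣q∣ s t ⟩
      ℚ.∣ s ∣ ℚ.* ℚ.∣ t ∣     ≤⟨ ℚ.*-monoʳ-≤-nonNeg ℚ.∣ t ∣ {{ℚ.∣-∣-nonNeg t}} (∣inv∣≤ (seq x m) 0<δ (hM m M≤m)) ⟩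
      ℚ.1/ δ ℚ.* ℚ.∣ t ∣      ≤⟨ ℚ.*-monoˡ-≤-nonNeg (ℚ.1/ δ) {{ℚ.nonNegative (ℚ.<⇒≤ 0<1/δ)}} (∣inv∣≤ (seq x n) 0<δ (hM n M≤n)) ⟩
      ℚ.1/ δ ℚ.* ℚ.1/ δ       ∎
      where
      open ℚ.≤-Reasoning
      s = inv (seq x m)
      t = inv (seq x n)
    inv-cauchy : IsCauchy (inv ∘ seq x)
    inv-cauchy ε 0<ε with small-product (ℚ.1/ δ ℚ.* ℚ.1/ δ) ε (0<* 0<1/δ 0<1/δ) 0<ε
    ... | η , 0<η , small with cauchy x η 0<η
    ...   | N , hN = M ℕ.⊔ N , λ m n m≥ n≥ →
            let M≤m = ℕ.m⊔n≤o⇒m≤o M N m≥ ; M≤n = ℕ.m⊔n≤o⇒m≤o M N n≥ in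
            subst (λ q → ℚ.∣ q ∣ ℚ.< ε) (sym (inv-difference (seq x m) (seq x n) 0<δ (hM m M≤m) (hM n M≤n)))
              (small (inv (seq x m) ℚ.* inv (seq x n)) (seq x n ℚ.- seq x m) (bound m n M≤m M≤n)
                (hN n m (ℕ.m⊔n≤o⇒n≤o M N n≥) (ℕ.m⊔n≤o⇒n≤o M N m≥)))

  ≗⇒≃ : ∀ {x y} → (∀ n → seq x n ≡ seq y n) → x ≃ y
  ≗⇒≃ {x} {y} x≗y = null-resp
    (λ n → sym (trans (cong (ℚ._- seq y n) (x≗y n)) (ℚ.+-inverseʳ (seq y n)))) null-0

  ≃-refl : ∀ {x} → x ≃ x
  ≃-refl {x} = ≗⇒≃ {x} {x} (λ _ → refl)

  ≃-sym : ∀ {x y} → x ≃ y → y ≃ x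
  ≃-sym {x} {y} x≃y = null-resp
    (λ n → solve 2 (λ a b → :- (a :- b) := b :- a) refl (seq x n) (seq y n)) (null-neg x≃y)

  ≃-trans : ∀ {x y z} → x ≃ y → y ≃ z → x ≃ z
  ≃-trans {x} {y} {z} x≃y y≃z = null-resp
    (λ n → solve 3 (λ a b c → (a :- b) :+ (b :- c) := a :- c) refl (seq x n) (seq y n) (seq z n))
    (null-+ x≃y y≃z)

  +ᴿ-cong : ∀ {x x′ y y′} → x ≃ x′ → y ≃ y′ → x +ᴿ y ≃ x′ +ᴿ y′
  +ᴿ-cong {x} {x′} {y} {y′} p q = null-resp
    (λ n → solve 4 (λ a b c d → (a :- b) :+ (c :- d) := (a :+ c) :- (b :+ d)) refl
             (seq x n) (seq x′ n) (seq y n) (seq y′ n))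
    (null-+ p q)

  -ᴿ-cong : ∀ {x y} → x ≃ y → -ᴿ x ≃ -ᴿ y
  -ᴿ-cong {x} {y} p = null-resp
    (λ n → solve 2 (λ a b → :- (a :- b) := (:- a) :- (:- b)) refl (seq x n) (seq y n)) (null-neg p)

  *ᴿ-cong : ∀ {x x′ y y′} → x ≃ x′ → y ≃ y′ → x *ᴿ y ≃ x′ *ᴿ y′
  *ᴿ-cong {x} {x′} {y} {y′} p q = null-resp
    (λ n → solve 4 (λ a b c d → d :* (a :- b) :+ a :* (c :- d) := (a :* c) :- (b :* d)) refl
             (seq x n) (seq x′ n) (seq y n) (seq y′ n))
    (null-+ {λ n → seq y′ n ℚ.* (seq x n ℚ.- seq x′ n)} {λ n → seq x n ℚ.* (seq y n ℚ.- seq y′ n)}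
      (null-*ˡ {seq y′} (cauchy y′) p) (null-*ˡ {seq x} (cauchy x) q))

  ≃-stable : ∀ {x y} → ¬ ¬ x ≃ y → x ≃ y
  ≃-stable {x} {y} = null-stable (cauchy (x +ᴿ -ᴿ y))

  fromℚ-injective : ∀ {p q} → fromℚ p ≃ fromℚ q → p ≡ q
  fromℚ-injective {p} {q} p≃q with p ℚ.- q ℚ.≟ 0ℚ
  ... | yes eq = trans (solve 2 (λ a b → a := (a :- b) :+ b) refl p q)
                   (trans (cong (ℚ._+ q) eq) (ℚ.+-identityˡ q))
  ... | no  ≢0 = contradiction p≃q (apart⇒¬null (ℚ.∣ p ℚ.- q ∣ , 0 , 0<∣p-q∣ , λ _ _ → ℚ.≤-refl))
    where
    0<∣p-q∣ : 0ℚ ℚ.< ℚ.∣ p ℚ.- q ∣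
    0<∣p-q∣ = ℚ.≰⇒> λ ∣∣≤0 → ≢0 (ℚ.∣p∣≡0⇒p≡0 (p ℚ.- q) (ℚ.≤-antisym ∣∣≤0 (ℚ.0≤∣p∣ (p ℚ.- q))))

  private
    ≗⇒≈ : ∀ z w → (∀ n → seq (re z) n ≡ seq (re w) n) → (∀ n → seq (im z) n ≡ seq (im w) n) → z ℂᵣ.≈ w
    ≗⇒≈ z w r i = ≗⇒≃ {re z} {re w} r , ≗⇒≃ {im z} {im w} i

  ℂ-commutativeRing : CommutativeRing 0ℓ 0ℓ
  ℂ-commutativeRing = record
    { Carrier = ℂ ; _≈_ = ℂᵣ._≈_ ; _+_ = ℂᵣ._+_ ; _*_ = ℂᵣ._*_ ; -_ = ℂᵣ.-_ ; 0# = ℂᵣ.0# ; 1# = ℂᵣ.1#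
    ; isCommutativeRing = record
      { isRing = record
        { +-isAbelianGroup = record
          { isGroup = record
            { isMonoid = record
              { isSemigroup = record
                { isMagma = record
                  { isEquivalence = record
                    { refl  = λ {z} → ≃-refl {re z} , ≃-refl {im z}
                    ; sym   = λ {z} {w} (p , q) → ≃-sym {re z} {re w} p , ≃-sym {im z} {im w} q
                    ; trans = λ {z} {w} {v} (p , q) (p′ , q′) →
                        ≃-trans {re z} {re w} {re v} p p′ , ≃-trans {im z} {im w} {im v} q q′
                    }
                  ; ∙-cong = λ {z} {z′} {w} {w′} (p , q) (p′ , q′) →
                      +ᴿ-cong {re z} {re z′} {re w} {re w′} p p′ , +ᴿ-cong {im z} {im z′} {im w} {im w′} q q′
                  }
                ; assoc = λ z w v → ≗⇒≈ ((z ⊕ w) ⊕ v) (z ⊕ (w ⊕ v)) (λ n → ℚ.+-assoc (re′ z n) (re′ w n) (re′ v n))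
                                        (λ n → ℚ.+-assoc (im′ z n) (im′ w n) (im′ v n))
                }
              ; identity = (λ z → ≗⇒≈ (ℂᵣ.0# ⊕ z) z (λ n → ℚ.+-identityˡ (re′ z n)) (λ n → ℚ.+-identityˡ (im′ z n)))
                         , (λ z → ≗⇒≈ (z ⊕ ℂᵣ.0#) z (λ n → ℚ.+-identityʳ (re′ z n)) (λ n → ℚ.+-identityʳ (im′ z n)))
              }
            ; inverse = (λ z → ≗⇒≈ ((ℂᵣ.- z) ⊕ z) ℂᵣ.0# (λ n → ℚ.+-inverseˡ (re′ z n)) (λ n → ℚ.+-inverseˡ (im′ z n)))
                      , (λ z → ≗⇒≈ (z ⊕ (ℂᵣ.- z)) ℂᵣ.0# (λ n → ℚ.+-inverseʳ (re′ z n)) (λ n → ℚ.+-inverseʳ (im′ z n)))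
            ; ⁻¹-cong = λ {z} {w} (p , q) → -ᴿ-cong {re z} {re w} p , -ᴿ-cong {im z} {im w} q
            }
          ; comm = λ z w → ≗⇒≈ (z ⊕ w) (w ⊕ z) (λ n → ℚ.+-comm (re′ z n) (re′ w n)) (λ n → ℚ.+-comm (im′ z n) (im′ w n))
          }
        ; *-cong = λ {z} {z′} {w} {w′} → *-cong z z′ w w′
        ; *-assoc = λ z w v → ≗⇒≈ ((z ⊛ w) ⊛ v) (z ⊛ (w ⊛ v))
            (λ n → solve 6 (λ a b c d e f → (a :* c :+ :- (b :* d)) :* e :+ :- ((a :* d :+ b :* c) :* f)
                                         := a :* (c :* e :+ :- (d :* f)) :+ :- (b :* (c :* f :+ d :* e)))
                     refl (re′ z n) (im′ z n) (re′ w n) (im′ w n) (re′ v n) (im′ v n))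
            (λ n → solve 6 (λ a b c d e f → (a :* c :+ :- (b :* d)) :* f :+ (a :* d :+ b :* c) :* e
                                         := a :* (c :* f :+ d :* e) :+ b :* (c :* e :+ :- (d :* f)))
                     refl (re′ z n) (im′ z n) (re′ w n) (im′ w n) (re′ v n) (im′ v n))
        ; *-identity =
            (λ z → ≗⇒≈ (ℂᵣ.1# ⊛ z) z
              (λ n → solve 2 (λ a b → con 1ℚ :* a :+ :- (con 0ℚ :* b) := a) refl (re′ z n) (im′ z n))
              (λ n → solve 2 (λ a b → con 1ℚ :* b :+ con 0ℚ :* a := b) refl (re′ z n) (im′ z n)))
          , (λ z → ≗⇒≈ (z ⊛ ℂᵣ.1#) z
              (λ n → solve 2 (λ a b → a :* con 1ℚ :+ :- (b :* con 0ℚ) := a) refl (re′ z n) (im′ z n))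
              (λ n → solve 2 (λ a b → a :* con 0ℚ :+ b :* con 1ℚ := b) refl (re′ z n) (im′ z n)))
        ; distrib =
            (λ z w v → ≗⇒≈ (z ⊛ (w ⊕ v)) ((z ⊛ w) ⊕ (z ⊛ v))
              (λ n → solve 6 (λ a b c d e f → a :* (c :+ e) :+ :- (b :* (d :+ f))
                                           := (a :* c :+ :- (b :* d)) :+ (a :* e :+ :- (b :* f)))
                       refl (re′ z n) (im′ z n) (re′ w n) (im′ w n) (re′ v n) (im′ v n))
              (λ n → solve 6 (λ a b c d e f → a :* (d :+ f) :+ b :* (c :+ e)
                                           := (a :* d :+ b :* c) :+ (a :* f :+ b :* e))
                       refl (re′ z n) (im′ z n) (re′ w n) (im′ w n) (re′ v n) (im′ v n)))
          , (λ z w v → ≗⇒≈ ((w ⊕ v) ⊛ z) ((w ⊛ z) ⊕ (v ⊛ z))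
              (λ n → solve 6 (λ a b c d e f → (c :+ e) :* a :+ :- ((d :+ f) :* b)
                                           := (c :* a :+ :- (d :* b)) :+ (e :* a :+ :- (f :* b)))
                       refl (re′ z n) (im′ z n) (re′ w n) (im′ w n) (re′ v n) (im′ v n))
              (λ n → solve 6 (λ a b c d e f → (c :+ e) :* b :+ (d :+ f) :* a
                                           := (c :* b :+ d :* a) :+ (e :* b :+ f :* a))
                       refl (re′ z n) (im′ z n) (re′ w n) (im′ w n) (re′ v n) (im′ v n)))
        }
      ; *-comm = λ z w → ≗⇒≈ (z ⊛ w) (w ⊛ z)
          (λ n → solve 4 (λ a b c d → a :* c :+ :- (b :* d) := c :* a :+ :- (d :* b))
                   refl (re′ z n) (im′ z n) (re′ w n) (im′ w n))
          (λ n → solve 4 (λ a b c d → a :* d :+ b :* c := c :* b :+ d :* a)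
                   refl (re′ z n) (im′ z n) (re′ w n) (im′ w n))
      }
    }
    where
    open ℂᵣ using () renaming (_+_ to _⊕_; _*_ to _⊛_)
    re′ im′ : ℂ → ℕ → ℚ
    re′ z = seq (re z)
    im′ z = seq (im z)
    *-cong : ∀ z z′ w w′ → z ℂᵣ.≈ z′ → w ℂᵣ.≈ w′ → (z ℂᵣ.* w) ℂᵣ.≈ (z′ ℂᵣ.* w′)
    *-cong (a +i b) (a′ +i b′) (c +i d) (c′ +i d′) (p , q) (r , s) =
        +ᴿ-cong {a *ᴿ c} {a′ *ᴿ c′} { -ᴿ (b *ᴿ d)} { -ᴿ (b′ *ᴿ d′)}
          (*ᴿ-cong {a} {a′} {c} {c′} p r) (-ᴿ-cong {b *ᴿ d} {b′ *ᴿ d′} (*ᴿ-cong {b} {b′} {d} {d′} q s))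
      , +ᴿ-cong {a *ᴿ d} {a′ *ᴿ d′} {b *ᴿ c} {b′ *ᴿ c′}
          (*ᴿ-cong {a} {a′} {d} {d′} p s) (*ᴿ-cong {b} {b′} {c} {c′} q r)

  ℂ-stable : ∀ z w → ¬ ¬ z ℂᵣ.≈ w → z ℂᵣ.≈ w
  ℂ-stable (a +i b) (c +i d) ¬¬≈ =
      ≃-stable {a} {c} (λ a≄c → ¬¬≈ (a≄c ∘ proj₁))
    , ≃-stable {b} {d} (λ b≄d → ¬¬≈ (b≄d ∘ proj₂))

  private
    normSq : ℂ → ℝ
    normSq (a +i b) = a *ᴿ a +ᴿ b *ᴿ b

    normSq≃0⇒≈0 : ∀ z → normSq z ≃ 0ᴿ → z ℂᵣ.≈ ℂᵣ.0#
    normSq≃0⇒≈0 (a +i b) null =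
        null-resp (λ n → sym (ℚ.+-identityʳ (seq a n))) (null-*-self (seq a) (seq b) null′)
      , null-resp (λ n → sym (ℚ.+-identityʳ (seq b n)))
          (null-*-self (seq b) (seq a) (null-resp (λ n → ℚ.+-comm (seq a n ℚ.* seq a n) (seq b n ℚ.* seq b n)) null′))
      where
      null′ : Null (λ n → seq a n ℚ.* seq a n ℚ.+ seq b n ℚ.* seq b n)
      null′ = null-resp (λ n → ℚ.+-identityʳ (seq a n ℚ.* seq a n ℚ.+ seq b n ℚ.* seq b n)) null

    z*conj≈ : ∀ z e → (z ℂᵣ.* ((re z *ᴿ e) +i (-ᴿ (im z *ᴿ e)))) ℂᵣ.≈ ((normSq z *ᴿ e) +i 0ᴿ)
    z*conj≈ (a +i b) e =
        ≗⇒≃ {x = a *ᴿ (a *ᴿ e) +ᴿ -ᴿ (b *ᴿ (-ᴿ (b *ᴿ e)))} {y = (a *ᴿ a +ᴿ b *ᴿ b) *ᴿ e}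
          (λ n → solve 3 (λ a b e → a :* (a :* e) :+ :- (b :* (:- (b :* e))) := (a :* a :+ b :* b) :* e)
                   refl (seq a n) (seq b n) (seq e n))
      , ≗⇒≃ {x = a *ᴿ (-ᴿ (b *ᴿ e)) +ᴿ b *ᴿ (a *ᴿ e)} {y = 0ᴿ}
          (λ n → solve 3 (λ a b e → a :* (:- (b :* e)) :+ b :* (a :* e) := con 0ℚ)
                   refl (seq a n) (seq b n) (seq e n))

  -- The inverse is conj z divided by the squared modulus. The double negation stems from passing
  -- from a squared modulus that is not null to one that is apart from 0.
  ℂ-invertible : ∀ z → ¬ z ℂᵣ.≈ ℂᵣ.0# → ¬ ¬ ∃ λ w → (z ℂᵣ.* w) ℂᵣ.≈ ℂᵣ.1#
  ℂ-invertible z z≉0 no-inverse = ¬null⇒¬¬apart (cauchy (normSq z)) ¬null λ apart →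
    let e , de≃1 = apart⇒invertible (normSq z) apart
        w = (re z *ᴿ e) +i (-ᴿ (im z *ᴿ e))
        p , q = z*conj≈ z e
    in no-inverse (w , ≃-trans {re (z ℂᵣ.* w)} {normSq z *ᴿ e} {1ᴿ} p de≃1 , q)
    where
    ¬null : ¬ Null (seq (normSq z))
    ¬null null = z≉0 (normSq≃0⇒≈0 z (null-resp (λ n → sym (ℚ.+-identityʳ (seq (normSq z) n))) null))

  ℂ-1≉0 : ¬ ℂᵣ.1# ℂᵣ.≈ ℂᵣ.0#
  ℂ-1≉0 (p , _) with () ← fromℚ-injective {1ℚ} {0ℚ} p

  ℂ-2≉0 : ¬ (ℂᵣ.1# ℂᵣ.+ ℂᵣ.1#) ℂᵣ.≈ ℂᵣ.0#
  ℂ-2≉0 (p , _) with () ← fromℚ-injective {1ℚ ℚ.+ 1ℚ} {0ℚ} p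

  modulusOne⇒*conj≈1 : ∀ z → HasModulusOne z → (z ℂᵣ.* conj z) ℂᵣ.≈ ℂᵣ.1#
  modulusOne⇒*conj≈1 z@(a +i b) unit =
      ≃-trans {re (z ℂᵣ.* conj z)} {normSq z} {1ᴿ}
        (≗⇒≃ {x = re (z ℂᵣ.* conj z)} {y = normSq z}
          (λ n → solve 2 (λ a b → a :* a :+ :- (b :* (:- b)) := a :* a :+ b :* b) refl (seq a n) (seq b n)))
        unit
    , ≗⇒≃ {x = im (z ℂᵣ.* conj z)} {y = 0ᴿ}
        (λ n → solve 2 (λ a b → a :* (:- b) :+ b :* a := con 0ℚ) refl (seq a n) (seq b n))

-- Linear algebra

-- For a finite index set the choices can be made one at a time. In this way the coefficients of all
-- columns become available at once under a single double negation.
¬¬-Π : ∀ {n} {P : Fin n → Set} → (∀ i → ¬ ¬ P i) → ¬ ¬ (∀ i → P i)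
¬¬-Π {zero}  _ ¬all = ¬all λ ()
¬¬-Π {suc n} p ¬all = p zero λ p₀ → ¬¬-Π (p ∘ suc) λ ps → ¬all λ { zero → p₀ ; (suc i) → ps i }

-- A field up to double negation: enough for linear algebra whenever the
-- conclusion is a decidable statement about dimensions.
record IsWeakField (R : CommutativeRing 0ℓ 0ℓ) : Set where
  open CommutativeRing R
  field
    ≈-stable   : ∀ x y → ¬ ¬ x ≈ y → x ≈ y
    invertible : ∀ x → ¬ x ≈ 0# → ¬ ¬ ∃ λ y → x * y ≈ 1#
    1≉0        : ¬ 1# ≈ 0#

module LinearAlgebra (R : CommutativeRing 0ℓ 0ℓ) (F : IsWeakField R) where
  open CommutativeRing R hiding (zero) renaming (refl to ≈-refl; sym to ≈-sym; trans to ≈-trans)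
  open IsWeakField F
  open RingProperties ring using (-‿distribˡ-*; -‿distribʳ-*)
  open SemiringSum semiring
  open SemiringSolver commutativeSemiring using (solve; _:=_; _:+_; _:*_; con)
  open SetoidReasoning setoid

  Mat : ℕ → ℕ → Set
  Mat m n = Fin m → Fin n → Carrier

  TrivialKernel : ∀ {m n} → Mat m n → Set
  TrivialKernel {m} {n} M =
    (c : Fin n → Carrier) → (∀ i → sum (λ j → M i j * c j) ≈ 0#) → ∀ j → c j ≈ 0#

  -- Over ℂ this unfolds to `IndependentColumns`, so proofs about `HasRank` carry over without
  -- conversion.
  Independent : ∀ {m n} → Mat m n → Subset n → Set
  Independent {m} {n} A S =
    (c : Fin n → Carrier) → (∀ j → j ∉ S → c j ≈ 0#) →
    (∀ i → sum (λ j → A i j * c j) ≈ 0#) → ∀ j → c j ≈ 0#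

  sum-zero : ∀ {n} {f : Fin n → Carrier} → (∀ i → f i ≈ 0#) → sum f ≈ 0#
  sum-zero {n} f≈0 = ≈-trans (sum-cong-≋ f≈0) (sum-replicate-zero n)

  sum-linear : ∀ {n} (f a b : Fin n → Carrier) x →
    sum (λ l → f l * (a l + x * b l)) ≈ sum (λ l → f l * a l) + x * sum (λ l → f l * b l)
  sum-linear f a b x = begin
    sum (λ l → f l * (a l + x * b l))
      ≈⟨ sum-cong-≋ (λ l → solve 4 (λ p q r s → p :* (q :+ s :* r) := p :* q :+ s :* (p :* r)) ≈-refl (f l) (a l) (b l) x) ⟩
    sum (λ l → f l * a l + x * (f l * b l))
      ≈⟨ ∑-distrib-+ (λ l → f l * a l) (λ l → x * (f l * b l)) ⟩
    sum (λ l → f l * a l) + sum (λ l → x * (f l * b l))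
      ≈⟨ +-congˡ (*-distribˡ-sum x (λ l → f l * b l)) ⟨
    sum (λ l → f l * a l) + x * sum (λ l → f l * b l) ∎

  -- One step of Gaussian elimination with pivot `M zero j`, whose inverse is p; the pivot row and
  -- the pivot column are dropped.
  eliminate : ∀ {r k} → Mat (suc r) (suc k) → Fin (suc k) → Carrier → Mat r k
  eliminate M j p i l = M (suc i) (punchIn j l) + (- (M (suc i) j * p)) * M zero (punchIn j l)

  eliminate-trivialKernel : ∀ {r k} (M : Mat (suc r) (suc k)) j p → M zero j * p ≈ 1# →
    TrivialKernel M → TrivialKernel (eliminate M j p)
  eliminate-trivialKernel {r} {k} M j p Mp≈1 triv c elim l = begin
    c l              ≡⟨ insertAt-punchIn c j v l ⟨
    c′ (punchIn j l) ≈⟨ triv c′ row (punchIn j l) ⟩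
    0#               ∎
    where
    s = sum (λ l → M zero (punchIn j l) * c l)
    -- The only value of the coordinate at j for which the extended vector satisfies the pivot row.
    v = - (p * s)
    c′ = insertAt c j v

    expand : ∀ i → sum (λ l → M i l * c′ l) ≈ (- (M i j * p)) * s + sum (λ l → M i (punchIn j l) * c l)
    expand i = begin
      sum (λ l → M i l * c′ l)
        ≈⟨ sum-remove {i = j} (λ l → M i l * c′ l) ⟩
      M i j * c′ j + sum (λ l → M i (punchIn j l) * c′ (punchIn j l))
        ≈⟨ +-cong (*-congˡ (reflexive (insertAt-lookup c j v)))
                  (sum-cong-≋ (λ l → *-congˡ {M i (punchIn j l)} (reflexive (insertAt-punchIn c j v l)))) ⟩
      M i j * - (p * s) + sum (λ l → M i (punchIn j l) * c l)
        ≈⟨ +-congʳ (≈-trans (≈-sym (-‿distribʳ-* (M i j) (p * s)))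
             (≈-trans (-‿cong (≈-sym (*-assoc (M i j) p s))) (-‿distribˡ-* (M i j * p) s))) ⟩
      (- (M i j * p)) * s + sum (λ l → M i (punchIn j l) * c l) ∎

    row : ∀ i → sum (λ l → M i l * c′ l) ≈ 0#
    row zero = begin
      sum (λ l → M zero l * c′ l)  ≈⟨ expand zero ⟩
      (- (M zero j * p)) * s + s   ≈⟨ +-congʳ (*-congʳ (-‿cong Mp≈1)) ⟩
      (- 1#) * s + s               ≈⟨ +-congʳ (≈-trans (≈-sym (-‿distribˡ-* 1# s)) (-‿cong (*-identityˡ s))) ⟩
      (- s) + s                    ≈⟨ -‿inverseˡ s ⟩
      0#                           ∎
    row (suc i) = begin
      sum (λ l → M (suc i) l * c′ l)
        ≈⟨ expand (suc i) ⟩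
      q * s + sum (λ l → M (suc i) (punchIn j l) * c l)
        ≈⟨ +-comm (q * s) _ ⟩
      sum (λ l → M (suc i) (punchIn j l) * c l) + q * s
        ≈⟨ +-cong (sum-cong-≋ (λ l → *-comm (M (suc i) (punchIn j l)) (c l)))
                  (*-congˡ (sum-cong-≋ (λ l → *-comm (M zero (punchIn j l)) (c l)))) ⟩
      sum (λ l → c l * M (suc i) (punchIn j l)) + q * sum (λ l → c l * M zero (punchIn j l))
        ≈⟨ sum-linear c (λ l → M (suc i) (punchIn j l)) (λ l → M zero (punchIn j l)) q ⟨
      sum (λ l → c l * eliminate M j p i l)
        ≈⟨ sum-cong-≋ (λ l → *-comm (c l) (eliminate M j p i l)) ⟩
      sum (λ l → eliminate M j p i l * c l)
        ≈⟨ elim i ⟩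
      0# ∎
      where q = - (M (suc i) j * p)

  -- An invertible entry of the first row serves as pivot, and elimination lowers both dimensions by
  -- one. As the conclusion is decidable, its failure may be assumed; then, by stability, every
  -- entry of the first row is zero, and a zero row can be deleted.
  trivialKernel⇒columns≤rows : ∀ r k (M : Mat r k) → TrivialKernel M → k ℕ.≤ r
  trivialKernel⇒columns≤rows r zero M triv = ℕ.z≤n
  trivialKernel⇒columns≤rows zero (suc k) M triv = contradiction (triv (λ _ → 1#) (λ ()) zero) 1≉0
  trivialKernel⇒columns≤rows (suc r) (suc k) M triv = decidable-stable (suc k ℕ.≤? suc r) λ ≰ →
    let
      first-row≈0 : ∀ j → M zero j ≈ 0#
      first-row≈0 j = ≈-stable (M zero j) 0# λ M≉0 → invertible (M zero j) M≉0 λ (p , Mp≈1) →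
        ≰ (ℕ.s≤s (trivialKernel⇒columns≤rows r k (eliminate M j p) (eliminate-trivialKernel M j p Mp≈1 triv)))
    in ≰ (ℕ.m≤n⇒m≤1+n (trivialKernel⇒columns≤rows r (suc k) (M ∘ suc) λ c rows → triv c λ
      { zero    → sum-zero (λ j → ≈-trans (*-congʳ (first-row≈0 j)) (zeroˡ (c j)))
      ; (suc i) → rows i }))

  -- A witness of rank at most k. Sums and diagonal scalings of such witnesses are given by explicit
  -- formulas, with no search for a basis.
  record Factor {m n} (A : Mat m n) (k : ℕ) : Set where
    constructor factor
    field
      left     : Mat m k
      right    : Mat k n
      factored : ∀ i j → A i j ≈ sum (λ l → left i l * right l j)

  factor-apply : ∀ {m n k q} {A : Mat m n} (A=LR : Factor A k) (f : Fin q → Fin n) (c : Fin q → Carrier) i →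
    sum (λ j → A i (f j) * c j) ≈
    sum (λ l → Factor.left A=LR i l * sum (λ j → Factor.right A=LR l (f j) * c j))
  factor-apply {k = k} {q = q} {A} (factor L R′ A≈) f c i = begin
    sum (λ j → A i (f j) * c j)
      ≈⟨ sum-cong-≋ (λ j → *-congʳ {c j} (A≈ i (f j))) ⟩
    sum (λ j → sum (λ l → L i l * R′ l (f j)) * c j)
      ≈⟨ sum-cong-≋ (λ j → *-distribʳ-sum (c j) (λ l → L i l * R′ l (f j))) ⟩
    sum (λ j → sum (λ l → (L i l * R′ l (f j)) * c j))
      ≈⟨ ∑-comm (λ j l → (L i l * R′ l (f j)) * c j) ⟩
    sum (λ l → sum (λ j → (L i l * R′ l (f j)) * c j))
      ≈⟨ sum-cong-≋ (λ l → sum-cong-≋ (λ j → *-assoc (L i l) (R′ l (f j)) (c j))) ⟩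
    sum (λ l → sum (λ j → L i l * (R′ l (f j) * c j)))
      ≈⟨ sum-cong-≋ (λ l → *-distribˡ-sum (L i l) (λ j → R′ l (f j) * c j)) ⟨
    sum (λ l → L i l * sum (λ j → R′ l (f j) * c j)) ∎

  factor-kernel : ∀ {m n k q} {A : Mat m n} (A=LR : Factor A k) (f : Fin q → Fin n) (c : Fin q → Carrier) →
    (∀ l → sum (λ j → Factor.right A=LR l (f j) * c j) ≈ 0#) → ∀ i → sum (λ j → A i (f j) * c j) ≈ 0#
  factor-kernel A=LR f c Rc≈0 i = ≈-trans (factor-apply A=LR f c i)
    (sum-zero (λ l → ≈-trans (*-congˡ (Rc≈0 l)) (zeroʳ (Factor.left A=LR i l))))

  -- A vector killed by the selected columns of the right factor is killed by the submatrix as well.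
  -- These columns therefore form a matrix with r rows, k columns and trivial kernel.
  nonsingular-submatrix⇒≤ : ∀ {m n p k r} {A : Mat m n} → Factor A r → (g : Fin p → Fin m) (f : Fin k → Fin n) →
    TrivialKernel (λ i j → A (g i) (f j)) → k ℕ.≤ r
  nonsingular-submatrix⇒≤ {k = k} {r} A=LR g f triv =
    trivialKernel⇒columns≤rows r k (λ l j → Factor.right A=LR l (f j))
      λ c Rc≈0 → triv c (λ i → factor-kernel A=LR f c Rc≈0 (g i))

  enum : ∀ {n} (S : Subset n) → Fin ∣ S ∣ → Fin n
  enum (true  ∷ S) zero    = zero
  enum (true  ∷ S) (suc l) = suc (enum S l)
  enum (false ∷ S) l       = suc (enum S l)

  extend : ∀ {n} (S : Subset n) → (Fin ∣ S ∣ → Carrier) → Fin n → Carrier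
  extend (true  ∷ S) c zero    = c zero
  extend (true  ∷ S) c (suc j) = extend S (c ∘ suc) j
  extend (false ∷ S) c zero    = 0#
  extend (false ∷ S) c (suc j) = extend S c j

  extend-enum : ∀ {n} (S : Subset n) c l → extend S c (enum S l) ≡ c l
  extend-enum (true  ∷ S) c zero    = refl
  extend-enum (true  ∷ S) c (suc l) = extend-enum S (c ∘ suc) l
  extend-enum (false ∷ S) c l       = extend-enum S c l

  extend-∉ : ∀ {n} (S : Subset n) c j → j ∉ S → extend S c j ≈ 0#
  extend-∉ (true  ∷ S) c zero    j∉ = contradiction here j∉
  extend-∉ (true  ∷ S) c (suc j) j∉ = extend-∉ S (c ∘ suc) j (j∉ ∘ there)
  extend-∉ (false ∷ S) c zero    j∉ = ≈-refl
  extend-∉ (false ∷ S) c (suc j) j∉ = extend-∉ S c j (j∉ ∘ there)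

  sum-enum : ∀ {n} (S : Subset n) f → (∀ j → j ∉ S → f j ≈ 0#) → sum f ≈ sum (f ∘ enum S)
  sum-enum []          f off = ≈-refl
  sum-enum (true  ∷ S) f off = +-congˡ (sum-enum S (f ∘ suc) (λ j j∉ → off (suc j) λ { (there j∈) → j∉ j∈ }))
  sum-enum (false ∷ S) f off = ≈-trans
    (+-cong (off zero λ ()) (sum-enum S (f ∘ suc) (λ j j∉ → off (suc j) λ { (there j∈) → j∉ j∈ })))
    (+-identityˡ _)

  -- A kernel vector of the columns of the right factor indexed by S extends by zero to a relation
  -- among the columns of A in S, hence vanishes.
  independent⇒∣S∣≤ : ∀ {m n k} {A : Mat m n} {S} → Independent A S → Factor A k → ∣ S ∣ ℕ.≤ k
  independent⇒∣S∣≤ {k = k} {A} {S} ind A=LR = trivialKernel⇒columns≤rows k ∣ S ∣ (λ l j → Factor.right A=LR l (enum S j))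
    λ c Rc≈0 l → begin
      c l                   ≡⟨ extend-enum S c l ⟨
      extend S c (enum S l) ≈⟨ ind (extend S c) (extend-∉ S c) (factor-kernel A=LR id (extend S c) λ l′ → begin
          sum (λ j → Factor.right A=LR l′ j * extend S c j)
            ≈⟨ sum-enum S _ (λ j j∉ → ≈-trans (*-congˡ (extend-∉ S c j j∉)) (zeroʳ _)) ⟩
          sum (λ j → Factor.right A=LR l′ (enum S j) * extend S c (enum S j))
            ≈⟨ sum-cong-≋ (λ j → *-congˡ {Factor.right A=LR l′ (enum S j)} (reflexive (extend-enum S c j))) ⟩
          sum (λ j → Factor.right A=LR l′ (enum S j) * c j)
            ≈⟨ Rc≈0 l′ ⟩
          0# ∎) (enum S l) ⟩
      0#                    ∎

  δ : ∀ {n} → Fin n → Fin n → Carrier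
  δ i j with i Fin.≟ j
  ... | yes _ = 1#
  ... | no  _ = 0#

  δ-diag : ∀ {n} (i : Fin n) → δ i i ≈ 1#
  δ-diag i with i Fin.≟ i
  ... | yes _  = ≈-refl
  ... | no i≢i = contradiction refl i≢i

  δ-off : ∀ {n} {i j : Fin n} → i ≢ j → δ i j ≈ 0#
  δ-off {i = i} {j} i≢j with i Fin.≟ j
  ... | yes i≡j = contradiction i≡j i≢j
  ... | no  _   = ≈-refl

  sum-δ : ∀ {n} (f : Fin n → Carrier) j → sum (λ l → f l * δ j l) ≈ f j
  sum-δ {suc n} f j = begin
    sum (λ l → f l * δ j l)
      ≈⟨ sum-remove {i = j} (λ l → f l * δ j l) ⟩
    f j * δ j j + sum (λ l → f (punchIn j l) * δ j (punchIn j l))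
      ≈⟨ +-cong (≈-trans (*-congˡ (δ-diag j)) (*-identityʳ (f j)))
           (sum-zero (λ l → ≈-trans (*-congˡ {f (punchIn j l)} (δ-off (Fin.punchInᵢ≢i j l ∘ sym))) (zeroʳ _))) ⟩
    f j + 0#
      ≈⟨ +-identityʳ (f j) ⟩
    f j ∎

  -- By maximality S spans every column of A. The columns in S form the left factor, the
  -- coefficients of the spanning combinations the right one.
  maximal-independent⇒factor : ∀ {m n} {A : Mat m n} {S} → Independent A S →
    (∀ S′ → Independent A S′ → ∣ S′ ∣ ℕ.≤ ∣ S ∣) → ¬ ¬ Factor A ∣ S ∣
  maximal-independent⇒factor {m} {n} {A} {S} ind max no-factor = ¬¬-Π spanned λ span →
    no-factor (factor (λ i l → A i (enum S l)) (λ l j → proj₁ (span j) (enum S l)) λ i j →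
      let g , off , combination = span j in
      ≈-trans (combination i) (sum-enum S _ (λ l l∉ → ≈-trans (*-congˡ (off l l∉)) (zeroʳ _))))
    where
    Spanned : Fin n → Set
    Spanned j = ∃ λ (g : Fin n → Carrier) → (∀ l → l ∉ S → g l ≈ 0#) × (∀ i → A i j ≈ sum (λ l → A i l * g l))

    spanned : ∀ j → ¬ ¬ Spanned j
    spanned j ¬span with j ∈ₛ? S
    ... | yes j∈S = ¬span (δ j , (λ l l∉ → δ-off {i = j} {l} λ { refl → l∉ j∈S }) , λ i → ≈-sym (sum-δ (A i) j))
    ... | no  j∉S = contradiction (max (S ∪ ⁅ j ⁆) ind′)
        (ℕ.<⇒≱ (p⊂q⇒∣p∣<∣q∣ (p⊆p∪q ⁅ j ⁆ , j , q⊆p∪q S ⁅ j ⁆ (x∈⁅x⁆ j) , j∉S)))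
      where
      ind′ : Independent A (S ∪ ⁅ j ⁆)
      ind′ c off Ac≈0 = ind c off-S Ac≈0
        where
        off-S∪j : ∀ l → l ∉ S → l ≢ j → c l ≈ 0#
        off-S∪j l l∉ l≢j = off l λ l∈ → [ l∉ , (λ l∈j → l≢j (x∈⁅y⁆⇒x≡y j l∈j)) ] (x∈p∪q⁻ S ⁅ j ⁆ l∈)

        cj≈0 : c j ≈ 0#
        cj≈0 = ≈-stable (c j) 0# λ cj≉0 → invertible (c j) cj≉0 λ (p , cp≈1) → ¬span
          -- The relation c has an invertible coefficient at j and can be solved for column j.
          -- Subtracting c / c_j from the unit vector at j leaves the combination unchanged and
          -- clears the coefficient at j.
          ( (λ l → δ j l + (- p) * c l)
          , (λ l l∉ → g-off p cp≈1 l l∉)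
          , λ i → begin
              A i j
                ≈⟨ +-identityʳ (A i j) ⟨
              A i j + 0#
                ≈⟨ +-cong (sum-δ (A i) j) (≈-trans (*-congˡ (Ac≈0 i)) (zeroʳ (- p))) ⟨
              sum (λ l → A i l * δ j l) + (- p) * sum (λ l → A i l * c l)
                ≈⟨ sum-linear (A i) (δ j) c (- p) ⟨
              sum (λ l → A i l * (δ j l + (- p) * c l)) ∎ )
          where
          g-off : ∀ p → c j * p ≈ 1# → ∀ l → l ∉ S → δ j l + (- p) * c l ≈ 0#
          g-off p cp≈1 l l∉ with j Fin.≟ l
          ... | yes refl = begin
            1# + (- p) * c j    ≈⟨ +-congˡ (≈-trans (≈-sym (-‿distribˡ-* p (c j))) (-‿cong (≈-trans (*-comm p (c j)) cp≈1))) ⟩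
            1# + (- 1#)         ≈⟨ -‿inverseʳ 1# ⟩
            0#                  ∎
          ... | no j≢l = ≈-trans (+-identityˡ _) (≈-trans (*-congˡ (off-S∪j l l∉ (j≢l ∘ sym))) (zeroʳ (- p)))

        off-S : ∀ l → l ∉ S → c l ≈ 0#
        off-S l l∉ with l Fin.≟ j
        ... | yes refl = cj≈0
        ... | no  l≢j  = off-S∪j l l∉ l≢j

  sum-splitAt : ∀ k {l} (h : Fin k ⊎ Fin l → Carrier) → sum (h ∘ splitAt k) ≈ sum (h ∘ inj₁) + sum (h ∘ inj₂)
  sum-splitAt zero    h = ≈-sym (+-identityˡ _)
  sum-splitAt (suc k) h = ≈-trans (+-congˡ (sum-splitAt k (h ∘ map₁ suc))) (≈-sym (+-assoc _ _ _))

  factor-cong : ∀ {m n k} {A B : Mat m n} → (∀ i j → A i j ≈ B i j) → Factor A k → Factor B k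
  factor-cong A≈B (factor L R′ A≈) = factor L R′ λ i j → ≈-trans (≈-sym (A≈B i j)) (A≈ i j)

  factor-+ : ∀ {m n k l} {A B : Mat m n} → Factor A k → Factor B l → Factor (λ i j → A i j + B i j) (k ℕ.+ l)
  factor-+ {k = k} (factor L R′ A≈) (factor L₂ R₂ B≈) = factor
    (λ i → [ L i , L₂ i ] ∘ splitAt k) (λ l j → [ (λ p → R′ p j) , (λ q → R₂ q j) ] (splitAt k l))
    λ i j → ≈-trans (+-cong (A≈ i j) (B≈ i j))
      (≈-sym (sum-splitAt k (λ s → [ L i , L₂ i ] s * [ (λ p → R′ p j) , (λ q → R₂ q j) ] s)))

  factor-scale : ∀ {m n k} {A : Mat m n} (a : Fin m → Carrier) (b : Fin n → Carrier) →
    Factor A k → Factor (λ i j → a i * A i j * b j) k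
  factor-scale {A = A} a b (factor L R′ A≈) = factor (λ i l → a i * L i l) (λ l j → R′ l j * b j) λ i j → begin
    a i * A i j * b j
      ≈⟨ *-congʳ (*-congˡ (A≈ i j)) ⟩
    a i * sum (λ l → L i l * R′ l j) * b j
      ≈⟨ *-congʳ (*-distribˡ-sum (a i) (λ l → L i l * R′ l j)) ⟩
    sum (λ l → a i * (L i l * R′ l j)) * b j
      ≈⟨ *-distribʳ-sum (b j) (λ l → a i * (L i l * R′ l j)) ⟩
    sum (λ l → a i * (L i l * R′ l j) * b j)
      ≈⟨ sum-cong-≋ (λ l → solve 4 (λ x y z w → x :* (y :* z) :* w := (x :* y) :* (z :* w)) ≈-refl
           (a i) (L i l) (R′ l j) (b j)) ⟩
    sum (λ l → (a i * L i l) * (R′ l j * b j)) ∎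

  factor-outer : ∀ {m n} (a : Fin m → Carrier) (b : Fin n → Carrier) → Factor (λ i j → a i * b j) 1
  factor-outer a b = factor (λ i _ → a i) (λ _ j → b j) λ i j → ≈-sym (+-identityʳ _)

  -- Each k ∈ K accounts for two rank-one matrices: its row and its column.
  factor-cover : ∀ {n} (K : List (Fin n)) (D : Mat n n) →
    (∀ i j → ¬ i ∈ K → ¬ j ∈ K → D i j ≈ 0#) → Factor D (length K ℕ.* 2)
  factor-cover []      D D≈0 = factor (λ _ ()) (λ ()) λ i j → D≈0 i j (λ ()) (λ ())
  factor-cover {n} (k ∷ K) D D≈0 = factor-cong decompose
    (factor-+ (factor-outer (δ k) (D k)) (factor-+ (factor-outer column (δ k)) (factor-cover K rest rest≈0)))
    where
    -- The entry (k, k) already belongs to the row, so the column has 0 there.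
    column : Fin n → Carrier
    column i with k Fin.≟ i
    ... | yes _ = 0#
    ... | no  _ = D i k

    rest : Mat n n
    rest i j with k Fin.≟ i | k Fin.≟ j
    ... | no _ | no _  = D i j
    ... | _    | _     = 0#

    rest≈0 : ∀ i j → ¬ i ∈ K → ¬ j ∈ K → rest i j ≈ 0#
    rest≈0 i j i∉ j∉ with k Fin.≟ i | k Fin.≟ j
    ... | yes _  | _      = ≈-refl
    ... | no _   | yes _  = ≈-refl
    ... | no k≢i | no k≢j = D≈0 i j (λ { (here i≡k) → k≢i (sym i≡k) ; (there i∈) → i∉ i∈ })
                                    (λ { (here j≡k) → k≢j (sym j≡k) ; (there j∈) → j∉ j∈ })

    decompose : ∀ i j → δ k i * D k j + (column i * δ k j + rest i j) ≈ D i j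
    decompose i j with k Fin.≟ i | k Fin.≟ j
    ... | yes refl | yes refl = solve 1 (λ d → con 1 :* d :+ (con 0 :* con 1 :+ con 0) := d) ≈-refl (D i j)
    ... | yes refl | no _     = solve 1 (λ d → con 1 :* d :+ (con 0 :* con 0 :+ con 0) := d) ≈-refl (D i j)
    ... | no _     | yes refl = solve 2 (λ d c → con 0 :* c :+ (d :* con 1 :+ con 0) := d) ≈-refl (D i j) (D k j)
    ... | no _     | no _     = solve 3 (λ d c b → con 0 :* c :+ (b :* con 0 :+ d) := d) ≈-refl (D i j) (D k j) (D i k)

-- Lists without repetitions

module _ {A : Set} where

  lookup-injective : {xs : List A} → Unique xs → ∀ i j → lookup xs i ≡ lookup xs j → i ≡ j
  lookup-injective (_ ∷ _)    zero    zero    _  = refl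
  lookup-injective (x∉ ∷ _)   zero    (suc j) eq = contradiction eq (All.lookup x∉ (∈-lookup j))
  lookup-injective (x∉ ∷ _)   (suc i) zero    eq = contradiction (sym eq) (All.lookup x∉ (∈-lookup i))
  lookup-injective (_ ∷ uniq) (suc i) (suc j) eq = cong suc (lookup-injective uniq i j eq)

  unique-⊆⇒length≤ : {xs ys : List A} → Unique xs → (∀ {x} → x ∈ xs → x ∈ ys) → length xs ℕ.≤ length ys
  unique-⊆⇒length≤ {xs} {ys} uniq xs⊆ys = Fin.injective⇒≤ {f = position} λ {i} {j} eq →
    lookup-injective uniq i j (trans (position-lookup i) (trans (cong (lookup ys) eq) (sym (position-lookup j))))
    where
    position : Fin (length xs) → Fin (length ys)
    position i = index (xs⊆ys (∈-lookup i))

    position-lookup : ∀ i → lookup xs i ≡ lookup ys (position i)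
    position-lookup i = lookup-index (xs⊆ys (∈-lookup i))

  length-filter-∁ : {P : A → Set} (P? : Decidable P) (xs : List A) →
    length (filter P? xs) ℕ.+ length (filter (∁? P?) xs) ≡ length xs
  length-filter-∁ P? [] = refl
  length-filter-∁ P? (x ∷ xs) with P? x
  ... | yes _ = cong suc (length-filter-∁ P? xs)
  ... | no  _ = trans (ℕ.+-suc (length (filter P? xs)) _) (cong suc (length-filter-∁ P? xs))

  unique-++⇒∉ : ∀ (pre : List A) {x post} → Unique (pre ++ x ∷ post) → ¬ x ∈ post
  unique-++⇒∉ []        uniq       = Unique.Unique[x∷xs]⇒x∉xs uniq
  unique-++⇒∉ (_ ∷ pre) (_ ∷ uniq) = unique-++⇒∉ pre uniq

-- Spanning forests

module _ {k : ℕ} (x y : Fin (suc k)) (x≢y : x ≢ y) where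

  -- The quotient by x = y, realised by dropping x from the set of labels. A new forest edge thus
  -- lowers the number of labels by exactly one.
  identify : Fin (suc k) → Fin k
  identify z with x Fin.≟ z
  ... | yes _  = punchOut x≢y
  ... | no x≢z = punchOut x≢z

  identify-punchIn : ∀ c → identify (punchIn x c) ≡ c
  identify-punchIn c with x Fin.≟ punchIn x c
  ... | yes eq = contradiction (sym eq) (Fin.punchInᵢ≢i x c)
  ... | no _   = trans (Fin.punchOut-cong x refl) (Fin.punchOut-punchIn x)

  identify-glues : identify x ≡ identify y
  identify-glues with x Fin.≟ x | x Fin.≟ y
  ... | no x≢x | _      = contradiction refl x≢x
  ... | _      | yes eq = contradiction eq x≢y
  ... | yes _  | no _   = Fin.punchOut-cong x refl

  identify-reflects : ∀ z w → identify z ≡ identify w → z ≡ w ⊎ (z ≡ x × w ≡ y) ⊎ (z ≡ y × w ≡ x)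
  identify-reflects z w eq with x Fin.≟ z | x Fin.≟ w
  ... | yes refl | yes refl = inj₁ refl
  ... | yes refl | no x≢w   = inj₂ (inj₁ (refl , sym (Fin.punchOut-injective x≢y x≢w eq)))
  ... | no x≢z   | yes refl = inj₂ (inj₂ (Fin.punchOut-injective x≢z x≢y eq , refl))
  ... | no x≢z   | no x≢w   = inj₁ (Fin.punchOut-injective x≢z x≢w eq)

Joined : ∀ {n} → List (Fin n × Fin n) → Fin n → Fin n → Set
Joined es i j = (i , j) ∈ es ⊎ (j , i) ∈ es

module _ {n : ℕ} (𝒢 : AbelianGroup 0ℓ 0ℓ) (gain : Fin n → Fin n → AbelianGroup.Carrier 𝒢) where
  open AbelianGroup 𝒢 using (Carrier; _≈_; _∙_; ε; _⁻¹; ∙-congʳ; ∙-congˡ; assoc; comm; identityˡ; inverseʳ; setoid)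

  -- The edges of es are scanned one by one: an edge either joins two components,
  -- and then the potential of one of them is adjusted so that the edge becomes
  -- balanced, or it closes a cycle, and then its first endpoint is put into extra.
  record SpanningForest (es : List (Fin n × Fin n)) : Set where
    field
      size           : ℕ
      label          : Fin n → Fin size
      representative : ∀ c → ∃ λ i → label i ≡ c
      sound          : ∀ i j → label i ≡ label j → Star (Joined es) i j
      complete       : All (λ (i , j) → label i ≡ label j) es
      potential      : Fin n → Carrier
      extra          : List (Fin n)
      -- Euler's relation: a forest edge lowers the number of components by one, an extra edge
      -- leaves it unchanged.
      size+length    : size ℕ.+ length es ≡ n ℕ.+ length extra
      balanced       : All (λ (i , j) → i ∈ extra ⊎ potential i ∙ gain i j ≈ potential j) es
      -- The list is scanned from its end, so `post` holds the edges met before ab. An extra edge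
      -- joins two vertices that these already connect.
      redundant      : extra ≡ [] ⊎ ∃₂ λ a b → ∃₂ λ pre post →
                         es ≡ pre ++ (a , b) ∷ post × Star (Joined post) a b

  private
    weaken : ∀ {e es} {i j : Fin n} → Star (Joined es) i j → Star (Joined (e ∷ es)) i j
    weaken = Star.map (Sum.map there there)

    redundant-∷ : ∀ {extra : List (Fin n)} {es} (e : Fin n × Fin n) →
      extra ≡ [] ⊎ (∃₂ λ a b → ∃₂ λ pre post → es ≡ pre ++ (a , b) ∷ post × Star (Joined post) a b) →
      extra ≡ [] ⊎ (∃₂ λ a b → ∃₂ λ pre post → e ∷ es ≡ pre ++ (a , b) ∷ post × Star (Joined post) a b)
    redundant-∷ e = Sum.map₂ λ (a , b , pre , post , eq , path) → a , b , e ∷ pre , post , cong (e ∷_) eq , path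

    close : ∀ {es} (T : SpanningForest es) a b → SpanningForest.label T a ≡ SpanningForest.label T b →
            SpanningForest ((a , b) ∷ es)
    close {es} T a b a~b = record
      { size           = size
      ; label          = label
      ; representative = representative
      ; sound          = λ i j eq → weaken (sound i j eq)
      ; complete       = a~b ∷ complete
      ; potential      = potential
      ; extra          = a ∷ extra
      ; size+length    = trans (ℕ.+-suc size (length es)) (trans (cong suc size+length) (sym (ℕ.+-suc n (length extra))))
      ; balanced       = inj₁ (here refl) ∷ All.map (Sum.map₁ there) balanced
      ; redundant      = inj₂ (a , b , [] , es , refl , sound a b a~b)
      }
      where open SpanningForest T

    attach : ∀ {es} (T : SpanningForest es) a b → SpanningForest.label T b ≢ SpanningForest.label T a →
             SpanningForest ((a , b) ∷ es)
    attach record { size = zero ; label = label } a b _ = contradiction (label a) λ ()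
    attach {es} record { size = suc k ; label = label ; representative = representative ; sound = sound
                  ; complete = complete ; potential = potential ; extra = extra
                  ; size+length = size+length ; balanced = balanced ; redundant = redundant } a b b≁a = record
      { size           = k
      ; label          = glue ∘ label
      ; representative = λ c → let i , eq = representative (punchIn (label b) c)
                               in i , trans (cong glue eq) (identify-punchIn (label b) (label a) b≁a c)
      ; sound          = sound′
      ; complete       = sym (identify-glues (label b) (label a) b≁a) ∷ All.map (cong glue) complete
      ; potential      = potential′
      ; extra          = extra
      ; size+length    = trans (ℕ.+-suc k (length es)) size+length
      ; balanced       = inj₂ new-edge ∷ All.zipWith (λ (i~j , bal) → Sum.map₂ (old-edge i~j) bal) (complete , balanced)
      ; redundant      = redundant-∷ {extra} (a , b) redundant
      }
      where
      open SetoidReasoning setoid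

      glue : Fin (suc k) → Fin k
      glue = identify (label b) (label a) b≁a

      sound′ : ∀ i j → glue (label i) ≡ glue (label j) → Star (Joined ((a , b) ∷ es)) i j
      sound′ i j eq with identify-reflects (label b) (label a) b≁a (label i) (label j) eq
      ... | inj₁ i~j                = weaken (sound i j i~j)
      ... | inj₂ (inj₁ (i~b , j~a)) = weaken (sound i b i~b) ◅◅ inj₂ (here refl) ◅ weaken (sound a j (sym j~a))
      ... | inj₂ (inj₂ (i~a , j~b)) = weaken (sound i a i~a) ◅◅ inj₁ (here refl) ◅ weaken (sound b j (sym j~b))

      -- Multiplying the potential on the whole component of b by one element keeps the edges inside
      -- it balanced; this element also balances ab.
      shift : Carrier
      shift = potential b ⁻¹ ∙ (potential a ∙ gain a b)

      potential′ : Fin n → Carrier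
      potential′ i with label i Fin.≟ label b
      ... | yes _ = potential i ∙ shift
      ... | no  _ = potential i

      new-edge : potential′ a ∙ gain a b ≈ potential′ b
      new-edge with label a Fin.≟ label b | label b Fin.≟ label b
      ... | yes a~b | _      = contradiction (sym a~b) b≁a
      ... | _       | no b≁b = contradiction refl b≁b
      ... | no _    | yes _  = begin
        potential a ∙ gain a b                                        ≈⟨ identityˡ _ ⟨
        ε ∙ (potential a ∙ gain a b)                                  ≈⟨ ∙-congʳ (inverseʳ (potential b)) ⟨
        (potential b ∙ potential b ⁻¹) ∙ (potential a ∙ gain a b)     ≈⟨ assoc _ _ _ ⟩
        potential b ∙ (potential b ⁻¹ ∙ (potential a ∙ gain a b))     ∎

      old-edge : ∀ {i j} → label i ≡ label j → potential i ∙ gain i j ≈ potential j →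
                 potential′ i ∙ gain i j ≈ potential′ j
      old-edge {i} {j} i~j bal with label i Fin.≟ label b | label j Fin.≟ label b
      ... | yes _   | yes _   = begin
        (potential i ∙ shift) ∙ gain i j  ≈⟨ assoc _ _ _ ⟩
        potential i ∙ (shift ∙ gain i j)  ≈⟨ ∙-congˡ (comm shift (gain i j)) ⟩
        potential i ∙ (gain i j ∙ shift)  ≈⟨ assoc _ _ _ ⟨
        (potential i ∙ gain i j) ∙ shift  ≈⟨ ∙-congʳ bal ⟩
        potential j ∙ shift               ∎
      ... | no _    | no _    = bal
      ... | yes i~b | no j≁b  = contradiction (trans (sym i~j) i~b) j≁b
      ... | no i≁b  | yes j~b = contradiction (trans i~j j~b) i≁b

  spanningForest : ∀ es → SpanningForest es
  spanningForest [] = record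
    { size = n ; label = id ; representative = λ c → c , refl ; sound = λ { i _ refl → nil } ; complete = []
    ; potential = λ _ → ε ; extra = [] ; size+length = refl ; balanced = [] ; redundant = inj₁ refl }
  spanningForest ((a , b) ∷ es) with spanningForest es
  ... | T with SpanningForest.label T b Fin.≟ SpanningForest.label T a
  ...   | yes b~a = close T a b (sym b~a)
  ...   | no  b≁a = attach T a b b≁a

-- Simple paths

-- The list omits the start, so `x ∷ vs` is the vertex sequence and the length of `vs` is the number
-- of edges.
data SimplePath {n : ℕ} (E : Fin n → Fin n → Set) : Fin n → Fin n → List (Fin n) → Set where
  done : ∀ {x} → SimplePath E x x []
  step : ∀ {x y z vs} → E x y → ¬ x ∈ (y ∷ vs) → SimplePath E y z vs → SimplePath E x z (y ∷ vs)

module _ {n : ℕ} {E : Fin n → Fin n → Set} where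
  open DecMembership (Fin._≟_ {n}) using (_∈?_)

  path-from : ∀ {x y z vs} → x ∈ (y ∷ vs) → SimplePath E y z vs → ∃ (SimplePath E x z)
  path-from (here refl) p            = _ , p
  path-from (there x∈)  (step _ _ p) = path-from x∈ p

  -- If the new start already lies on the loop-free remainder, the path is cut down to the part from
  -- that occurrence on.
  loop-erase : ∀ {x z} → Star E x z → ∃ (SimplePath E x z)
  loop-erase nil = [] , done
  loop-erase {x} (_◅_ {j = y} e es) with loop-erase es
  ... | vs , p with x ∈? (y ∷ vs)
  ...   | yes x∈ = path-from x∈ p
  ...   | no  x∉ = y ∷ vs , step e x∉ p

  path-unique : ∀ {x z vs} → SimplePath E x z vs → Unique (x ∷ vs)
  path-unique done          = [] ∷ []
  path-unique (step _ x∉ p) = All.tabulate (λ y∈ x≡y → x∉ (subst (_∈ _) (sym x≡y) y∈)) ∷ path-unique p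

  path-step : ∀ {x z vs} → SimplePath E x z vs → ∀ i → E (lookup (x ∷ vs) (inject₁ i)) (lookup vs i)
  path-step (step e _ _) zero    = e
  path-step (step _ _ p) (suc i) = path-step p i

  path-end : ∀ {x z vs} → SimplePath E x z vs → lookup (x ∷ vs) (fromℕ (length vs)) ≡ z
  path-end done         = refl
  path-end (step _ _ p) = path-end p

-- `next` is defined through a remainder. This equation and the following one replace it, on cycles
-- of unspecified length, by a step forward and the return to the start.
next-inject₁ : ∀ {k} (i : Fin k) → next (inject₁ i) ≡ suc i
next-inject₁ {k} i = Fin.toℕ-injective (trans (Fin.toℕ-fromℕ< _)
  (trans (cong (λ m → suc m ℕ.% suc k) (Fin.toℕ-inject₁ i)) (ℕ.m<n⇒m%n≡m (ℕ.s≤s (Fin.toℕ<n i)))))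

next-fromℕ : ∀ k → next (fromℕ k) ≡ zero
next-fromℕ k = Fin.toℕ-injective (trans (Fin.toℕ-fromℕ< _)
  (trans (cong (λ m → suc m ℕ.% suc k) (Fin.toℕ-fromℕ k)) (ℕ.n%n≡0 (suc k))))

-- Edges and the cyclomatic number

-- Gives the pair ij the orientation in which `edges` lists it, so that unordered edges can be
-- compared.
edge : ∀ {n} → Fin n → Fin n → Fin n × Fin n
edge i j with i Fin.<? j
... | yes _ = i , j
... | no  _ = j , i

edge-injective : ∀ {n} (i j k l : Fin n) → edge i j ≡ edge k l → (i ≡ k × j ≡ l) ⊎ (i ≡ l × j ≡ k)
edge-injective i j k l eq with i Fin.<? j | k Fin.<? l
edge-injective i j k l refl | yes _ | yes _ = inj₁ (refl , refl)
edge-injective i j k l refl | yes _ | no _  = inj₂ (refl , refl)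
edge-injective i j k l refl | no _  | yes _ = inj₂ (refl , refl)
edge-injective i j k l refl | no _  | no _  = inj₁ (refl , refl)

edge-comm : ∀ {n} {i j : Fin n} → i ≢ j → edge i j ≡ edge j i
edge-comm {i = i} {j} i≢j with i Fin.<? j | j Fin.<? i
... | yes i<j | yes j<i = contradiction j<i (Fin.<-asym i<j)
... | yes _   | no _    = refl
... | no _    | yes _   = refl
... | no i≮j  | no j≮i  = contradiction (Fin.toℕ-injective (ℕ.≤-antisym (ℕ.≮⇒≥ j≮i) (ℕ.≮⇒≥ i≮j))) i≢j

edge-∈⇒joined : ∀ {n} {es} (i j : Fin n) → edge i j ∈ es → Joined es i j
edge-∈⇒joined i j e∈ with i Fin.<? j
... | yes _ = inj₁ e∈
... | no  _ = inj₂ e∈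

module _ {n : ℕ} where

  -- Representatives of the classes of f carry pairwise distinct labels under g, since g separates
  -- whatever f separates.
  labels≤ : ∀ {k l} (f : Fin n → Fin k) → (∀ c → ∃ λ i → f i ≡ c) → (g : Fin n → Fin l) →
            (∀ i j → g i ≡ g j → f i ≡ f j) → k ℕ.≤ l
  labels≤ f surj g coarser = Fin.injective⇒≤ {f = g ∘ proj₁ ∘ surj} λ {c} {d} eq →
    trans (sym (proj₂ (surj c))) (trans (coarser _ _ eq) (proj₂ (surj d)))

  star-invariant : ∀ {B : Set} {E : Fin n → Fin n → Set} (f : Fin n → B) →
    (∀ {i j} → E i j → f i ≡ f j) → ∀ {i j} → Star E i j → f i ≡ f j
  star-invariant f inv nil      = refl
  star-invariant f inv (e ◅ es) = trans (inv e) (star-invariant f inv es)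

  joined-label : ∀ {B : Set} {es} {f : Fin n → B} → All (λ (i , j) → f i ≡ f j) es →
    ∀ {i j} → Joined es i j → f i ≡ f j
  joined-label eqs (inj₁ e∈) = All.lookup eqs e∈
  joined-label eqs (inj₂ e∈) = sym (All.lookup eqs e∈)

module _ {n : ℕ} (G : SimpleGraph n) where
  open SimpleGraph G using (adj; adj-sym; adj-irrefl)

  adjacent⇒≢ : ∀ {i j} → Adj G i j → i ≢ j
  adjacent⇒≢ {i} ij refl = adj-irrefl i ij

  ∈-edges⁻ : ∀ {i j} → (i , j) ∈ edges G → i Fin.< j × Adj G i j
  ∈-edges⁻ e∈ = proj₂ (∈-filter⁻ (λ (i , j) → (i Fin.<? j) ×-dec T? (adj i j))
                        {xs = cartesianProduct (allFin n) (allFin n)} e∈)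

  ∈-edges⁺ : ∀ {i j} → Adj G i j → edge i j ∈ edges G
  ∈-edges⁺ {i} {j} ij with i Fin.<? j
  ... | yes i<j = ∈-filter⁺ (λ (i , j) → (i Fin.<? j) ×-dec T? (adj i j))
                    (∈-cartesianProduct⁺ (∈-allFin i) (∈-allFin j)) (i<j , ij)
  ... | no  i≮j = ∈-filter⁺ (λ (i , j) → (i Fin.<? j) ×-dec T? (adj i j))
                    (∈-cartesianProduct⁺ (∈-allFin j) (∈-allFin i))
                    (Fin.≤∧≢⇒< (ℕ.≮⇒≥ i≮j) (adjacent⇒≢ ij ∘ sym) , adj-sym i j ij)

  edges-unique : Unique (edges G)
  edges-unique = Unique.filter⁺ (λ (i , j) → (i Fin.<? j) ×-dec T? (adj i j))
    (Unique.cartesianProduct⁺ (Unique.allFin⁺ n) (Unique.allFin⁺ n))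

  open ComponentLabelling (proj₂ (componentLabelling G)) renaming (label to component) using (label-surjective; label-connected)

  -- Each labelling is constant on the classes of the other, so there are equally many classes. This
  -- ties the scan to `ω`, of which only the specification `ComponentLabelling` enters.
  forest-size : ∀ {𝒢 gain es} (T : SpanningForest 𝒢 gain es) →
    (∀ {i j} → (i , j) ∈ es → Adj G i j) → (∀ {i j} → Adj G i j → Star (Joined es) i j) →
    SpanningForest.size T ≡ ω G
  forest-size T es⊆G generates = ℕ.≤-antisym
    (labels≤ label representative component λ i j eq → star-invariant label
      (λ ij → star-invariant label (joined-label complete) (generates ij)) (Equivalence.to (label-connected i j) eq))
    (labels≤ component label-surjective label λ i j eq → Equivalence.from (label-connected i j)
      (Star.map [ es⊆G , (λ e∈ → adj-sym _ _ (es⊆G e∈)) ] (sound i j eq)))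
    where open SpanningForest T

  ∈-edges⇒adjacent : ∀ {i j} → (i , j) ∈ edges G → Adj G i j
  ∈-edges⇒adjacent = proj₂ ∘ ∈-edges⁻

  -- θ G = t, with all terms moved so that no subtraction occurs.
  IsCyclomatic : ℕ → Set
  IsCyclomatic t = ω G ℕ.+ length (edges G) ≡ n ℕ.+ t

  cyclomatic⇒θ : ∀ {t} → IsCyclomatic t → θ G ≡ + t
  cyclomatic⇒θ {t} eq = begin
    + length (edges G) ℤ.- + n ℤ.+ + ω G        ≡⟨ ℤ.+-assoc (+ length (edges G)) (ℤ.- + n) (+ ω G) ⟩
    + length (edges G) ℤ.+ (ℤ.- + n ℤ.+ + ω G)  ≡⟨ cong (λ z → + length (edges G) ℤ.+ z) (ℤ.+-comm (ℤ.- + n) (+ ω G)) ⟩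
    + length (edges G) ℤ.+ (+ ω G ℤ.- + n)      ≡⟨ ℤ.+-assoc (+ length (edges G)) (+ ω G) (ℤ.- + n) ⟨
    + (length (edges G) ℕ.+ ω G) ℤ.- + n        ≡⟨ cong (λ m → + m ℤ.- + n) (trans (ℕ.+-comm (length (edges G)) (ω G)) eq) ⟩
    + (n ℕ.+ t) ℤ.- + n                         ≡⟨ cong (λ m → + m ℤ.- + n) (ℕ.+-comm n t) ⟩
    + (t ℕ.+ n) ℤ.- + n                         ≡⟨ ℤ.+-assoc (+ t) (+ n) (ℤ.- + n) ⟩
    + t ℤ.+ (+ n ℤ.- + n)                       ≡⟨ cong (λ z → + t ℤ.+ z) (ℤ.+-inverseʳ (+ n)) ⟩
    + t ℤ.+ + 0                                 ≡⟨ ℤ.+-identityʳ (+ t) ⟩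
    + t                                         ∎
    where open ≡-Reasoning

  forest-cyclomatic : ∀ {𝒢 gain} (T : SpanningForest 𝒢 gain (edges G)) →
    IsCyclomatic (length (SpanningForest.extra T))
  forest-cyclomatic T = trans
    (cong (ℕ._+ length (edges G)) (sym (forest-size T ∈-edges⇒adjacent
      (λ {i} {j} ij → edge-∈⇒joined i j (∈-edges⁺ ij) ◅ nil))))
    (SpanningForest.size+length T)

  private
    trivial : AbelianGroup 0ℓ 0ℓ
    trivial = Terminal.abelianGroup

    trivialForest : ∀ es → SpanningForest {n} trivial _ es
    trivialForest = spanningForest trivial _

  cyclomatic-unique : ∀ {s t} → IsCyclomatic s → IsCyclomatic t → s ≡ t
  cyclomatic-unique {s} {t} p q = ℕ.+-cancelˡ-≡ n s t (trans (sym p) q)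

  -- If some of the edges already generate the connectivity of G, then each of the
  -- remaining ones contributes an independent cycle.
  redundant-edges≤ : ∀ {P : Fin n × Fin n → Set} (P? : Decidable P) {t} → IsCyclomatic t →
    (∀ {i j} → Adj G i j → Star (Joined (filter P? (edges G))) i j) → length (filter (∁? P?) (edges G)) ℕ.≤ t
  redundant-edges≤ P? {t} cyc generates = ℕ.+-cancelˡ-≤ n _ _ (begin
    n ℕ.+ length rest                      ≤⟨ ℕ.+-monoˡ-≤ (length rest) (ℕ.m≤m+n n (length extra)) ⟩
    n ℕ.+ length extra ℕ.+ length rest     ≡⟨ cong (ℕ._+ length rest) size+length ⟨
    size ℕ.+ length kept ℕ.+ length rest   ≡⟨ cong (λ s → s ℕ.+ length kept ℕ.+ length rest) (forest-size T kept⊆G generates) ⟩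
    ω G ℕ.+ length kept ℕ.+ length rest    ≡⟨ ℕ.+-assoc (ω G) (length kept) (length rest) ⟩
    ω G ℕ.+ (length kept ℕ.+ length rest)  ≡⟨ cong (ω G ℕ.+_) (length-filter-∁ P? (edges G)) ⟩
    ω G ℕ.+ length (edges G)               ≡⟨ cyc ⟩
    n ℕ.+ t                                ∎)
    where
    open ℕ.≤-Reasoning
    kept = filter P? (edges G)
    rest = filter (∁? P?) (edges G)
    T = trivialForest kept
    open SpanningForest T
    kept⊆G : ∀ {i j} → (i , j) ∈ kept → Adj G i j
    kept⊆G e∈ = ∈-edges⇒adjacent (proj₁ (∈-filter⁻ P? {xs = edges G} e∈))

  cyclomatic-exists : ∃ IsCyclomatic
  cyclomatic-exists = _ , forest-cyclomatic (trivialForest (edges G))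

  -- Loop erasure leaves a simple path from a to b other than the edge ab, hence of length at least
  -- two, and the edge from b back to a closes it.
  redundant-edge⇒cycle : ∀ {a b pre post} → edges G ≡ pre ++ (a , b) ∷ post → Star (Joined post) a b →
    ∃ (Cycle G)
  redundant-edge⇒cycle {a} {b} {pre} {post} eq path with loop-erase (Star.map avoid path)
    where
    post⊆ : ∀ {e} → e ∈ post → e ∈ edges G
    post⊆ e∈ = subst (_ ∈_) (sym eq) (∈-++⁺ʳ pre (there e∈))
    ab∈ : (a , b) ∈ edges G
    ab∈ = subst ((a , b) ∈_) (sym eq) (∈-++⁺ʳ pre (here refl))
    -- Excluding the step from a to b rules out a path of length one. This step is absent because
    -- `edges` lists each edge once, with its smaller endpoint in front.
    avoid : ∀ {i j} → Joined post i j → Adj G i j × ¬ (i ≡ a × j ≡ b)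
    avoid (inj₁ e∈) = ∈-edges⇒adjacent (post⊆ e∈) , λ { (refl , refl) →
      unique-++⇒∉ pre (subst Unique eq edges-unique) e∈ }
    avoid (inj₂ e∈) = adj-sym _ _ (∈-edges⇒adjacent (post⊆ e∈)) , λ { (refl , refl) →
      Fin.<-asym (proj₁ (∈-edges⁻ ab∈)) (proj₁ (∈-edges⁻ (post⊆ e∈))) }
  ... | [] , done = contradiction (∈-edges⇒adjacent (subst ((a , b) ∈_) (sym eq) (∈-++⁺ʳ pre (here refl)))) (adj-irrefl a)
  ... | _ ∷ [] , step (_ , ≢ab) _ done = contradiction (refl , refl) ≢ab
  ... | vs@(_ ∷ _ ∷ _) , p = suc (length vs) , record
    { 3≤k       = ℕ.s≤s (ℕ.s≤s (ℕ.s≤s ℕ.z≤n))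
    ; vertex    = lookup (a ∷ vs)
    ; injective = λ {i} {j} → lookup-injective (path-unique p) i j
    ; adjacent  = adjacent
    }
    where
    adjacent : ∀ i → Adj G (lookup (a ∷ vs) i) (lookup (a ∷ vs) (next i))
    adjacent i with view i
    ... | ‵fromℕ     = subst₂ (λ x y → Adj G x (lookup (a ∷ vs) y)) (sym (path-end p)) (sym (next-fromℕ (length vs)))
          (adj-sym a b (∈-edges⇒adjacent (subst ((a , b) ∈_) (sym eq) (∈-++⁺ʳ pre (here refl)))))
    ... | ‵inject₁ i = subst (λ y → Adj G (lookup (a ∷ vs) (inject₁ i)) (lookup (a ∷ vs) y)) (sym (next-inject₁ i))
          (proj₁ (path-step p i))

  acyclic⇒cyclomatic≡0 : Acyclic G → ∀ {t} → IsCyclomatic t → t ≡ 0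
  acyclic⇒cyclomatic≡0 acyc {t} cyc with SpanningForest.redundant T
    where T = trivialForest (edges G)
  ... | inj₁ eq = trans (cyclomatic-unique cyc (forest-cyclomatic (trivialForest (edges G)))) (cong length eq)
  ... | inj₂ (a , b , pre , post , eq , path) =
    let k , C = redundant-edge⇒cycle eq path in contradiction C (acyc k)

  -- The rest of the cycle replaces its closing edge, so the other edges of G already generate the
  -- connectivity and the closing edge is redundant.
  cycle⇒1≤cyclomatic : ∀ {k t} → Cycle G k → IsCyclomatic t → 1 ℕ.≤ t
  cycle⇒1≤cyclomatic {zero} C cyc with () ← Cycle.3≤k C
  cycle⇒1≤cyclomatic {suc k} {t} C cyc = ℕ.≤-trans (∈-length e₀∈) (redundant-edges≤ keep? cyc generates)
    where
    open Cycle C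
    v₀ = vertex zero
    vₗ = vertex (fromℕ k)
    e₀ = edge vₗ v₀

    closing : Adj G vₗ v₀
    closing = subst (λ i → Adj G vₗ (vertex i)) (next-fromℕ k) (adjacent (fromℕ k))

    keep? : Decidable (_≢ e₀)
    keep? = ∁? (λ e → Product.≡-dec Fin._≟_ Fin._≟_ e e₀)

    e₀∈ : e₀ ∈ filter (∁? keep?) (edges G)
    e₀∈ = ∈-filter⁺ (∁? keep?) (∈-edges⁺ closing) (λ ≢ → ≢ refl)

    kept : ∀ {i j} → Adj G i j → edge i j ≢ e₀ → Joined (filter keep? (edges G)) i j
    kept {i} {j} ij ≢e₀ = edge-∈⇒joined i j (∈-filter⁺ keep? (∈-edges⁺ ij) ≢e₀)

    other-edge : ∀ i → edge (vertex (inject₁ i)) (vertex (suc i)) ≢ e₀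
    other-edge i eq with edge-injective (vertex (inject₁ i)) (vertex (suc i)) vₗ v₀ eq
    ... | inj₁ (p , _) = Fin.fromℕ≢inject₁ (sym (injective p))
    -- The reversed closing edge could only be the initial edge of a cycle of length two.
    ... | inj₂ (p , q) = ℕ.<-irrefl (sym 1≡k) (ℕ.s≤s⁻¹ 3≤k)
      where
      toℕi≡0 : toℕ i ≡ 0
      toℕi≡0 = trans (sym (Fin.toℕ-inject₁ i)) (cong toℕ (injective p))
      1≡k : k ≡ 1
      1≡k = trans (sym (Fin.toℕ-fromℕ k)) (trans (cong toℕ (sym (injective q))) (cong suc toℕi≡0))

    path : ∀ i → Star (Joined (filter keep? (edges G))) v₀ (vertex i)
    path = <-weakInduction _ nil λ i p → p ◅◅ kept
      (subst (λ j → Adj G (vertex (inject₁ i)) (vertex j)) (next-inject₁ i) (adjacent (inject₁ i))) (other-edge i) ◅ nil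

    generates : ∀ {i j} → Adj G i j → Star (Joined (filter keep? (edges G))) i j
    generates {i} {j} ij with Product.≡-dec Fin._≟_ Fin._≟_ (edge i j) e₀
    ... | no ≢e₀ = kept ij ≢e₀ ◅ nil
    ... | yes eq with edge-injective i j vₗ v₀ eq
    ...   | inj₁ (refl , refl) = Star.reverse swap (path (fromℕ k))
    ...   | inj₂ (refl , refl) = path (fromℕ k)

  cyclomatic≡0⇒acyclic : IsCyclomatic 0 → Acyclic G
  cyclomatic≡0⇒acyclic cyc k C with () ← cycle⇒1≤cyclomatic C cyc

  -- Exhibits m + ω distinct vertices: one for each component and m more in the component of v. The
  -- resulting bound on `ω` limits the cyclomatic number of a four-cycle.
  components+≤ : ∀ {m} (v : Fin n) (u : Fin m → Fin n) → Injective _≡_ _≡_ u → (∀ i → u i ≢ v) →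
    (∀ i → Connected G v (u i)) → m ℕ.+ ω G ℕ.≤ n
  components+≤ {m} v u u-inj u≢v v~u = Fin.injective⇒≤ {f = h ∘ splitAt m} λ {i} {j} eq →
    trans (sym (Fin.join-splitAt m (ω G) i)) (trans (cong (join m (ω G)) (h-inj (splitAt m i) (splitAt m j) eq)) (Fin.join-splitAt m (ω G) j))
    where
    -- The vertex v represents its own component, so the representatives avoid every `u i`.
    choose : ∀ c → ∃ λ i → component i ≡ c × (c ≡ component v → i ≡ v)
    choose c with c Fin.≟ component v
    ... | yes refl = v , refl , λ _ → refl
    ... | no  c≢   = let i , eq = label-surjective c in i , eq , λ c≡ → contradiction c≡ c≢

    h : Fin m ⊎ Fin (ω G) → Fin n
    h = [ u , proj₁ ∘ choose ]

    distinct : ∀ i c → u i ≢ proj₁ (choose c)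
    distinct i c eq = u≢v i (trans eq (proj₂ (proj₂ (choose c))
      (trans (sym (proj₁ (proj₂ (choose c)))) (trans (cong component (sym eq))
        (sym (Equivalence.from (label-connected v (u i)) (v~u i)))))))

    h-inj : ∀ x y → h x ≡ h y → x ≡ y
    h-inj (inj₁ i) (inj₁ j) eq = cong inj₁ (u-inj eq)
    h-inj (inj₁ i) (inj₂ d) eq = contradiction eq (distinct i d)
    h-inj (inj₂ c) (inj₁ j) eq = contradiction (sym eq) (distinct j c)
    h-inj (inj₂ c) (inj₂ d) eq = cong inj₂
      (trans (sym (proj₁ (proj₂ (choose c)))) (trans (cong component eq) (proj₁ (proj₂ (choose d)))))

-- Gain matrices

module Units (R : CommutativeRing 0ℓ 0ℓ) where
  open CommutativeRing R hiding (zero) renaming (refl to ≈-refl; sym to ≈-sym; trans to ≈-trans)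
  open SemiringSolver commutativeSemiring using (solve; _:=_; _:+_; _:*_; con)

  -- The inverse is part of the data: in a weak field inverses exist only under a double negation,
  -- whereas potentials have to be computed.
  record Unit : Set where
    constructor unit
    field
      value inverse : Carrier
      value*inverse : value * inverse ≈ 1#

  open Unit public

  inverse-unique : ∀ {a b c} → a * b ≈ 1# → a * c ≈ 1# → b ≈ c
  inverse-unique {a} {b} {c} ab≈1 ac≈1 = begin
    b             ≈⟨ *-identityʳ b ⟨
    b * 1#        ≈⟨ *-congˡ ac≈1 ⟨
    b * (a * c)   ≈⟨ solve 3 (λ a b c → b :* (a :* c) := (a :* b) :* c) ≈-refl a b c ⟩
    (a * b) * c   ≈⟨ *-congʳ ab≈1 ⟩
    1# * c        ≈⟨ *-identityˡ c ⟩
    c             ∎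
    where open SetoidReasoning setoid

  units : AbelianGroup 0ℓ 0ℓ
  units = record
    { Carrier = Unit
    ; _≈_     = λ a b → value a ≈ value b
    ; _∙_     = λ a b → unit (value a * value b) (inverse a * inverse b)
                  (≈-trans (solve 4 (λ x y z w → (x :* y) :* (z :* w) := (x :* z) :* (y :* w)) ≈-refl
                              (value a) (value b) (inverse a) (inverse b))
                    (≈-trans (*-cong (value*inverse a) (value*inverse b)) (*-identityˡ 1#)))
    ; ε       = unit 1# 1# (*-identityˡ 1#)
    ; _⁻¹     = λ a → unit (inverse a) (value a) (≈-trans (*-comm _ _) (value*inverse a))
    ; isAbelianGroup = record
      { isGroup = record
        { isMonoid = record
          { isSemigroup = record
            { isMagma = record
              { isEquivalence = record { refl = ≈-refl ; sym = ≈-sym ; trans = ≈-trans }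
              ; ∙-cong        = *-cong
              }
            ; assoc = λ a b c → *-assoc (value a) (value b) (value c)
            }
          ; identity = (λ a → *-identityˡ (value a)) , (λ a → *-identityʳ (value a))
          }
        ; inverse = (λ a → ≈-trans (*-comm _ _) (value*inverse a)) , value*inverse
        ; ⁻¹-cong = λ {a} {b} a≈b → inverse-unique (value*inverse a) (≈-trans (*-congʳ a≈b) (value*inverse b))
        }
      ; comm = λ a b → *-comm (value a) (value b)
      }
    }

module GainMatrices (R : CommutativeRing 0ℓ 0ℓ) (F : IsWeakField R) {n : ℕ} (G : SimpleGraph n) where
  open CommutativeRing R hiding (zero) renaming (refl to ≈-refl; sym to ≈-sym; trans to ≈-trans)
  open IsWeakField F
  open GroupProperties +-group using () renaming (∙-cancelʳ to +-cancelʳ)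
  open SemiringSolver commutativeSemiring using (solve; _:=_; _:+_; _:*_; con)
  open SemiringSum semiring using (sum)
  open SetoidReasoning setoid
  open LinearAlgebra R F
  open Units R
  open SimpleGraph G using (adj; adj-sym; adj-irrefl)

  adjacent? : ∀ i j → Dec (Adj G i j)
  adjacent? i j = T? (adj i j)

  -- Reversing an edge conjugates a gain of modulus one, that is, inverts it. Reciprocity expresses
  -- this over any commutative ring, without a conjugation.
  record IsGainMatrix (A : Mat n n) : Set where
    field
      nonadjacent : ∀ {i j} → ¬ Adj G i j → A i j ≈ 0#
      reciprocal  : ∀ {i j} → Adj G i j → A i j * A j i ≈ 1#

    diagonal : ∀ i → A i i ≈ 0#
    diagonal i = nonadjacent (adj-irrefl i)

    cancel : ∀ {i j c} → Adj G i j → A i j * c ≈ 0# → c ≈ 0#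
    cancel {i} {j} {c} ij Ac≈0 = begin
      c                    ≈⟨ *-identityˡ c ⟨
      1# * c               ≈⟨ *-congʳ (reciprocal ij) ⟨
      A i j * A j i * c    ≈⟨ solve 3 (λ a b c → a :* b :* c := b :* (a :* c)) ≈-refl (A i j) (A j i) c ⟩
      A j i * (A i j * c)  ≈⟨ *-congˡ Ac≈0 ⟩
      A j i * 0#           ≈⟨ zeroʳ (A j i) ⟩
      0#                   ∎

  open IsGainMatrix

  record IsAdjacencyMatrix (A : Mat n n) : Set where
    field
      adjacent-1    : ∀ {i j} → Adj G i j → A i j ≈ 1#
      nonadjacent-0 : ∀ {i j} → ¬ Adj G i j → A i j ≈ 0#

    isGainMatrix : IsGainMatrix A
    isGainMatrix = record
      { nonadjacent = nonadjacent-0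
      ; reciprocal  = λ {i} {j} ij → ≈-trans (*-cong (adjacent-1 ij) (adjacent-1 (adj-sym i j ij))) (*-identityˡ 1#)
      }

  *-cancelʳ-≉ : ∀ {x y c} → ¬ x ≈ y → x * c ≈ y * c → c ≈ 0#
  *-cancelʳ-≉ {x} {y} {c} x≉y xc≈yc = ≈-stable c 0# λ c≉0 → invertible c c≉0 λ (p , cp≈1) → x≉y (begin
    x            ≈⟨ *-identityʳ x ⟨
    x * 1#       ≈⟨ *-congˡ cp≈1 ⟨
    x * (c * p)  ≈⟨ *-assoc x c p ⟨
    x * c * p    ≈⟨ *-congʳ xc≈yc ⟩
    y * c * p    ≈⟨ *-assoc y c p ⟩
    y * (c * p)  ≈⟨ *-congˡ cp≈1 ⟩
    y * 1#       ≈⟨ *-identityʳ y ⟩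
    y            ∎)

  zero-left : ∀ {x y} → x ≈ 0# → x * y ≈ 0#
  zero-left {x} {y} x≈0 = ≈-trans (*-congʳ x≈0) (zeroˡ y)

  zero-right : ∀ {x y} → y ≈ 0# → x * y ≈ 0#
  zero-right {x} {y} y≈0 = ≈-trans (*-congˡ y≈0) (zeroʳ x)

  -- After switching A by the potential of a spanning forest, A agrees with B
  -- outside the rows and columns of one endpoint of each extra edge.
  switch : ∀ {A B t k} → IsGainMatrix A → IsGainMatrix B → IsCyclomatic G t →
    Factor A k → Factor B (k ℕ.+ t ℕ.* 2)
  switch {A} {B} {t} {k} gA gB cyc fA =
    subst (λ s → Factor B (k ℕ.+ s ℕ.* 2)) (cyclomatic-unique G (forest-cyclomatic G T) cyc)
      (factor-cong recombine (factor-+ (factor-scale f g fA) (factor-cover extra D D≈0)))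
    where
    -- The quotient A_ij / B_ij, with default 1 off the edges. A potential f with f_i A_ij / B_ij =
    -- f_j switches A_ij into B_ij.
    gain : Fin n → Fin n → Unit
    gain i j with adjacent? i j
    ... | no  _  = unit 1# 1# (*-identityˡ 1#)
    ... | yes ij = unit (A i j * B j i) (A j i * B i j)
      (≈-trans (solve 4 (λ x y z w → (x :* y) :* (z :* w) := (x :* z) :* (y :* w)) ≈-refl (A i j) (B j i) (A j i) (B i j))
        (≈-trans (*-cong (reciprocal gA ij) (reciprocal gB (adj-sym i j ij))) (*-identityˡ 1#)))

    gain-value : ∀ {i j} → Adj G i j → value (gain i j) ≈ A i j * B j i
    gain-value {i} {j} ij with adjacent? i j
    ... | yes _  = ≈-refl
    ... | no ¬ij = contradiction ij ¬ij

    T : SpanningForest units gain (edges G)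
    T = spanningForest units gain (edges G)
    open SpanningForest T using (extra; potential; balanced)

    f g : Fin n → Carrier
    f i = value (potential i)
    g i = inverse (potential i)

    D : Mat n n
    D i j = B i j + - (f i * A i j * g j)

    recombine : ∀ i j → f i * A i j * g j + D i j ≈ B i j
    recombine i j = begin
      x + (B i j + - x)  ≈⟨ solve 3 (λ x b y → x :+ (b :+ y) := (x :+ y) :+ b) ≈-refl x (B i j) (- x) ⟩
      (x + - x) + B i j  ≈⟨ +-congʳ (-‿inverseʳ x) ⟩
      0# + B i j         ≈⟨ +-identityˡ (B i j) ⟩
      B i j              ∎
      where x = f i * A i j * g j

    D-zero : ∀ {i j} → f i * A i j * g j ≈ B i j → D i j ≈ 0#
    D-zero {i} {j} eq = ≈-trans (+-congˡ (-‿cong eq)) (-‿inverseʳ (B i j))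

    Balanced : Fin n → Fin n → Set
    Balanced i j = f i * value (gain i j) ≈ f j

    forwards : ∀ {i j} → Adj G i j → Balanced i j → f i * A i j * g j ≈ B i j
    forwards {i} {j} ij bal = begin
      f i * A i j * g j                      ≈⟨ *-identityʳ _ ⟨
      f i * A i j * g j * 1#                 ≈⟨ *-congˡ (reciprocal gB ij) ⟨
      f i * A i j * g j * (B i j * B j i)    ≈⟨ solve 5 (λ f a g b b′ → f :* a :* g :* (b :* b′) := f :* (a :* b′) :* g :* b) ≈-refl
                                                  (f i) (A i j) (g j) (B i j) (B j i) ⟩
      f i * (A i j * B j i) * g j * B i j    ≈⟨ *-congʳ (*-congʳ (*-congˡ (gain-value ij))) ⟨
      f i * value (gain i j) * g j * B i j   ≈⟨ *-congʳ (*-congʳ bal) ⟩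
      f j * g j * B i j                      ≈⟨ *-congʳ (value*inverse (potential j)) ⟩
      1# * B i j                             ≈⟨ *-identityˡ (B i j) ⟩
      B i j                                  ∎

    backwards : ∀ {i j} → Adj G i j → Balanced i j → f j * A j i * g i ≈ B j i
    backwards {i} {j} ij bal = begin
      f j * A j i * g i                          ≈⟨ *-congʳ (*-congʳ bal) ⟨
      f i * value (gain i j) * A j i * g i       ≈⟨ *-congʳ (*-congʳ (*-congˡ (gain-value ij))) ⟩
      f i * (A i j * B j i) * A j i * g i        ≈⟨ solve 5 (λ f a g b a′ → f :* (a :* b) :* a′ :* g := (f :* g) :* ((a :* a′) :* b)) ≈-refl
                                                      (f i) (A i j) (g i) (B j i) (A j i) ⟩
      f i * g i * (A i j * A j i * B j i)        ≈⟨ *-cong (value*inverse (potential i)) (*-congʳ (reciprocal gA ij)) ⟩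
      1# * (1# * B j i)                          ≈⟨ solve 1 (λ b → con 1 :* (con 1 :* b) := b) ≈-refl (B j i) ⟩
      B j i                                      ∎

    D≈0 : ∀ i j → ¬ i ∈ extra → ¬ j ∈ extra → D i j ≈ 0#
    D≈0 i j i∉ j∉ with adjacent? i j
    ... | no ¬ij = D-zero (≈-trans (zero-left (zero-right (nonadjacent gA ¬ij))) (≈-sym (nonadjacent gB ¬ij)))
    -- `edges` lists only one orientation, so the balance may be known for ij or only for ji. In
    -- either case the endpoint possibly in `extra` is i or j, and both are excluded.
    ... | yes ij with edge-∈⇒joined i j (∈-edges⁺ G ij)
    ...   | inj₁ e∈ = [ (λ i∈ → contradiction i∈ i∉) , (λ bal → D-zero (forwards ij bal)) ] (All.lookup balanced e∈)
    ...   | inj₂ e∈ = [ (λ j∈ → contradiction j∈ j∉) , (λ bal → D-zero (backwards (adj-sym i j ij) bal)) ] (All.lookup balanced e∈)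

  -- The submatrix on u and v has zero diagonal and invertible entries off it.
  edge⇒2≤ : ∀ {A k u v} → IsGainMatrix A → Adj G u v → Factor A k → 2 ℕ.≤ k
  edge⇒2≤ {A} {k} {u} {v} gA uv fA = nonsingular-submatrix⇒≤ fA (lookup (u ∷ v ∷ [])) (lookup (u ∷ v ∷ [])) kernel
    where
    kernel : TrivialKernel (λ i j → A (lookup (u ∷ v ∷ []) i) (lookup (u ∷ v ∷ []) j))
    kernel c rows zero = cancel gA (adj-sym u v uv) (begin
      A v u * c zero
        ≈⟨ ≈-trans (+-congˡ (≈-trans (+-identityʳ _) (zero-left (diagonal gA v)))) (+-identityʳ _) ⟨
      A v u * c zero + (A v v * c (suc zero) + 0#)
        ≈⟨ rows (suc zero) ⟩
      0# ∎)
    kernel c rows (suc zero) = cancel gA uv (begin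
      A u v * c (suc zero)
        ≈⟨ ≈-trans (+-cong (zero-left (diagonal gA u)) (+-identityʳ _)) (+-identityˡ _) ⟨
      A u u * c zero + (A u v * c (suc zero) + 0#)
        ≈⟨ rows zero ⟩
      0# ∎)

  -- The vanishing of the Schur complement of the block on u and v. By reciprocity that block is its
  -- own inverse, which is why the middle factors are A_vu and A_uv.
  RankTwoFormula : Mat n n → Fin n → Fin n → Set
  RankTwoFormula A u v = ∀ i j → A i j ≈ A i v * A v u * A u j + A i u * A u v * A v j

  -- The minor on the rows i, u, v and the columns j, u, v vanishes.
  factor-2⇒formula : ∀ {A u v} → IsGainMatrix A → ¬ ¬ Factor A 2 → Adj G u v → RankTwoFormula A u v
  factor-2⇒formula {A} {u} {v} gA ¬¬fA uv i j = ≈-stable _ _ λ A≉s → ¬¬fA λ fA →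
    contradiction (nonsingular-submatrix⇒≤ fA (lookup (i ∷ u ∷ v ∷ [])) (lookup (j ∷ u ∷ v ∷ [])) (kernel A≉s))
      λ { (ℕ.s≤s (ℕ.s≤s ())) }
    where
    vu = adj-sym u v uv
    s = A i v * A v u * A u j + A i u * A u v * A v j

    kernel : ¬ A i j ≈ s → TrivialKernel (λ p q → A (lookup (i ∷ u ∷ v ∷ []) p) (lookup (j ∷ u ∷ v ∷ []) q))
    kernel A≉s c rows = λ
      { zero             → c₀≈0
      ; (suc zero)       → cancel gA vu (≈-trans (≈-sym (≈-trans (+-congʳ (zero-right c₀≈0)) (+-identityˡ _))) row-v)
      ; (suc (suc zero)) → cancel gA uv (≈-trans (≈-sym (≈-trans (+-congʳ (zero-right c₀≈0)) (+-identityˡ _))) row-u)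
      }
      where
      c₀ = c zero
      c₁ = c (suc zero)
      c₂ = c (suc (suc zero))

      row-u : A u j * c₀ + A u v * c₂ ≈ 0#
      row-u = begin
        A u j * c₀ + A u v * c₂                         ≈⟨ +-congˡ (≈-trans (+-cong (zero-left (diagonal gA u)) (+-identityʳ _)) (+-identityˡ _)) ⟨
        A u j * c₀ + (A u u * c₁ + (A u v * c₂ + 0#))   ≈⟨ rows (suc zero) ⟩
        0#                                              ∎

      row-v : A v j * c₀ + A v u * c₁ ≈ 0#
      row-v = begin
        A v j * c₀ + A v u * c₁                         ≈⟨ +-congˡ (≈-trans (+-congˡ (≈-trans (+-identityʳ _) (zero-left (diagonal gA v)))) (+-identityʳ _)) ⟨
        A v j * c₀ + (A v u * c₁ + (A v v * c₂ + 0#))   ≈⟨ rows (suc (suc zero)) ⟩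
        0#                                              ∎

      -- A combination of the rows u and v agrees with row i except for s in place of A_ij.
      -- Comparison with row i leaves A_ij c₀ = s c₀.
      s-row : s * c₀ + (A i u * c₁ + A i v * c₂) ≈ 0#
      s-row = begin
        s * c₀ + (A i u * c₁ + A i v * c₂)
          ≈⟨ +-congˡ (+-cong (*-congʳ (≈-trans (*-congˡ (reciprocal gA uv)) (*-identityʳ (A i u))))
                             (*-congʳ (≈-trans (*-congˡ (reciprocal gA vu)) (*-identityʳ (A i v))))) ⟨
        s * c₀ + (A i u * (A u v * A v u) * c₁ + A i v * (A v u * A u v) * c₂)
          ≈⟨ solve 9 (λ iv vu uj iu uv vj c₀ c₁ c₂ →
               (iv :* vu :* uj :+ iu :* uv :* vj) :* c₀ :+ (iu :* (uv :* vu) :* c₁ :+ iv :* (vu :* uv) :* c₂)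
               := iv :* vu :* (uj :* c₀ :+ uv :* c₂) :+ iu :* uv :* (vj :* c₀ :+ vu :* c₁)) ≈-refl
               (A i v) (A v u) (A u j) (A i u) (A u v) (A v j) c₀ c₁ c₂ ⟩
        A i v * A v u * (A u j * c₀ + A u v * c₂) + A i u * A u v * (A v j * c₀ + A v u * c₁)
          ≈⟨ +-cong (zero-right row-u) (zero-right row-v) ⟩
        0# + 0#
          ≈⟨ +-identityˡ 0# ⟩
        0# ∎

      row-i : A i j * c₀ + (A i u * c₁ + A i v * c₂) ≈ 0#
      row-i = ≈-trans (+-congˡ (+-congˡ (≈-sym (+-identityʳ _)))) (rows zero)

      c₀≈0 : c₀ ≈ 0#
      c₀≈0 = *-cancelʳ-≉ A≉s (+-cancelʳ (A i u * c₁ + A i v * c₂) (A i j * c₀) (s * c₀) (≈-trans row-i (≈-sym s-row)))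

  formula⇒factor-2 : ∀ {A u v} → RankTwoFormula A u v → Factor A 2
  formula⇒factor-2 {A} {u} {v} formula = factor-cong (λ i j → ≈-sym (formula i j))
    (factor-+ (factor-outer (λ i → A i v * A v u) (A u)) (factor-outer (λ i → A i u * A u v) (A v)))

  -- Four-cycles with isolated vertices

  record IsFourCycle (u v x y : Fin n) : Set where
    field
      uv   : Adj G u v
      vx   : Adj G v x
      xy   : Adj G x y
      yu   : Adj G y u
      u≢x  : u ≢ x
      v≢y  : v ≢ y
      -- Phrased by the sides {u, x} and {v, y} of the bipartition rather than by the four edges,
      -- since the block structure of the matrix depends on the sides alone.
      only : ∀ {i j} → Adj G i j → ((i ≡ u ⊎ i ≡ x) × (j ≡ v ⊎ j ≡ y)) ⊎ ((i ≡ v ⊎ i ≡ y) × (j ≡ u ⊎ j ≡ x))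

    cycle-vertices : List (Fin n)
    cycle-vertices = u ∷ v ∷ x ∷ y ∷ []

    cycle-vertices-unique : Unique cycle-vertices
    cycle-vertices-unique =
        (adjacent⇒≢ G uv ∷ u≢x ∷ (adjacent⇒≢ G yu ∘ sym) ∷ [])
      ∷ (adjacent⇒≢ G vx ∷ v≢y ∷ []) ∷ (adjacent⇒≢ G xy ∷ []) ∷ [] ∷ []

    complete : ∀ {i j} → i ≡ u ⊎ i ≡ x → j ≡ v ⊎ j ≡ y → Adj G i j
    complete (inj₁ refl) (inj₁ refl) = uv
    complete (inj₁ refl) (inj₂ refl) = adj-sym y u yu
    complete (inj₂ refl) (inj₁ refl) = adj-sym v x vx
    complete (inj₂ refl) (inj₂ refl) = xy

    disjoint : ∀ {i} → i ≡ u ⊎ i ≡ x → ¬ (i ≡ v ⊎ i ≡ y)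
    disjoint {i} i∈ i∈′ = adj-irrefl i (complete i∈ i∈′)

    no-edge-ux : ∀ {i j} → i ≡ u ⊎ i ≡ x → j ≡ u ⊎ j ≡ x → ¬ Adj G i j
    no-edge-ux i∈ j∈ ij = [ (λ (_ , j∈′) → disjoint j∈ j∈′) , (λ (i∈′ , _) → disjoint i∈ i∈′) ] (only ij)

    no-edge-vy : ∀ {i j} → i ≡ v ⊎ i ≡ y → j ≡ v ⊎ j ≡ y → ¬ Adj G i j
    no-edge-vy i∈ j∈ ij = [ (λ (i∈′ , _) → disjoint i∈′ i∈) , (λ (_ , j∈′) → disjoint j∈′ j∈) ] (only ij)

  module _ {u v x y} (C : IsFourCycle u v x y) where
    open IsFourCycle C

    gainOf : Mat n n → Carrier
    gainOf A = A u v * (A v x * (A x y * A y u))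

    adjacency-gain≈1 : ∀ {B} → IsAdjacencyMatrix B → gainOf B ≈ 1#
    adjacency-gain≈1 {B} adjB = begin
      B u v * (B v x * (B x y * B y u))  ≈⟨ *-cong (adjacent-1 uv) (*-cong (adjacent-1 vx) (*-cong (adjacent-1 xy) (adjacent-1 yu))) ⟩
      1# * (1# * (1# * 1#))              ≈⟨ solve 0 (con 1 :* (con 1 :* (con 1 :* con 1)) := con 1) ≈-refl ⟩
      1#                                 ∎
      where open IsAdjacencyMatrix adjB

    -- Off the edges both products vanish. On them reciprocity proves the formula whenever u or v is
    -- an endpoint; the entries (x, y) and (y, x) are where the gain enters.
    fourCycle-formula : ∀ {A} → IsGainMatrix A → gainOf A ≈ 1# → RankTwoFormula A u v
    fourCycle-formula {A} gA gain≈1 i j with adjacent? i j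
    ... | no ¬ij = ≈-trans (nonadjacent gA ¬ij) (≈-sym (≈-trans (+-cong first second) (+-identityˡ 0#)))
      where
      first : A i v * A v u * A u j ≈ 0#
      first with adjacent? i v | adjacent? u j
      ... | no ¬iv | _      = zero-left (zero-left (nonadjacent gA ¬iv))
      ... | _      | no ¬uj = zero-right (nonadjacent gA ¬uj)
      ... | yes iv | yes uj with only iv | only uj
      ...   | inj₁ (i∈ , _) | inj₁ (_ , j∈) = contradiction (complete i∈ j∈) ¬ij
      ...   | inj₂ (_ , v∈) | _             = contradiction (inj₁ refl) (disjoint v∈)
      ...   | _             | inj₂ (u∈ , _) = contradiction u∈ (disjoint (inj₁ refl))
      second : A i u * A u v * A v j ≈ 0#
      second with adjacent? i u | adjacent? v j
      ... | no ¬iu | _      = zero-left (zero-left (nonadjacent gA ¬iu))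
      ... | _      | no ¬vj = zero-right (nonadjacent gA ¬vj)
      ... | yes iu | yes vj with only iu | only vj
      ...   | inj₂ (i∈ , _) | inj₂ (_ , j∈) = contradiction (adj-sym j i (complete j∈ i∈)) ¬ij
      ...   | inj₁ (_ , u∈) | _             = contradiction u∈ (disjoint (inj₁ refl))
      ...   | _             | inj₁ (v∈ , _) = contradiction (inj₁ refl) (disjoint v∈)
    ... | yes ij with only ij
    ...   | inj₁ (i∈ , j∈) = ≈-sym (≈-trans
              (+-cong (first i∈ j∈) (zero-left (zero-left (nonadjacent gA (no-edge-ux i∈ (inj₁ refl)))))) (+-identityʳ _))
      where
      first : ∀ {i j} → i ≡ u ⊎ i ≡ x → j ≡ v ⊎ j ≡ y → A i v * A v u * A u j ≈ A i j
      first {_} {j} (inj₁ refl) _ = ≈-trans (*-congʳ (reciprocal gA uv)) (*-identityˡ (A u j))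
      first {i} (inj₂ refl) (inj₁ refl) =
        ≈-trans (*-assoc _ _ _) (≈-trans (*-congˡ (reciprocal gA (adj-sym u v uv))) (*-identityʳ (A i v)))
      first (inj₂ refl) (inj₂ refl) = begin
        A x v * A v u * A u y
          ≈⟨ *-identityʳ _ ⟨
        A x v * A v u * A u y * 1#
          ≈⟨ *-congˡ gain≈1 ⟨
        A x v * A v u * A u y * (A u v * (A v x * (A x y * A y u)))
          ≈⟨ solve 7 (λ xv vu uy uv vx xy yu → xv :* vu :* uy :* (uv :* (vx :* (xy :* yu)))
               := (vx :* xv) :* (uv :* vu) :* (yu :* uy) :* xy) ≈-refl
               (A x v) (A v u) (A u y) (A u v) (A v x) (A x y) (A y u) ⟩
        A v x * A x v * (A u v * A v u) * (A y u * A u y) * A x y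
          ≈⟨ *-congʳ (*-cong (*-cong (reciprocal gA vx) (reciprocal gA uv)) (reciprocal gA yu)) ⟩
        1# * 1# * 1# * A x y
          ≈⟨ solve 1 (λ a → con 1 :* con 1 :* con 1 :* a := a) ≈-refl (A x y) ⟩
        A x y ∎
    ...   | inj₂ (i∈ , j∈) = ≈-sym (≈-trans
              (+-cong (zero-left (zero-left (nonadjacent gA (no-edge-vy i∈ (inj₁ refl))))) (second i∈ j∈)) (+-identityˡ _))
      where
      second : ∀ {i j} → i ≡ v ⊎ i ≡ y → j ≡ u ⊎ j ≡ x → A i u * A u v * A v j ≈ A i j
      second {_} {j} (inj₁ refl) _ = ≈-trans (*-congʳ (reciprocal gA (adj-sym u v uv))) (*-identityˡ (A v j))
      second {i} (inj₂ refl) (inj₁ refl) =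
        ≈-trans (*-assoc _ _ _) (≈-trans (*-congˡ (reciprocal gA uv)) (*-identityʳ (A i u)))
      second (inj₂ refl) (inj₂ refl) = begin
        A y u * A u v * A v x
          ≈⟨ *-identityʳ _ ⟨
        A y u * A u v * A v x * 1#
          ≈⟨ *-congˡ (reciprocal gA xy) ⟨
        A y u * A u v * A v x * (A x y * A y x)
          ≈⟨ solve 5 (λ yu uv vx xy yx → yu :* uv :* vx :* (xy :* yx) := (uv :* (vx :* (xy :* yu))) :* yx) ≈-refl
               (A y u) (A u v) (A v x) (A x y) (A y x) ⟩
        gainOf A * A y x
          ≈⟨ *-congʳ gain≈1 ⟩
        1# * A y x
          ≈⟨ *-identityˡ (A y x) ⟩
        A y x ∎

    -- The bipartition splits the matrix on u, v, x, y into two 2 × 2 blocks, each singular only if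
    -- the gain is 1.
    fourCycle-nonsingular : ∀ {A k} → IsGainMatrix A → ¬ gainOf A ≈ 1# → Factor A k → 4 ℕ.≤ k
    fourCycle-nonsingular {A} gA gain≉1 fA =
      nonsingular-submatrix⇒≤ fA (lookup cycle-vertices) (lookup cycle-vertices) kernel
      where
      -- Here q′ and s′ are the inverses of q and s. Scaling by them gives d the coefficient 1 in
      -- both equations, and their comparison isolates c.
      solve₂ : ∀ {p q q′ r s s′ c d} → q′ * q ≈ 1# → s′ * s ≈ 1# → ¬ q′ * p ≈ s′ * r →
        p * c + q * d ≈ 0# → r * c + s * d ≈ 0# → c ≈ 0# × d ≈ 0#
      solve₂ {p} {q} {q′} {r} {s} {s′} {c} {d} q′q≈1 s′s≈1 p≉r eq₁ eq₂ = c≈0 , d≈0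
        where
        scale : ∀ p q q′ → q′ * q ≈ 1# → p * c + q * d ≈ 0# → q′ * p * c + d ≈ 0#
        scale p q q′ q′q≈1 eq = begin
          q′ * p * c + d             ≈⟨ +-congˡ (≈-trans (*-congʳ q′q≈1) (*-identityˡ d)) ⟨
          q′ * p * c + q′ * q * d    ≈⟨ solve 5 (λ p q q′ c d → q′ :* p :* c :+ q′ :* q :* d := q′ :* (p :* c :+ q :* d)) ≈-refl p q q′ c d ⟩
          q′ * (p * c + q * d)       ≈⟨ zero-right eq ⟩
          0#                         ∎
        c≈0 : c ≈ 0#
        c≈0 = *-cancelʳ-≉ p≉r (+-cancelʳ d (q′ * p * c) (s′ * r * c)
          (≈-trans (scale p q q′ q′q≈1 eq₁) (≈-sym (scale r s s′ s′s≈1 eq₂))))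
        d≈0 : d ≈ 0#
        d≈0 = ≈-trans (≈-sym (≈-trans (+-congʳ (zero-right c≈0)) (+-identityˡ d))) (scale p q q′ q′q≈1 eq₁)

      kernel : TrivialKernel (λ i j → A (lookup cycle-vertices i) (lookup cycle-vertices j))
      kernel c rows = λ
        { zero → proj₁ even ; (suc zero) → proj₁ odd ; (suc (suc zero)) → proj₂ even ; (suc (suc (suc zero))) → proj₂ odd }
        where
        c₀ = c zero
        c₁ = c (suc zero)
        c₂ = c (suc (suc zero))
        c₃ = c (suc (suc (suc zero)))

        ux-row : ∀ {i} → i ≡ u ⊎ i ≡ x → A i u * c₀ + (A i v * c₁ + (A i x * c₂ + (A i y * c₃ + 0#))) ≈ 0# →
                 A i v * c₁ + A i y * c₃ ≈ 0#
        ux-row {i} i∈ row = begin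
          A i v * c₁ + A i y * c₃
            ≈⟨ solve 2 (λ p q → con 0 :+ (p :+ (con 0 :+ (q :+ con 0))) := p :+ q) ≈-refl (A i v * c₁) (A i y * c₃) ⟨
          0# + (A i v * c₁ + (0# + (A i y * c₃ + 0#)))
            ≈⟨ +-cong (zero-left (nonadjacent gA (no-edge-ux i∈ (inj₁ refl))))
                 (+-congˡ (+-congʳ (zero-left (nonadjacent gA (no-edge-ux i∈ (inj₂ refl)))))) ⟨
          A i u * c₀ + (A i v * c₁ + (A i x * c₂ + (A i y * c₃ + 0#)))
            ≈⟨ row ⟩
          0# ∎

        vy-row : ∀ {i} → i ≡ v ⊎ i ≡ y → A i u * c₀ + (A i v * c₁ + (A i x * c₂ + (A i y * c₃ + 0#))) ≈ 0# →
                 A i u * c₀ + A i x * c₂ ≈ 0#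
        vy-row {i} i∈ row = begin
          A i u * c₀ + A i x * c₂
            ≈⟨ solve 2 (λ p q → p :+ (con 0 :+ (q :+ (con 0 :+ con 0))) := p :+ q) ≈-refl (A i u * c₀) (A i x * c₂) ⟨
          A i u * c₀ + (0# + (A i x * c₂ + (0# + 0#)))
            ≈⟨ +-congˡ (+-cong (zero-left (nonadjacent gA (no-edge-vy i∈ (inj₁ refl))))
                 (+-congˡ (+-congʳ (zero-left (nonadjacent gA (no-edge-vy i∈ (inj₂ refl))))))) ⟨
          A i u * c₀ + (A i v * c₁ + (A i x * c₂ + (A i y * c₃ + 0#)))
            ≈⟨ row ⟩
          0# ∎

        odd : c₁ ≈ 0# × c₃ ≈ 0#
        odd = solve₂ {q′ = A y u} {s′ = A y x} (reciprocal gA yu) (reciprocal gA (adj-sym x y xy)) (λ eq → gain≉1 (begin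
            A u v * (A v x * (A x y * A y u))
              ≈⟨ solve 4 (λ uv vx xy yu → uv :* (vx :* (xy :* yu)) := (yu :* uv) :* (vx :* xy)) ≈-refl (A u v) (A v x) (A x y) (A y u) ⟩
            A y u * A u v * (A v x * A x y)
              ≈⟨ *-congʳ eq ⟩
            A y x * A x v * (A v x * A x y)
              ≈⟨ solve 4 (λ yx xv vx xy → (yx :* xv) :* (vx :* xy) := (xy :* yx) :* (vx :* xv)) ≈-refl (A y x) (A x v) (A v x) (A x y) ⟩
            A x y * A y x * (A v x * A x v)
              ≈⟨ ≈-trans (*-cong (reciprocal gA xy) (reciprocal gA vx)) (*-identityˡ 1#) ⟩
            1# ∎))
          (ux-row (inj₁ refl) (rows zero)) (ux-row (inj₂ refl) (rows (suc (suc zero))))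

        even : c₀ ≈ 0# × c₂ ≈ 0#
        even = solve₂ {q′ = A x v} {s′ = A x y} (reciprocal gA (adj-sym v x vx)) (reciprocal gA xy) (λ eq → gain≉1 (begin
            A u v * (A v x * (A x y * A y u))
              ≈⟨ *-assoc _ _ _ ⟨
            A u v * A v x * (A x y * A y u)
              ≈⟨ *-congˡ eq ⟨
            A u v * A v x * (A x v * A v u)
              ≈⟨ solve 4 (λ uv vx xv vu → (uv :* vx) :* (xv :* vu) := (uv :* vu) :* (vx :* xv)) ≈-refl (A u v) (A v x) (A x v) (A v u) ⟩
            A u v * A v u * (A v x * A x v)
              ≈⟨ ≈-trans (*-cong (reciprocal gA uv) (reciprocal gA vx)) (*-identityˡ 1#) ⟩
            1# ∎))
          (vy-row (inj₁ refl) (rows (suc zero))) (vy-row (inj₂ refl) (rows (suc (suc (suc zero)))))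

    -- There are at most four edges, and 3 + ω ≤ n because v, x and y lie in the component of u.
    fourCycle-cyclomatic≤1 : ∀ {t} → IsCyclomatic G t → t ℕ.≤ 1
    fourCycle-cyclomatic≤1 {t} cyc = ℕ.+-cancelˡ-≤ n t 1 (≤R.begin
      n ℕ.+ t                   ≤R.≡⟨ cyc ⟨
      ω G ℕ.+ length (edges G)  ≤R.≤⟨ ℕ.+-monoʳ-≤ (ω G) (unique-⊆⇒length≤ (edges-unique G) edges⊆) ⟩
      ω G ℕ.+ 4                 ≤R.≡⟨ ℕ.+-comm (ω G) 4 ⟩
      1 ℕ.+ (3 ℕ.+ ω G)         ≤R.≤⟨ ℕ.s≤s components≤ ⟩
      1 ℕ.+ n                   ≤R.≡⟨ ℕ.+-comm 1 n ⟩
      n ℕ.+ 1                   ≤R.∎)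
      where
      module ≤R = ℕ.≤-Reasoning
      cycle-edges : List (Fin n × Fin n)
      cycle-edges = edge u v ∷ edge u y ∷ edge x v ∷ edge x y ∷ []

      cross∈ : ∀ {i j} → i ≡ u ⊎ i ≡ x → j ≡ v ⊎ j ≡ y → edge i j ∈ cycle-edges
      cross∈ (inj₁ refl) (inj₁ refl) = here refl
      cross∈ (inj₁ refl) (inj₂ refl) = there (here refl)
      cross∈ (inj₂ refl) (inj₁ refl) = there (there (here refl))
      cross∈ (inj₂ refl) (inj₂ refl) = there (there (there (here refl)))

      edge-< : ∀ {i j : Fin n} → i Fin.< j → (i , j) ≡ edge i j
      edge-< {i} {j} i<j with i Fin.<? j
      ... | yes _  = refl
      ... | no i≮j = contradiction i<j i≮j

      edges⊆ : ∀ {e} → e ∈ edges G → e ∈ cycle-edges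
      edges⊆ {i , j} e∈ with ∈-edges⁻ G e∈
      ... | i<j , ij = subst (_∈ cycle-edges) (sym (edge-< i<j))
        ([ (λ (i∈ , j∈) → cross∈ i∈ j∈)
         , (λ (i∈ , j∈) → subst (_∈ cycle-edges) (edge-comm (adjacent⇒≢ G ij ∘ sym)) (cross∈ j∈ i∈)) ]′ (only ij))

      components≤ : 3 ℕ.+ ω G ℕ.≤ n
      components≤ with cycle-vertices-unique
      ... | u∉ ∷ rest-unique = components+≤ G u (lookup (v ∷ x ∷ y ∷ []))
        (λ {i} {j} → lookup-injective rest-unique i j) (λ i eq → All.lookup u∉ (∈-lookup i) (sym eq)) λ
        { zero             → uv ◅ nil
        ; (suc zero)       → uv ◅ vx ◅ nil
        ; (suc (suc zero)) → adj-sym y u yu ◅ nil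
        }

  -- If the graph has rank two, its edges form a complete bipartite graph whose
  -- sides are the neighbourhoods of u and v, for any edge uv.
  module RankTwo {B} (adjB : IsAdjacencyMatrix B) (2≉0 : ¬ 1# + 1# ≈ 0#)
                 (rankTwo : ∀ {u v} → Adj G u v → RankTwoFormula B u v) where
    open IsAdjacencyMatrix adjB

    formula : ∀ {u v} → Adj G u v → ∀ i j → B i j ≈ B i v * B u j + B i u * B v j
    formula {u} {v} uv i j = ≈-trans (rankTwo uv i j)
      (+-cong (*-congʳ (≈-trans (*-congˡ (adjacent-1 (adj-sym u v uv))) (*-identityʳ (B i v))))
              (*-congʳ (≈-trans (*-congˡ (adjacent-1 uv)) (*-identityʳ (B i u)))))

    -- In a triangle the formula would give the diagonal entry `B i i` the value 1 + 1. In
    -- characteristic two a triangle does have rank two.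
    no-triangle : ∀ {u v i} → Adj G u v → Adj G i u → ¬ Adj G i v
    no-triangle {u} {v} {i} uv iu iv = 2≉0 (begin
      1# + 1#                          ≈⟨ +-cong (*-identityˡ 1#) (*-identityˡ 1#) ⟨
      1# * 1# + 1# * 1#                ≈⟨ +-cong (*-cong (adjacent-1 iv) (adjacent-1 (adj-sym i u iu)))
                                                 (*-cong (adjacent-1 iu) (adjacent-1 (adj-sym i v iv))) ⟨
      B i v * B u i + B i u * B v i    ≈⟨ formula uv i i ⟨
      B i i                            ≈⟨ nonadjacent-0 (adj-irrefl i) ⟩
      0#                               ∎)

    -- In the formula for `B i j` one product is 1, and the other vanishes because an edge iu would
    -- close a triangle.
    cross : ∀ {u v i j} → Adj G u v → Adj G i v → Adj G u j → Adj G i j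
    cross {u} {v} {i} {j} uv iv uj with adjacent? i j
    ... | yes ij = ij
    ... | no ¬ij = contradiction (begin
      1#                               ≈⟨ ≈-trans (+-congʳ (*-identityˡ 1#)) (+-identityʳ 1#) ⟨
      1# * 1# + 0#                     ≈⟨ +-cong (*-cong (adjacent-1 iv) (adjacent-1 uj))
                                                 (zero-left (nonadjacent-0 (λ iu → no-triangle uv iu iv))) ⟨
      B i v * B u j + B i u * B v j    ≈⟨ formula uv i j ⟨
      B i j                            ≈⟨ nonadjacent-0 ¬ij ⟩
      0#                               ∎) 1≉0

    -- As `B i j` is 1, the two products of the formula cannot both vanish.
    sides : ∀ {u v i j} → Adj G u v → Adj G i j → (Adj G i v × Adj G u j) ⊎ (Adj G i u × Adj G v j)
    sides {u} {v} {i} {j} uv ij with adjacent? i v ×-dec adjacent? u j | adjacent? i u ×-dec adjacent? v j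
    ... | yes p | _     = inj₁ p
    ... | _     | yes q = inj₂ q
    ... | no ¬p | no ¬q = contradiction (begin
      1#                               ≈⟨ adjacent-1 ij ⟨
      B i j                            ≈⟨ formula uv i j ⟩
      B i v * B u j + B i u * B v j    ≈⟨ +-cong (product≈0 ¬p) (product≈0 ¬q) ⟩
      0# + 0#                          ≈⟨ +-identityˡ 0# ⟩
      0#                               ∎) 1≉0
      where
      product≈0 : ∀ {a b c d} → ¬ (Adj G a b × Adj G c d) → B a b * B c d ≈ 0#
      product≈0 {a} {b} {c} {d} ¬both with adjacent? a b
      ... | yes ab = zero-right (nonadjacent-0 (λ cd → ¬both (ab , cd)))
      ... | no ¬ab = zero-left (nonadjacent-0 ¬ab)

    Other? : ∀ u v → Decidable (λ i → Adj G i v × i ≢ u)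
    Other? u v i = adjacent? i v ×-dec ¬? (i Fin.≟ u)

    -- Together with u these are the neighbours of v, the side of the bipartition that contains u.
    others : Fin n → Fin n → List (Fin n)
    others u v = filter (Other? u v) (allFin n)

    ∈-others⁺ : ∀ {u v i} → Adj G i v → i ≢ u → i ∈ others u v
    ∈-others⁺ {u} {v} {i} iv i≢u = ∈-filter⁺ (Other? u v) (∈-allFin i) (iv , i≢u)

    ∈-others⁻ : ∀ {u v i} → i ∈ others u v → Adj G i v × i ≢ u
    ∈-others⁻ {u} {v} i∈ = proj₂ (∈-filter⁻ (Other? u v) {xs = allFin n} i∈)

    -- By `sides` every edge has an endpoint adjacent to v. The side of u is thus a vertex cover,
    -- and each of its vertices costs rank two.
    neighbourhood-cover : ∀ {A u v} → IsGainMatrix A → Adj G u v → Factor A (suc (length (others u v)) ℕ.* 2)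
    neighbourhood-cover {A} {u} {v} gA uv = factor-cover (u ∷ others u v) A λ i j i∉ j∉ → nonadjacent gA λ ij →
      [ (λ (iv , _) → i∉ (neighbour iv)) , (λ (_ , vj) → j∉ (neighbour (adj-sym v j vj))) ] (sides uv ij)
      where
      neighbour : ∀ {i} → Adj G i v → i ∈ (u ∷ others u v)
      neighbour {i} iv with i Fin.≟ u
      ... | yes i≡u = here i≡u
      ... | no  i≢u = there (∈-others⁺ iv i≢u)

    -- The edges at u or v generate the connectivity; every further edge is
    -- redundant. There is one at y for each element of others u v, and xy′.
    others<cyclomatic : ∀ {u v x y y′ t} → Adj G u v → x ∈ others u v → y ∈ others v u → y′ ∈ others v u →
      y ≢ y′ → IsCyclomatic G t → suc (length (others u v)) ℕ.≤ t
    others<cyclomatic {u} {v} {x} {y} {y′} {t} uv x∈ y∈ y′∈ y≢y′ cyc = ℕ.≤-trans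
      (subst (ℕ._≤ length (filter (∁? incident?) (edges G))) (cong suc (List.length-map (λ i → edge i y) (others u v)))
        (unique-⊆⇒length≤ unique ⊆redundant))
      (redundant-edges≤ G incident? cyc generates)
      where
      Centre : Fin n → Set
      Centre i = i ≡ u ⊎ i ≡ v

      centre? : Decidable Centre
      centre? i = (i Fin.≟ u) ⊎-dec (i Fin.≟ v)

      Incident : Fin n × Fin n → Set
      Incident (i , j) = Centre i ⊎ Centre j

      incident? : Decidable Incident
      incident? (i , j) = centre? i ⊎-dec centre? j

      incident-edge⁺ : ∀ {i j} → Centre i ⊎ Centre j → Incident (edge i j)
      incident-edge⁺ {i} {j} c with i Fin.<? j
      ... | yes _ = c
      ... | no  _ = swap c

      incident-edge⁻ : ∀ {i j} → Incident (edge i j) → Centre i ⊎ Centre j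
      incident-edge⁻ {i} {j} c with i Fin.<? j
      ... | yes _ = c
      ... | no  _ = swap c

      kept : ∀ {i j} → Adj G i j → Centre i ⊎ Centre j → Joined (filter incident? (edges G)) i j
      kept {i} {j} ij c = edge-∈⇒joined i j (∈-filter⁺ incident? (∈-edges⁺ G ij) (incident-edge⁺ c))

      generates : ∀ {i j} → Adj G i j → Star (Joined (filter incident? (edges G))) i j
      generates ij with sides uv ij
      ... | inj₁ (iv , uj) = kept iv (inj₂ (inj₂ refl)) ◅ kept (adj-sym u v uv) (inj₁ (inj₂ refl)) ◅ kept uj (inj₁ (inj₁ refl)) ◅ nil
      ... | inj₂ (iu , vj) = kept iu (inj₂ (inj₁ refl)) ◅ kept uv (inj₁ (inj₁ refl)) ◅ kept vj (inj₁ (inj₂ refl)) ◅ nil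

      ∈-others⇒¬centre : ∀ {a b i} → (∀ {j} → Centre j → j ≡ a ⊎ j ≡ b) → i ∈ others a b → ¬ Centre i
      ∈-others⇒¬centre sub i∈ c with ∈-others⁻ i∈ | sub c
      ... | _ , i≢a | inj₁ i≡a  = i≢a i≡a
      ... | ib , _  | inj₂ refl = adj-irrefl _ ib

      ∈-redundant : ∀ {i j} → i ∈ others u v → j ∈ others v u → edge i j ∈ filter (∁? incident?) (edges G)
      ∈-redundant {i} {j} i∈ j∈ = ∈-filter⁺ (∁? incident?)
        (∈-edges⁺ G (cross uv (proj₁ (∈-others⁻ i∈)) (adj-sym j u (proj₁ (∈-others⁻ j∈)))))
        λ inc → [ ∈-others⇒¬centre id i∈ , ∈-others⇒¬centre swap j∈ ] (incident-edge⁻ inc)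

      edges-at-y : List (Fin n × Fin n)
      edges-at-y = map (λ i → edge i y) (others u v)

      ⊆redundant : ∀ {e} → e ∈ (edge x y′ ∷ edges-at-y) → e ∈ filter (∁? incident?) (edges G)
      ⊆redundant (here refl) = ∈-redundant x∈ y′∈
      ⊆redundant (there e∈) with ∈-map⁻ (λ i → edge i y) e∈
      ... | i , i∈ , refl = ∈-redundant i∈ y∈

      edge-cancel : ∀ {i j} → edge i y ≡ edge j y → i ≡ j
      edge-cancel {i} {j} eq with edge-injective i y j y eq
      ... | inj₁ (i≡j , _)   = i≡j
      ... | inj₂ (i≡y , y≡j) = trans i≡y y≡j

      unique : Unique (edge x y′ ∷ edges-at-y)
      unique = All.tabulate fresh ∷ Unique.map⁺ edge-cancel (Unique.filter⁺ (Other? u v) (Unique.allFin⁺ n))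
        where
        fresh : ∀ {e} → e ∈ edges-at-y → edge x y′ ≢ e
        fresh e∈ eq with ∈-map⁻ (λ i → edge i y) e∈
        ... | i , _ , refl with edge-injective x y′ i y eq
        -- Reversed coincidence would mean x = y, a common neighbour of u and v.
        ...   | inj₁ (_ , y′≡y) = y≢y′ (sym y′≡y)
        ...   | inj₂ (refl , _) = no-triangle uv (proj₁ (∈-others⁻ y∈)) (proj₁ (∈-others⁻ x∈))

    -- The cover gives 2(t + 1) ≤ 2p for each side, p being its size, so t < p and both sides have a
    -- second vertex. A third vertex on one side would give p ≤ t for the other by
    -- `others<cyclomatic`.
    extremal⇒fourCycle : ∀ {A r t u v} → IsGainMatrix A → (∀ {k} → Factor A k → r ℕ.≤ k) → IsCyclomatic G t →
      r ≡ suc t ℕ.* 2 → 1 ℕ.≤ t → Adj G u v → ∃₂ λ x y → IsFourCycle u v x y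
    extremal⇒fourCycle {A} {r} {t} {u} {v} gA r≤ cyc r≡ 1≤t uv =
      let x , x∈ = nonempty (others u v) (ℕ.≤-trans 1≤t (t≤ uv))
          y , y∈ = nonempty (others v u) (ℕ.≤-trans 1≤t (t≤ (adj-sym u v uv)))
          xv , x≢u = ∈-others⁻ x∈
          yu , y≢v = ∈-others⁻ y∈
          side-v : ∀ {i} → Adj G i v → i ≡ u ⊎ i ≡ x
          side-v {i} iv = side uv x∈ y∈ iv
          side-u : ∀ {j} → Adj G j u → j ≡ v ⊎ j ≡ y
          side-u {j} ju = side (adj-sym u v uv) y∈ x∈ ju
      in x , y , record
        { uv = uv ; vx = adj-sym x v xv ; xy = cross uv xv (adj-sym y u yu) ; yu = yu
        ; u≢x = x≢u ∘ sym ; v≢y = y≢v ∘ sym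
        ; only = λ {i} {j} ij → Sum.map (λ (iv , uj) → side-v iv , side-u (adj-sym u j uj))
                                        (λ (iu , vj) → side-u iu , side-v (adj-sym v j vj)) (sides uv ij)
        }
      where
      t≤ : ∀ {u v} → Adj G u v → t ℕ.≤ length (others u v)
      t≤ {u} {v} uv = ℕ.s≤s⁻¹ (ℕ.*-cancelʳ-≤ (suc t) (suc (length (others u v))) 2
        (subst (ℕ._≤ suc (length (others u v)) ℕ.* 2) r≡ (r≤ (neighbourhood-cover gA uv))))

      nonempty : ∀ (xs : List (Fin n)) → 1 ℕ.≤ length xs → ∃ (_∈ xs)
      nonempty (x ∷ _) _ = x , here refl

      side : ∀ {u v x y i} → Adj G u v → x ∈ others u v → y ∈ others v u → Adj G i v → i ≡ u ⊎ i ≡ x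
      side {u} {v} {x} {y} {i} uv x∈ y∈ iv with i Fin.≟ u | i Fin.≟ x
      ... | yes i≡u | _       = inj₁ i≡u
      ... | _       | yes i≡x = inj₂ i≡x
      ... | no i≢u  | no i≢x  = contradiction (t≤ (adj-sym u v uv))
        (ℕ.<⇒≱ (others<cyclomatic (adj-sym u v uv) y∈ x∈ (∈-others⁺ iv i≢u) (i≢x ∘ sym) cyc))

-- Ranks of complex unit gain graphs

ℂ-isWeakField : IsWeakField ℂ-commutativeRing
ℂ-isWeakField = record { ≈-stable = ℂ-stable ; invertible = ℂ-invertible ; 1≉0 = ℂ-1≉0 }

open LinearAlgebra ℂ-commutativeRing ℂ-isWeakField using (Factor; independent⇒∣S∣≤; maximal-independent⇒factor)
module ℂ-ring = CommutativeRing ℂ-commutativeRing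

rank≤factor : ∀ {m n} {A : Matrix m n} {r k} → HasRank A r → Factor A k → r ℕ.≤ k
rank≤factor {k = k} rank fA = let S , ∣S∣≡r , ind = HasRank.attained rank
                      in subst (ℕ._≤ k) ∣S∣≡r (independent⇒∣S∣≤ {S = S} ind fA)

rank⇒factor : ∀ {m n} {A : Matrix m n} {r} → HasRank A r → ¬ ¬ Factor A r
rank⇒factor {A = A} {r} rank ¬factor with HasRank.attained rank
... | S , refl , ind = maximal-independent⇒factor {S = S} ind (HasRank.maximal rank) ¬factor

≤-via-rank : ∀ {m n} {A : Matrix m n} {r a b} → HasRank A r → (Factor A r → a ℕ.≤ b) → a ℕ.≤ b
≤-via-rank {a = a} {b} rank bound = decidable-stable (a ℕ.≤? b) λ ≰ → rank⇒factor rank (≰ ∘ bound)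

module _ {n : ℕ} (Φ : GainGraph n) where
  open GainGraph Φ
  open SimpleGraph graph using (adj-sym)
  open GainMatrices ℂ-commutativeRing ℂ-isWeakField graph

  adjacencyMatrix-isAdjacencyMatrix : IsAdjacencyMatrix (adjacencyMatrix graph)
  adjacencyMatrix-isAdjacencyMatrix = record { adjacent-1 = one ; nonadjacent-0 = zero′ }
    where
    one : ∀ {i j} → Adj graph i j → adjacencyMatrix graph i j ℂᵣ.≈ ℂᵣ.1#
    one {i} {j} ij with T? (SimpleGraph.adj graph i j)
    ... | yes _  = ℂ-ring.refl {ℂᵣ.1#}
    ... | no ¬ij = contradiction ij ¬ij
    zero′ : ∀ {i j} → ¬ Adj graph i j → adjacencyMatrix graph i j ℂᵣ.≈ ℂᵣ.0#
    zero′ {i} {j} ¬ij with T? (SimpleGraph.adj graph i j)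
    ... | yes ij = contradiction ij ¬ij
    ... | no _   = ℂ-ring.refl {ℂᵣ.0#}

  -- `gainMatrix` evaluates φ at the adjacency proof found by `T?`; all such proofs are equal.
  gainMatrix-adjacent : ∀ {i j} (ij : Adj graph i j) → gainMatrix Φ i j ≡ φ i j ij
  gainMatrix-adjacent {i} {j} ij with T? (SimpleGraph.adj graph i j)
  ... | yes ij′ = cong (φ i j) (T-irrelevant ij′ ij)
  ... | no ¬ij  = contradiction ij ¬ij

  gainMatrix-isGainMatrix : IsGainMatrix (gainMatrix Φ)
  gainMatrix-isGainMatrix = record { nonadjacent = zero′ ; reciprocal = λ {i} {j} → reciprocal i j }
    where
    zero′ : ∀ {i j} → ¬ Adj graph i j → gainMatrix Φ i j ℂᵣ.≈ ℂᵣ.0#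
    zero′ {i} {j} ¬ij with T? (SimpleGraph.adj graph i j)
    ... | yes ij = contradiction ij ¬ij
    ... | no _   = ℂ-ring.refl {ℂᵣ.0#}
    reciprocal : ∀ i j → Adj graph i j → (gainMatrix Φ i j ℂᵣ.* gainMatrix Φ j i) ℂᵣ.≈ ℂᵣ.1#
    reciprocal i j ij
      rewrite gainMatrix-adjacent ij | gainMatrix-adjacent (adj-sym i j ij) =
      ℂ-ring.trans {φ i j ij ℂᵣ.* φ j i ji} {φ i j ij ℂᵣ.* conj (φ i j ij)} {ℂᵣ.1#}
        (ℂ-ring.*-congˡ {φ i j ij} {φ j i ji} {conj (φ i j ij)} (φ-reverse i j ij ji))
        (modulusOne⇒*conj≈1 (φ i j ij) (φ-unit i j ij))
      where ji = adj-sym i j ij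

  cycleGain≡ : (C : Cycle graph 4) → let open Cycle C in
    let e = λ i → gainMatrix Φ (vertex i) (vertex (next i)) in
    cycleGain Φ C ≡ e zero ℂᵣ.* (e (suc zero) ℂᵣ.* (e (suc (suc zero)) ℂᵣ.* (e (suc (suc (suc zero))) ℂᵣ.* ℂᵣ.1#)))
  cycleGain≡ C = sym (cong₂ ℂᵣ._*_ (at zero) (cong₂ ℂᵣ._*_ (at (suc zero)) (cong₂ ℂᵣ._*_ (at (suc (suc zero)))
    (cong₂ ℂᵣ._*_ (at (suc (suc (suc zero)))) refl))))
    where
    at : ∀ i → _ ≡ _
    at i = gainMatrix-adjacent (Cycle.adjacent C i)

  -- The Type A value for length four is 1, so Type B says that `gainOf` differs from 1.
  [-1]²≈1 : ((ℂᵣ.- ℂᵣ.1#) ℂᵣ.^ 2) ℂᵣ.≈ ℂᵣ.1#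
  [-1]²≈1 = ≗⇒≃ {re ((ℂᵣ.- ℂᵣ.1#) ℂᵣ.^ 2)} {1ᴿ} (λ _ → refl) , ≗⇒≃ {im ((ℂᵣ.- ℂᵣ.1#) ℂᵣ.^ 2)} {0ᴿ} (λ _ → refl)

  cycleGain≈ : ∀ {u v x y} (C : Cycle graph 4) (C′ : IsFourCycle u v x y) →
    (∀ i → Cycle.vertex C i ≡ lookup (u ∷ v ∷ x ∷ y ∷ []) i) →
    cycleGain Φ C ℂᵣ.≈ gainOf C′ (gainMatrix Φ)
  cycleGain≈ {u} {v} {x} {y} C C′ eq = ℂ-ring.trans
    {cycleGain Φ C} {A u v ℂᵣ.* (A v x ℂᵣ.* (A x y ℂᵣ.* (A y u ℂᵣ.* ℂᵣ.1#)))} {gainOf C′ A}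
    (ℂ-ring.reflexive (trans (cycleGain≡ C) (cong₂ ℂᵣ._*_ (at zero)
      (cong₂ ℂᵣ._*_ (at (suc zero)) (cong₂ ℂᵣ._*_ (at (suc (suc zero)))
        (cong₂ ℂᵣ._*_ (at (suc (suc (suc zero)))) refl))))))
    (ℂ-ring.*-congˡ {A u v} {A v x ℂᵣ.* (A x y ℂᵣ.* (A y u ℂᵣ.* ℂᵣ.1#))} {A v x ℂᵣ.* (A x y ℂᵣ.* A y u)}
      (ℂ-ring.*-congˡ {A v x} {A x y ℂᵣ.* (A y u ℂᵣ.* ℂᵣ.1#)} {A x y ℂᵣ.* A y u}
        (ℂ-ring.*-congˡ {A x y} {A y u ℂᵣ.* ℂᵣ.1#} {A y u} (ℂ-ring.*-identityʳ (A y u)))))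
    where
    A = gainMatrix Φ
    at : ∀ i → A (Cycle.vertex C i) (Cycle.vertex C (next i)) ≡
               A (lookup (u ∷ v ∷ x ∷ y ∷ []) i) (lookup (u ∷ v ∷ x ∷ y ∷ []) (next i))
    at i = cong₂ A (eq i) (eq (next i))

  toFourCycle : (C : Cycle graph 4) → OnlyEdges Φ C → let open Cycle C in
    IsFourCycle (vertex zero) (vertex (suc zero)) (vertex (suc (suc zero))) (vertex (suc (suc (suc zero))))
  toFourCycle C only = record
    { uv = adjacent zero ; vx = adjacent (suc zero) ; xy = adjacent (suc (suc zero)) ; yu = adjacent (suc (suc (suc zero)))
    ; u≢x = λ eq → contradiction (injective eq) λ ()
    ; v≢y = λ eq → contradiction (injective eq) λ ()
    ; only = λ {i} {j} ij → sides (only i j ij)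
    }
    where
    open Cycle C
    U = vertex zero
    V = vertex (suc zero)
    X = vertex (suc (suc zero))
    Y = vertex (suc (suc (suc zero)))

    sides : ∀ {i j} → (∃ λ s → (i ≡ vertex s × j ≡ vertex (next s)) ⊎ (j ≡ vertex s × i ≡ vertex (next s))) →
            ((i ≡ U ⊎ i ≡ X) × (j ≡ V ⊎ j ≡ Y)) ⊎ ((i ≡ V ⊎ i ≡ Y) × (j ≡ U ⊎ j ≡ X))
    sides (zero               , inj₁ (p , q)) = inj₁ (inj₁ p , inj₁ q)
    sides (zero               , inj₂ (p , q)) = inj₂ (inj₁ q , inj₁ p)
    sides (suc zero           , inj₁ (p , q)) = inj₂ (inj₁ p , inj₂ q)
    sides (suc zero           , inj₂ (p , q)) = inj₁ (inj₂ q , inj₁ p)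
    sides (suc (suc zero)     , inj₁ (p , q)) = inj₁ (inj₂ p , inj₂ q)
    sides (suc (suc zero)     , inj₂ (p , q)) = inj₂ (inj₂ q , inj₂ p)
    sides (suc (suc (suc zero)) , inj₁ (p , q)) = inj₂ (inj₂ p , inj₁ q)
    sides (suc (suc (suc zero)) , inj₂ (p , q)) = inj₁ (inj₁ q , inj₂ p)

  fromFourCycle : ∀ {u v x y} → IsFourCycle u v x y → Cycle graph 4
  fromFourCycle C = record
    { 3≤k       = ℕ.s≤s (ℕ.s≤s (ℕ.s≤s ℕ.z≤n))
    ; vertex    = lookup cycle-vertices
    ; injective = λ {i} {j} → lookup-injective cycle-vertices-unique i j
    ; adjacent  = λ { zero → uv ; (suc zero) → vx ; (suc (suc zero)) → xy ; (suc (suc (suc zero))) → yu }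
    }
    where open IsFourCycle C

  fromFourCycle-onlyEdges : ∀ {u v x y} (C : IsFourCycle u v x y) → OnlyEdges Φ (fromFourCycle C)
  fromFourCycle-onlyEdges C i j ij with IsFourCycle.only C ij
  ... | inj₁ (inj₁ p , inj₁ q) = zero , inj₁ (p , q)
  ... | inj₁ (inj₁ p , inj₂ q) = suc (suc (suc zero)) , inj₂ (q , p)
  ... | inj₁ (inj₂ p , inj₁ q) = suc zero , inj₂ (q , p)
  ... | inj₁ (inj₂ p , inj₂ q) = suc (suc zero) , inj₁ (p , q)
  ... | inj₂ (inj₁ p , inj₁ q) = zero , inj₂ (q , p)
  ... | inj₂ (inj₁ p , inj₂ q) = suc zero , inj₁ (p , q)
  ... | inj₂ (inj₂ p , inj₁ q) = suc (suc (suc zero)) , inj₁ (p , q)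
  ... | inj₂ (inj₂ p , inj₂ q) = suc (suc zero) , inj₂ (q , p)

  module _ {rΦ rG t : ℕ} (hΦ : HasRank (gainMatrix Φ) rΦ) (hG : HasRank (adjacencyMatrix graph) rG)
           (cyc : IsCyclomatic graph t) where

    private
      gΦ : IsGainMatrix (gainMatrix Φ)
      gΦ = gainMatrix-isGainMatrix
      aG : IsAdjacencyMatrix (adjacencyMatrix graph)
      aG = adjacencyMatrix-isAdjacencyMatrix
      gG : IsGainMatrix (adjacencyMatrix graph)
      gG = IsAdjacencyMatrix.isGainMatrix aG

    rΦ≤rG+2θ : rΦ ℕ.≤ rG ℕ.+ t ℕ.* 2
    rΦ≤rG+2θ = ≤-via-rank hG λ fG → rank≤factor hΦ (switch gG gΦ cyc fG)

    rG≤rΦ+2θ : rG ℕ.≤ rΦ ℕ.+ t ℕ.* 2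
    rG≤rΦ+2θ = ≤-via-rank hΦ λ fΦ → rank≤factor hG (switch gΦ gG cyc fΦ)

    2≤rΦ : HasEdge graph → 2 ℕ.≤ rΦ
    2≤rΦ (u , v , uv) = ≤-via-rank hΦ (edge⇒2≤ gΦ uv)

    2≤rG : HasEdge graph → 2 ℕ.≤ rG
    2≤rG (u , v , uv) = ≤-via-rank hG (edge⇒2≤ gG uv)

    acyclic⇒t≡0 : Acyclic graph → t ≡ 0
    acyclic⇒t≡0 acyc = acyclic⇒cyclomatic≡0 graph acyc cyc

    t≡0⇒acyclic : t ≡ 0 → Acyclic graph
    t≡0⇒acyclic t≡0 = cyclomatic≡0⇒acyclic graph (subst (IsCyclomatic graph) t≡0 cyc)

    acyclic⇒rΦ≡rG : Acyclic graph → rΦ ≡ rG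
    acyclic⇒rΦ≡rG acyc with acyclic⇒t≡0 acyc
    ... | refl = ℕ.≤-antisym (subst (rΦ ℕ.≤_) (ℕ.+-identityʳ rG) rΦ≤rG+2θ)
                             (subst (rG ℕ.≤_) (ℕ.+-identityʳ rΦ) rG≤rΦ+2θ)

    extremal⇒typeB : HasEdge graph → rG ≡ 2 → rΦ ≡ suc t ℕ.* 2 → 1 ℕ.≤ t → IsTypeBFourCycleWithIsolatedVertices Φ
    extremal⇒typeB (u , v , uv) refl rΦ≡ 1≤t =
      let x , y , C = RankTwo.extremal⇒fourCycle aG ℂ-2≉0 (factor-2⇒formula gG (rank⇒factor hG))
                        gΦ (rank≤factor hΦ) cyc rΦ≡ 1≤t uv
      in fromFourCycle C , (divides 2 refl , not-type-A C) , fromFourCycle-onlyEdges C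
      where
      -- Gain 1 would give rank two by the formula, but the rank is 2(t + 1) ≥ 4.
      not-type-A : ∀ {x y} (C : IsFourCycle u v x y) → ¬ cycleGain Φ (fromFourCycle C) ℂᵣ.≈ ((ℂᵣ.- ℂᵣ.1#) ℂᵣ.^ 2)
      not-type-A C gain≈ = contradiction (begin
        4              ≤⟨ ℕ.*-monoˡ-≤ 2 (ℕ.s≤s 1≤t) ⟩
        suc t ℕ.* 2    ≡⟨ rΦ≡ ⟨
        rΦ             ≤⟨ rank≤factor hΦ (formula⇒factor-2 (fourCycle-formula C gΦ gain≈1)) ⟩
        2              ∎) λ { (ℕ.s≤s (ℕ.s≤s ())) }
        where
        open ℕ.≤-Reasoning
        gain≈1 : gainOf C (gainMatrix Φ) ℂᵣ.≈ ℂᵣ.1#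
        gain≈1 = ℂ-ring.trans {gainOf C (gainMatrix Φ)} {cycleGain Φ (fromFourCycle C)} {ℂᵣ.1#}
          (ℂ-ring.sym {cycleGain Φ (fromFourCycle C)} {gainOf C (gainMatrix Φ)}
            (cycleGain≈ (fromFourCycle C) C λ _ → refl))
          (ℂ-ring.trans {cycleGain Φ (fromFourCycle C)} {(ℂᵣ.- ℂᵣ.1#) ℂᵣ.^ 2} {ℂᵣ.1#} gain≈ [-1]²≈1)

    typeB⇒extremal : IsTypeBFourCycleWithIsolatedVertices Φ → rG ≡ 2 × rΦ ≡ 4 × t ≡ 1
    typeB⇒extremal (C , (_ , not-type-A) , only) = rG≡2 , rΦ≡4 , t≡1
      where
      open Cycle C
      C′ = toFourCycle C only

      gain≉1 : ¬ gainOf C′ (gainMatrix Φ) ℂᵣ.≈ ℂᵣ.1#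
      gain≉1 gain≈1 = not-type-A (ℂ-ring.trans {cycleGain Φ C} {gainOf C′ (gainMatrix Φ)} {(ℂᵣ.- ℂᵣ.1#) ℂᵣ.^ 2}
        (cycleGain≈ C C′ λ { zero → refl ; (suc zero) → refl ; (suc (suc zero)) → refl ; (suc (suc (suc zero))) → refl })
        (ℂ-ring.trans {gainOf C′ (gainMatrix Φ)} {ℂᵣ.1#} {(ℂᵣ.- ℂᵣ.1#) ℂᵣ.^ 2} gain≈1
          (ℂ-ring.sym {(ℂᵣ.- ℂᵣ.1#) ℂᵣ.^ 2} {ℂᵣ.1#} [-1]²≈1)))

      rG≡2 : rG ≡ 2
      rG≡2 = ℕ.≤-antisym
        (rank≤factor hG (formula⇒factor-2 (fourCycle-formula C′ gG (adjacency-gain≈1 C′ aG))))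
        (2≤rG (_ , _ , adjacent zero))

      4≤rΦ : 4 ℕ.≤ rΦ
      4≤rΦ = ≤-via-rank hΦ (fourCycle-nonsingular C′ gΦ gain≉1)

      rΦ≤2+2t : rΦ ℕ.≤ suc t ℕ.* 2
      rΦ≤2+2t = subst (λ g → rΦ ℕ.≤ g ℕ.+ t ℕ.* 2) rG≡2 rΦ≤rG+2θ

      -- The lower bound on t is read off from the ranks: 4 ≤ rΦ ≤ 2 + 2t.
      t≡1 : t ≡ 1
      t≡1 = ℕ.≤-antisym (fourCycle-cyclomatic≤1 C′ cyc)
        (ℕ.s≤s⁻¹ (ℕ.*-cancelʳ-≤ 2 (suc t) 2 (ℕ.≤-trans 4≤rΦ rΦ≤2+2t)))

      rΦ≡4 : rΦ ≡ 4
      rΦ≡4 = ℕ.≤-antisym (subst (λ s → rΦ ℕ.≤ suc s ℕ.* 2) t≡1 rΦ≤2+2t) 4≤rΦ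

    upper⇔ : HasEdge graph → rΦ ≡ suc t ℕ.* rG ⇔ (Acyclic graph ⊎ IsTypeBFourCycleWithIsolatedVertices Φ)
    upper⇔ e = mk⇔ to [ (λ acyc → trans (acyclic⇒rΦ≡rG acyc)
                                   (sym (trans (cong (λ s → suc s ℕ.* rG) (acyclic⇒t≡0 acyc)) (ℕ.+-identityʳ rG))))
                      , (λ typeB → let rG≡2 , rΦ≡4 , t≡1 = typeB⇒extremal typeB
                                   in trans rΦ≡4 (sym (cong₂ (λ s g → suc s ℕ.* g) t≡1 rG≡2))) ]
      where
      to : rΦ ≡ suc t ℕ.* rG → Acyclic graph ⊎ IsTypeBFourCycleWithIsolatedVertices Φ
      to rΦ≡ with t ℕ.≟ 0
      ... | yes t≡0 = inj₁ (t≡0⇒acyclic t≡0)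
      ... | no  t≢0 = inj₂ (extremal⇒typeB e rG≡2 (trans rΦ≡ (cong (suc t ℕ.*_) rG≡2)) (ℕ.n≢0⇒n>0 t≢0))
        where
        instance
          t-nonZero : NonZero t
          t-nonZero = ℕ.≢-nonZero t≢0
        -- From rG + t rG = rΦ ≤ rG + 2t follows t rG ≤ 2t, and t is positive.
        rG≡2 : rG ≡ 2
        rG≡2 = ℕ.≤-antisym
          (ℕ.*-cancelˡ-≤ t (ℕ.+-cancelˡ-≤ rG _ _ (subst (ℕ._≤ rG ℕ.+ t ℕ.* 2) rΦ≡ rΦ≤rG+2θ))) (2≤rG e)

    lower⇔ : HasEdge graph → rG ≡ rΦ ℕ.+ t ℕ.* rG ⇔ Acyclic graph
    lower⇔ e = mk⇔ to λ acyc → sym (trans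
        (cong₂ (λ r s → r ℕ.+ s ℕ.* rG) (acyclic⇒rΦ≡rG acyc) (acyclic⇒t≡0 acyc)) (ℕ.+-identityʳ rG))
      where
      to : rG ≡ rΦ ℕ.+ t ℕ.* rG → Acyclic graph
      to rG≡ with t ℕ.≟ 0
      ... | yes t≡0 = t≡0⇒acyclic t≡0
      -- With t ≥ 1 the right-hand side is at least rΦ + rG, which exceeds rG because rΦ is
      -- positive.
      ... | no  t≢0 = contradiction (begin
        1 ℕ.+ rG               ≤⟨ ℕ.+-monoˡ-≤ rG (ℕ.≤-trans (ℕ.s≤s ℕ.z≤n) (2≤rΦ e)) ⟩
        rΦ ℕ.+ rG              ≡⟨ cong (rΦ ℕ.+_) (ℕ.*-identityˡ rG) ⟨
        rΦ ℕ.+ 1 ℕ.* rG        ≤⟨ ℕ.+-monoʳ-≤ rΦ (ℕ.*-monoˡ-≤ rG (ℕ.n≢0⇒n>0 t≢0)) ⟩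
        rΦ ℕ.+ t ℕ.* rG        ≡⟨ rG≡ ⟨
        rG                     ∎) ℕ.1+n≰n
        where open ℕ.≤-Reasoning

-- Ratios of ranks as rational numbers

open import Data.Rational using (_/_; _+_; _-_; _≤_)

-- The fraction `_/_` normalises by a gcd. Among unnormalised rationals the sum is an explicit
-- formula and equality is cross multiplication.
1+z/1 : ∀ z → 1ℚ + z / 1 ≡ (+ 1 ℤ.+ z) / 1
1+z/1 z = ℚ.toℚᵘ-injective (begin
  ℚ.toℚᵘ (1ℚ + z / 1)                  ≈⟨ ℚ.toℚᵘ-homo-+ 1ℚ (z / 1) ⟩
  ℚᵘ.1ℚᵘ ℚᵘ.+ ℚ.toℚᵘ (z / 1)           ≈⟨ ℚᵘ.+-congʳ ℚᵘ.1ℚᵘ (ℚ.toℚᵘ-fromℚᵘ (ℚᵘ.mkℚᵘ z 0)) ⟩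
  ℚᵘ.1ℚᵘ ℚᵘ.+ ℚᵘ.mkℚᵘ z 0              ≈⟨ ℚᵘ.*≡* (cong (ℤ._* + 1) (cong (λ w → + 1 ℤ.+ w) (ℤ.*-identityʳ z))) ⟩
  ℚᵘ.mkℚᵘ (+ 1 ℤ.+ z) 0                ≈⟨ ℚ.toℚᵘ-fromℚᵘ (ℚᵘ.mkℚᵘ (+ 1 ℤ.+ z) 0) ⟨
  ℚ.toℚᵘ ((+ 1 ℤ.+ z) / 1)             ∎)
  where open SetoidReasoning ℚᵘ.≃-setoid

-[z/1] : ∀ z → ℚ.- (z / 1) ≡ (ℤ.- z) / 1
-[z/1] z = ℚ.toℚᵘ-injective (begin
  ℚ.toℚᵘ (ℚ.- (z / 1))     ≈⟨ ℚ.toℚᵘ-homo‿- (z / 1) ⟩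
  ℚᵘ.- ℚ.toℚᵘ (z / 1)      ≈⟨ ℚᵘ.-‿cong (ℚ.toℚᵘ-fromℚᵘ (ℚᵘ.mkℚᵘ z 0)) ⟩
  ℚᵘ.mkℚᵘ (ℤ.- z) 0        ≈⟨ ℚ.toℚᵘ-fromℚᵘ (ℚᵘ.mkℚᵘ (ℤ.- z) 0) ⟨
  ℚ.toℚᵘ ((ℤ.- z) / 1)     ∎)
  where open SetoidReasoning ℚᵘ.≃-setoid

fromℚᵘ-mono-≤ : ∀ {p q} → p ℚᵘ.≤ q → ℚ.fromℚᵘ p ≤ ℚ.fromℚᵘ q
fromℚᵘ-mono-≤ {p} {q} p≤q = ℚ.toℚᵘ-cancel-≤
  (ℚᵘ.≤-respˡ-≃ (ℚᵘ.≃-sym (ℚ.toℚᵘ-fromℚᵘ p)) (ℚᵘ.≤-respʳ-≃ (ℚᵘ.≃-sym (ℚ.toℚᵘ-fromℚᵘ q)) p≤q))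

-- With all terms moved so that no subtraction occurs, the comparisons of r / g
-- with 1 ± t become comparisons of natural numbers.
ratio-bounds : ∀ {P Q : Set} (r g t : ℕ) → 2 ℕ.≤ g → r ℕ.≤ g ℕ.+ t ℕ.* 2 → g ℕ.≤ r ℕ.+ t ℕ.* 2 →
  (r ≡ suc t ℕ.* g ⇔ P) → (g ≡ r ℕ.+ t ℕ.* g ⇔ Q) → ∀ z → z ≡ + t →
  Σ (NonZero g) λ g≢0 → let ratio = _/_ (+ r) g {{g≢0}} in
    (1ℚ - z / 1 ≤ ratio × ratio ≤ 1ℚ + z / 1) × (ratio ≡ 1ℚ + z / 1 ⇔ P) × (ratio ≡ 1ℚ - z / 1 ⇔ Q)
ratio-bounds {P} {Q} r g@(suc g-1) t 2≤g r≤ g≤ upper lower _ refl = _ ,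
    ( subst (_≤ + r / g) (sym 1-t) (fromℚᵘ-mono-≤ {1-tᵘ} {ratioᵘ} (ℚᵘ.*≤* (begin
        (+ 1 ℤ.- + t) ℤ.* + g       ≡⟨ [1-t]*g ⟩
        -- Here 2 ≤ g weakens g ≤ r + 2t to g ≤ r + t g; the upper bound is treated in the same way.
        + g ℤ.- + (t ℕ.* g)         ≤⟨ ℤ.+-monoˡ-≤ (ℤ.- + (t ℕ.* g)) (ℤ.+≤+ (ℕ.≤-trans g≤ (ℕ.+-monoʳ-≤ r (ℕ.*-monoʳ-≤ t 2≤g)))) ⟩
        + (r ℕ.+ t ℕ.* g) ℤ.- + (t ℕ.* g)  ≡⟨ r+tg-tg ⟩
        + r                         ≡⟨ ℤ.*-identityʳ (+ r) ⟨
        + r ℤ.* + 1                 ∎)))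
    , subst (+ r / g ≤_) (sym (1+z/1 (+ t))) (fromℚᵘ-mono-≤ {ratioᵘ} {1+tᵘ} (ℚᵘ.*≤* (begin
        + r ℤ.* + 1           ≡⟨ ℤ.*-identityʳ (+ r) ⟩
        + r                   ≤⟨ ℤ.+≤+ (ℕ.≤-trans r≤ (ℕ.+-monoʳ-≤ g (ℕ.*-monoʳ-≤ t 2≤g))) ⟩
        + (suc t ℕ.* g)       ≡⟨ ℤ.pos-* (suc t) g ⟩
        + suc t ℤ.* + g       ∎))) )
  , mk⇔ (λ eq → Equivalence.to upper (ℤ.+-injective (trans (sym (ℤ.*-identityʳ (+ r)))
          (trans (ℚᵘ.drop-*≡* (ℚ.fromℚᵘ-injective {ratioᵘ} {1+tᵘ} (trans eq (1+z/1 (+ t))))) (sym (ℤ.pos-* (suc t) g))))))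
        (λ p → trans (ℚ.fromℚᵘ-cong {ratioᵘ} {1+tᵘ} (ℚᵘ.*≡* (trans (ℤ.*-identityʳ (+ r))
          (trans (cong +_ (Equivalence.from upper p)) (ℤ.pos-* (suc t) g))))) (sym (1+z/1 (+ t))))
  , mk⇔ (λ eq → Equivalence.to lower (ℤ.+-injective (trans (sym g-tg+tg) (cong (λ w → w ℤ.+ + (t ℕ.* g))
          (trans (sym [1-t]*g) (trans (sym (ℚᵘ.drop-*≡* (ℚ.fromℚᵘ-injective {ratioᵘ} {1-tᵘ} (trans eq 1-t))))
            (ℤ.*-identityʳ (+ r))))))))
        (λ q → trans (ℚ.fromℚᵘ-cong {ratioᵘ} {1-tᵘ} (ℚᵘ.*≡* (trans (ℤ.*-identityʳ (+ r))
          (trans (sym r+tg-tg) (trans (cong (λ m → + m ℤ.- + (t ℕ.* g)) (sym (Equivalence.from lower q))) (sym [1-t]*g)))))) (sym 1-t))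
  where
  open ℤ.≤-Reasoning
  ratioᵘ 1+tᵘ 1-tᵘ : ℚᵘ.ℚᵘ
  ratioᵘ = ℚᵘ.mkℚᵘ (+ r) g-1
  1+tᵘ = ℚᵘ.mkℚᵘ (+ suc t) 0
  1-tᵘ = ℚᵘ.mkℚᵘ (+ 1 ℤ.- + t) 0

  1-t : 1ℚ - + t / 1 ≡ (+ 1 ℤ.- + t) / 1
  1-t = trans (cong (1ℚ ℚ.+_) (-[z/1] (+ t))) (1+z/1 (ℤ.- + t))

  [1-t]*g : (+ 1 ℤ.- + t) ℤ.* + g ≡ + g ℤ.- + (t ℕ.* g)
  [1-t]*g = trans (ℤ.*-distribʳ-+ (+ g) (+ 1) (ℤ.- + t)) (cong₂ ℤ._+_ (ℤ.*-identityˡ (+ g))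
    (trans (sym (ℤ.neg-distribˡ-* (+ t) (+ g))) (cong ℤ.-_ (sym (ℤ.pos-* t g)))))

  r+tg-tg : + (r ℕ.+ t ℕ.* g) ℤ.- + (t ℕ.* g) ≡ + r
  r+tg-tg = trans (ℤ.+-assoc (+ r) (+ (t ℕ.* g)) (ℤ.- + (t ℕ.* g)))
    (trans (cong (λ w → + r ℤ.+ w) (ℤ.+-inverseʳ (+ (t ℕ.* g)))) (ℤ.+-identityʳ (+ r)))

  g-tg+tg : + g ℤ.- + (t ℕ.* g) ℤ.+ + (t ℕ.* g) ≡ + g
  g-tg+tg = trans (ℤ.+-assoc (+ g) (ℤ.- + (t ℕ.* g)) (+ (t ℕ.* g)))
    (trans (cong (λ w → + g ℤ.+ w) (ℤ.+-inverseˡ (+ (t ℕ.* g)))) (ℤ.+-identityʳ (+ g)))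

theorem4p10 : (n : ℕ) (Φ : GainGraph n) →
    let G = GainGraph.graph Φ
        θG = θ G / 1
    in HasEdge G →
       (rΦ rG : ℕ) → HasRank (gainMatrix Φ) rΦ → HasRank (adjacencyMatrix G) rG →
       Σ (NonZero rG) λ rG≢0 →
         let ratio = _/_ (+ rΦ) rG {{rG≢0}}
         in (1ℚ - θG ≤ ratio × ratio ≤ 1ℚ + θG)
          × (ratio ≡ 1ℚ + θG ⇔ (Acyclic G ⊎ IsTypeBFourCycleWithIsolatedVertices Φ))
          × (ratio ≡ 1ℚ - θG ⇔ Acyclic G)
theorem4p10 n Φ e rΦ rG hΦ hG =
  let G = GainGraph.graph Φ
      t , cyc = cyclomatic-exists G
  in ratio-bounds rΦ rG t (2≤rG Φ hΦ hG cyc e) (rΦ≤rG+2θ Φ hΦ hG cyc) (rG≤rΦ+2θ Φ hΦ hG cyc)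
       (upper⇔ Φ hΦ hG cyc e) (lower⇔ Φ hΦ hG cyc e) (θ G) (cyclomatic⇒θ G cyc)
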